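{- The following hold: (i) The set of all quadratic algebraic integers in $\mathbb{C}\setminus\mathbb{R}$ is equal to the disjoint union $$\biguplus_{n \in \mathbb{Z},\ \varepsilon \in \{ -1,+1\}} \left(\varepsilon \hat{S}^{2,i} + n\right).$$ The set of all quadratic algebraic integers in $\mathbb{C}\setminus\mathbb{R}$ except those in $\mathbb{Q}(\sqrt{ -1})$ is equal to the disjoint union $$\biguplus_{n \in \mathbb{Z},\ \varepsilon \in \{ -1,+1\}} \left(\varepsilon S^{2,i} + n\right).$$ (In both cases disjointness means that the sets for distinct pairs $(n,\varepsilon)$ are pairwise disjoint.) (ii) In particular, $\hat{S}^{2,i}$ includes a primitive element (over $\mathbb{Q}$) of any imaginary quadratic field; $S^{2,i}$ includes a primitive element of any imaginary quadratic field except $\mathbb{Q}(\sqrt{ -1})$.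
   Context: A quadratic algebraic integer is an algebraic integer of degree exactly two over $\mathbb{Q}$. An imaginary quadratic field is a subfield of $\mathbb{C}$ of degree two over $\mathbb{Q}$ not contained in $\mathbb{R}$. For a positive integer $c$, $\sqrt{ -c}$ denotes $\sqrt{c}\,\sqrt{ -1}$ (the root with positive imaginary part), and likewise $\sqrt{1-4c} = \sqrt{4c-1}\,\sqrt{ -1}$. For an integer $n \ge 1$ define $$I_n^{2,i} := \left\{\tfrac{1+\sqrt{1-4c}}{2} \in \mathbb{C}\setminus\mathbb{R} \;\middle|\; c \in \mathbb{Z},\ \left(\tfrac{n-1}{2}\right)^2+1 \le c \le \left(\tfrac{n+1}{2}\right)^2\right\} \quad \text{if } n \text{ is odd},$$ $$I_n^{2,i} := \left\{\sqrt{ -c} \in \mathbb{C}\setminus\mathbb{R} \;\middle|\; c \in \mathbb{Z},\ \left(\tfrac{n}{2}\right)^2 < c < \left(\tfrac{n}{2}+1\right)^2\right\} \quad \text{if } n \text{ is even}.$$ Put $$S^{2,i} := \bigcup_{n \ge 1} I_n^{2,i}, \qquad \hat{S}^{2,i} := S^{2,i} \cup \{n\sqrt{ -1} \mid n \in \mathbb{Z}_{>0}\}.$$ For a set $S \subset \mathbb{C}$ and an integer $n$: $+S := S$, $-S := \{ -\alpha \mid \alpha \in S\}$ and $S+n := \{\alpha+n \mid \alpha \in S\}$; $\varepsilon S$ means $+S$ for $\varepsilon=+1$ and $-S$ for $\varepsilon=-1$. -}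

module Defs where

open import Algebra.Bundles using (CommutativeMonoid)
import Algebra.Properties.CommutativeSemigroup as CommutativeSemigroupₚ
import Algebra.Properties.Group as Groupₚ
import Algebra.Properties.Ring as Ringₚ
open import Data.Integer as ℤ using (ℤ; +_; -[1+_])
import Data.Integer.Properties as ℤₚ
import Data.Integer.Solver as ℤSolver
open import Data.List using (List; foldr; map; _∷ʳ_)
open import Data.Nat as ℕ using (ℕ; zero; suc; _⊔_; ⌊_/2⌋; z≤n; s≤s)
open import Data.Nat.Divisibility using (_∣_; _∤_)
import Data.Nat.Properties as ℕₚ
import Data.Nat.Solver as ℕSolver
open import Data.Product using (∃; _×_; _,_)
open import Data.Rational as ℚ using (ℚ; 0ℚ; 1ℚ; ½; mkℚ; ↧ₙ_; ∣_∣; 1/_)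
import Data.Rational.Properties as ℚₚ
import Data.Rational.Unnormalised as ℚᵘ
import Data.Rational.Unnormalised.Properties as ℚᵘₚ
open import Data.Sign as Sign using (Sign)
open import Data.Sum using (_⊎_; inj₁; inj₂)
open import Data.Vec as Vec using (Vec)
open import Data.Vec.Functional as Vector using (Vector)
open import Level using (Level; 0ℓ)
open import Relation.Binary.PropositionalEquality
  using (_≡_; _≢_; refl; sym; trans; cong; cong₂; subst; subst₂; module ≡-Reasoning)
open import Relation.Nullary using (¬_; yes; no; contradiction)
open import Relation.Unary using (Pred; _∈_; _∉_; _⊆_; _≐_; _∪_; _⊥_; ⋃)

------------------------------------------------------------------------
-- Cauchy sequences of rationals

IsCauchy : (ℕ → ℚ) → Set
IsCauchy x = ∀ ε → 0ℚ ℚ.< ε →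
  ∃ λ N → ∀ m n → N ℕ.≤ m → N ℕ.≤ n → ∣ x m ℚ.- x n ∣ ℚ.< ε

private
  open CommutativeSemigroupₚ
    (CommutativeMonoid.commutativeSemigroup ℚₚ.+-0-commutativeMonoid) using (interchange)
  open Groupₚ ℚₚ.+-0-group using (//-rightDividesˡ; //-rightDividesʳ; ⁻¹-anti-homo-//)
  open Ringₚ ℚₚ.+-*-ring using (x[y-z]≈xy-xz; [y-z]x≈yx-zx)

  halve : ∀ ε → ½ ℚ.* ε ℚ.+ ½ ℚ.* ε ≡ ε
  halve ε = trans (sym (ℚₚ.*-distribʳ-+ ε ½ ½)) (ℚₚ.*-identityˡ ε)

  ½-pos : ∀ {ε} → 0ℚ ℚ.< ε → 0ℚ ℚ.< ½ ℚ.* ε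
  ½-pos {ε} 0<ε = ℚₚ.positive⁻¹ (½ ℚ.* ε)
    where instance
      _ = ℚ.positive 0<ε
      _ = ℚₚ.pos*pos⇒pos ½ ε

  const-cauchy : ∀ q → IsCauchy (λ _ → q)
  const-cauchy q ε 0<ε = 0 , λ _ _ _ _ →
    subst (ℚ._< ε) (sym (cong ∣_∣ (ℚₚ.+-inverseʳ q))) 0<ε

-- Abstract: otherwise the positivity checker normalises these proofs whenever
-- arithmetic on ℂ occurs in a record or data declaration.
abstract
  +-cauchy : ∀ x y → IsCauchy x → IsCauchy y → IsCauchy (λ n → x n ℚ.+ y n)
  +-cauchy x y cx cy ε 0<ε =
    let M , hx = cx (½ ℚ.* ε) (½-pos 0<ε)
        N , hy = cy (½ ℚ.* ε) (½-pos 0<ε)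
    in M ⊔ N , λ m n m≥ n≥ → begin-strict
      ∣ (x m ℚ.+ y m) ℚ.- (x n ℚ.+ y n) ∣
        ≡⟨ cong ∣_∣ (regroup (x m) (y m) (x n) (y n)) ⟩
      ∣ (x m ℚ.- x n) ℚ.+ (y m ℚ.- y n) ∣
        ≤⟨ ℚₚ.∣p+q∣≤∣p∣+∣q∣ (x m ℚ.- x n) (y m ℚ.- y n) ⟩
      ∣ x m ℚ.- x n ∣ ℚ.+ ∣ y m ℚ.- y n ∣
        <⟨ ℚₚ.+-mono-<
             (hx m n (ℕₚ.m⊔n≤o⇒m≤o M N m≥) (ℕₚ.m⊔n≤o⇒m≤o M N n≥))
             (hy m n (ℕₚ.m⊔n≤o⇒n≤o M N m≥) (ℕₚ.m⊔n≤o⇒n≤o M N n≥)) ⟩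
      ½ ℚ.* ε ℚ.+ ½ ℚ.* ε
        ≡⟨ halve ε ⟩
      ε ∎
    where
    open ℚₚ.≤-Reasoning
    regroup : ∀ a b c d → (a ℚ.+ b) ℚ.- (c ℚ.+ d) ≡ (a ℚ.- c) ℚ.+ (b ℚ.- d)
    regroup a b c d = trans (cong ((a ℚ.+ b) ℚ.+_) (ℚₚ.neg-distrib-+ c d))
                            (interchange a b (ℚ.- c) (ℚ.- d))

  neg-cauchy : ∀ x → IsCauchy x → IsCauchy (λ n → ℚ.- x n)
  neg-cauchy x cx ε 0<ε =
    let N , h = cx ε 0<ε
    in N , λ m n m≥ n≥ → subst (ℚ._< ε) (flip (x m) (x n)) (h m n m≥ n≥)
    where
    flip : ∀ a b → ∣ a ℚ.- b ∣ ≡ ∣ ℚ.- a ℚ.- ℚ.- b ∣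
    flip a b = trans (sym (ℚₚ.∣-p∣≡∣p∣ (a ℚ.- b)))
                     (cong ∣_∣ (ℚₚ.neg-distrib-+ a (ℚ.- b)))

private
  eventually-bounded : ∀ x → IsCauchy x →
    ∃ λ B → ∃ λ N → 0ℚ ℚ.< B × (∀ n → N ℕ.≤ n → ∣ x n ∣ ℚ.≤ B)
  eventually-bounded x cx =
    let N , h = cx 1ℚ (ℚₚ.positive⁻¹ 1ℚ)
    in 1ℚ ℚ.+ ∣ x N ∣ , N
     , ℚₚ.+-mono-<-≤ (ℚₚ.positive⁻¹ 1ℚ) (ℚₚ.0≤∣p∣ (x N))
     , λ n n≥ → begin
       ∣ x n ∣
         ≡⟨ cong ∣_∣ (sym (//-rightDividesˡ (x N) (x n))) ⟩
       ∣ (x n ℚ.- x N) ℚ.+ x N ∣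
         ≤⟨ ℚₚ.∣p+q∣≤∣p∣+∣q∣ (x n ℚ.- x N) (x N) ⟩
       ∣ x n ℚ.- x N ∣ ℚ.+ ∣ x N ∣
         ≤⟨ ℚₚ.+-monoˡ-≤ ∣ x N ∣ (ℚₚ.<⇒≤ (h n N n≥ ℕₚ.≤-refl)) ⟩
       1ℚ ℚ.+ ∣ x N ∣ ∎
    where open ℚₚ.≤-Reasoning

  scale : ∀ A ε → 0ℚ ℚ.< A → 0ℚ ℚ.< ε → ∃ λ δ → 0ℚ ℚ.< δ × A ℚ.* δ ≡ ε
  scale A ε 0<A 0<ε =
    (1/ A) ℚ.* ε , ℚₚ.positive⁻¹ ((1/ A) ℚ.* ε) , (begin
      A ℚ.* ((1/ A) ℚ.* ε) ≡⟨ sym (ℚₚ.*-assoc A (1/ A) ε) ⟩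
      (A ℚ.* (1/ A)) ℚ.* ε ≡⟨ cong (ℚ._* ε) (ℚₚ.*-inverseʳ A) ⟩
      1ℚ ℚ.* ε             ≡⟨ ℚₚ.*-identityˡ ε ⟩
      ε ∎)
    where
    open ≡-Reasoning
    instance
      A>0 = ℚ.positive 0<A
      A≢0 = ℚₚ.pos⇒nonZero A
      1/A>0 = ℚₚ.1/pos⇒pos A
      ε>0 = ℚ.positive 0<ε
      _ = ℚₚ.pos*pos⇒pos (1/ A) ε

  *-bound : ∀ {a A d δ} → ∣ a ∣ ℚ.≤ A → 0ℚ ℚ.< A → ∣ d ∣ ℚ.< δ →
            ∣ a ℚ.* d ∣ ℚ.< A ℚ.* δ
  *-bound {a} {A} {d} {δ} a≤A 0<A d<δ = begin-strict
    ∣ a ℚ.* d ∣     ≡⟨ ℚₚ.∣p*q∣≡∣p∣*∣q∣ a d ⟩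
    ∣ a ∣ ℚ.* ∣ d ∣ ≤⟨ ℚₚ.*-monoʳ-≤-nonNeg ∣ d ∣ a≤A ⟩
    A ℚ.* ∣ d ∣     <⟨ ℚₚ.*-monoʳ-<-pos A d<δ ⟩
    A ℚ.* δ ∎
    where
    open ℚₚ.≤-Reasoning
    instance
      _ = ℚₚ.∣-∣-nonNeg d
      _ = ℚ.positive 0<A

abstract
  *-cauchy : ∀ x y → IsCauchy x → IsCauchy y → IsCauchy (λ n → x n ℚ.* y n)
  *-cauchy x y cx cy ε 0<ε
    with A , K , 0<A , bx ← eventually-bounded x cx
       | B , L , 0<B , by ← eventually-bounded y cy
    with δ , 0<δ , Aδ ← scale A (½ ℚ.* ε) 0<A (½-pos 0<ε)
       | η , 0<η , Bη ← scale B (½ ℚ.* ε) 0<B (½-pos 0<ε)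
    with M , hy ← cy δ 0<δ
       | N , hx ← cx η 0<η
    = (K ⊔ L) ⊔ (M ⊔ N) , λ m n m≥ n≥ →
      let KL≤m = ℕₚ.m⊔n≤o⇒m≤o (K ⊔ L) (M ⊔ N) m≥
          KL≤n = ℕₚ.m⊔n≤o⇒m≤o (K ⊔ L) (M ⊔ N) n≥
          MN≤m = ℕₚ.m⊔n≤o⇒n≤o (K ⊔ L) (M ⊔ N) m≥
          MN≤n = ℕₚ.m⊔n≤o⇒n≤o (K ⊔ L) (M ⊔ N) n≥
      in begin-strict
      ∣ x m ℚ.* y m ℚ.- x n ℚ.* y n ∣
        ≡⟨ cong ∣_∣ (regroup (x m) (y m) (x n) (y n)) ⟩
      ∣ x m ℚ.* (y m ℚ.- y n) ℚ.+ y n ℚ.* (x m ℚ.- x n) ∣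
        ≤⟨ ℚₚ.∣p+q∣≤∣p∣+∣q∣ (x m ℚ.* (y m ℚ.- y n)) (y n ℚ.* (x m ℚ.- x n)) ⟩
      ∣ x m ℚ.* (y m ℚ.- y n) ∣ ℚ.+ ∣ y n ℚ.* (x m ℚ.- x n) ∣
        <⟨ ℚₚ.+-mono-<
             (*-bound {x m} (bx m (ℕₚ.m⊔n≤o⇒m≤o K L KL≤m)) 0<A
               (hy m n (ℕₚ.m⊔n≤o⇒m≤o M N MN≤m) (ℕₚ.m⊔n≤o⇒m≤o M N MN≤n)))
             (*-bound {y n} (by n (ℕₚ.m⊔n≤o⇒n≤o K L KL≤n)) 0<B
               (hx m n (ℕₚ.m⊔n≤o⇒n≤o M N MN≤m) (ℕₚ.m⊔n≤o⇒n≤o M N MN≤n))) ⟩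
      A ℚ.* δ ℚ.+ B ℚ.* η
        ≡⟨ cong₂ ℚ._+_ Aδ Bη ⟩
      ½ ℚ.* ε ℚ.+ ½ ℚ.* ε
        ≡⟨ halve ε ⟩
      ε ∎
    where
    open ℚₚ.≤-Reasoning
    regroup : ∀ a b c d →
      a ℚ.* b ℚ.- c ℚ.* d ≡ a ℚ.* (b ℚ.- d) ℚ.+ d ℚ.* (a ℚ.- c)
    regroup a b c d = ≡-Reasoning.begin
      a ℚ.* b ℚ.- c ℚ.* d
        ≡-Reasoning.≡⟨ cong (ℚ._- c ℚ.* d) (sym (//-rightDividesˡ (a ℚ.* d) (a ℚ.* b))) ⟩
      a ℚ.* b ℚ.- a ℚ.* d ℚ.+ a ℚ.* d ℚ.- c ℚ.* d
        ≡-Reasoning.≡⟨ ℚₚ.+-assoc (a ℚ.* b ℚ.- a ℚ.* d) (a ℚ.* d) (ℚ.- (c ℚ.* d)) ⟩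
      (a ℚ.* b ℚ.- a ℚ.* d) ℚ.+ (a ℚ.* d ℚ.- c ℚ.* d)
        ≡-Reasoning.≡⟨ sym (cong₂ ℚ._+_ (x[y-z]≈xy-xz a b d) (trans (ℚₚ.*-comm d (a ℚ.- c)) ([y-z]x≈yx-zx d a c))) ⟩
      a ℚ.* (b ℚ.- d) ℚ.+ d ℚ.* (a ℚ.- c) ≡-Reasoning.∎

------------------------------------------------------------------------
-- Real numbers

record ℝ : Set where
  constructor mkℝ
  field
    seq    : ℕ → ℚ
    cauchy : IsCauchy seq

open ℝ public

infix  4 _≈ʳ_
infixl 6 _+ʳ_
infixl 7 _*ʳ_
infix  8 -ʳ_

record _≈ʳ_ (x y : ℝ) : Set where
  constructor mk≈ʳ
  field
    limit : ∀ ε → 0ℚ ℚ.< ε →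
      ∃ λ N → ∀ n → N ℕ.≤ n → ∣ seq x n ℚ.- seq y n ∣ ℚ.< ε

open _≈ʳ_ public

fromℚʳ : ℚ → ℝ
fromℚʳ q = mkℝ (λ _ → q) (const-cauchy q)

0ʳ 1ʳ : ℝ
0ʳ = fromℚʳ 0ℚ
1ʳ = fromℚʳ 1ℚ

_+ʳ_ _*ʳ_ : ℝ → ℝ → ℝ
x +ʳ y = mkℝ (λ n → seq x n ℚ.+ seq y n) (+-cauchy (seq x) (seq y) (cauchy x) (cauchy y))
x *ʳ y = mkℝ (λ n → seq x n ℚ.* seq y n) (*-cauchy (seq x) (seq y) (cauchy x) (cauchy y))

-ʳ_ : ℝ → ℝ
-ʳ x = mkℝ (λ n → ℚ.- seq x n) (neg-cauchy (seq x) (cauchy x))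

------------------------------------------------------------------------
-- Square roots of natural numbers

isqrt : ℕ → ℕ
isqrt zero = 0
isqrt (suc n) with suc (isqrt n) ℕ.* suc (isqrt n) ℕ.≤? suc n
... | yes _ = suc (isqrt n)
... | no  _ = isqrt n

isqrt-lower : ∀ n → isqrt n ℕ.* isqrt n ℕ.≤ n
isqrt-lower zero = z≤n
isqrt-lower (suc n) with suc (isqrt n) ℕ.* suc (isqrt n) ℕ.≤? suc n
... | yes p = p
... | no  _ = ℕₚ.m≤n⇒m≤1+n (isqrt-lower n)

isqrt-upper : ∀ n → n ℕ.< suc (isqrt n) ℕ.* suc (isqrt n)
isqrt-upper zero = s≤s z≤n
isqrt-upper (suc n) with suc (isqrt n) ℕ.* suc (isqrt n) ℕ.≤? suc n
... | yes _ = ℕₚ.≤-<-trans (isqrt-upper n) (ℕₚ.*-mono-< r<1+r r<1+r)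
  where
  r<1+r : suc (isqrt n) ℕ.< suc (suc (isqrt n))
  r<1+r = ℕₚ.n<1+n (suc (isqrt n))
... | no ¬p = ℕₚ.≰⇒> ¬p

-- The k-th term is ⌊(k+1)√n⌋ / (k+1).
√seq : ℕ → ℕ → ℚ
√seq n k = + isqrt (n ℕ.* (suc k ℕ.* suc k)) ℚ./ suc k

private
  square-cancel-< : ∀ {a b} → a ℕ.* a ℕ.< b ℕ.* b → a ℕ.< b
  square-cancel-< {a} {b} h with a ℕ.<? b
  ... | yes a<b = a<b
  ... | no  a≮b = let b≤a = ℕₚ.≮⇒≥ a≮b in
    contradiction h (ℕₚ.≤⇒≯ (ℕₚ.*-mono-≤ b≤a b≤a))

  √-cross : ∀ n i j →
    isqrt (n ℕ.* (suc i ℕ.* suc i)) ℕ.* suc j ℕ.<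
    suc (isqrt (n ℕ.* (suc j ℕ.* suc j))) ℕ.* suc i
  √-cross n i j = square-cancel-< (begin-strict
    (a ℕ.* N) ℕ.* (a ℕ.* N)       ≡⟨ square a N ⟩
    (a ℕ.* a) ℕ.* (N ℕ.* N)       ≤⟨ ℕₚ.*-monoˡ-≤ (N ℕ.* N) (isqrt-lower (n ℕ.* (M ℕ.* M))) ⟩
    (n ℕ.* (M ℕ.* M)) ℕ.* (N ℕ.* N) ≡⟨ swap n (M ℕ.* M) (N ℕ.* N) ⟩
    (n ℕ.* (N ℕ.* N)) ℕ.* (M ℕ.* M) <⟨ ℕₚ.*-monoˡ-< (M ℕ.* M) (isqrt-upper (n ℕ.* (N ℕ.* N))) ⟩
    (b ℕ.* b) ℕ.* (M ℕ.* M)       ≡⟨ sym (square b M) ⟩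
    (b ℕ.* M) ℕ.* (b ℕ.* M) ∎)
    where
    open ℕₚ.≤-Reasoning
    M N a b : ℕ
    M = suc i
    N = suc j
    a = isqrt (n ℕ.* (M ℕ.* M))
    b = suc (isqrt (n ℕ.* (N ℕ.* N)))
    open ℕSolver.+-*-Solver
    square : ∀ u v → (u ℕ.* v) ℕ.* (u ℕ.* v) ≡ (u ℕ.* u) ℕ.* (v ℕ.* v)
    square = solve 2 (λ u v → (u :* v) :* (u :* v) := (u :* u) :* (v :* v)) refl
    swap : ∀ u v w → (u ℕ.* v) ℕ.* w ≡ (u ℕ.* w) ℕ.* v
    swap = solve 3 (λ u v w → (u :* v) :* w := (u :* w) :* v) refl

  /-mono-< : ∀ a i b j → a ℕ.* suc j ℕ.< b ℕ.* suc i →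
             (+ a) ℚ./ suc i ℚ.< (+ b) ℚ./ suc j
  /-mono-< a i b j h = ℚₚ.toℚᵘ-cancel-< (begin-strict
    ℚ.toℚᵘ (ℚ.fromℚᵘ p) ≃⟨ ℚₚ.toℚᵘ-fromℚᵘ p ⟩
    p                   <⟨ ℚᵘ.*<* (subst₂ ℤ._<_ (ℤₚ.pos-* a (suc j)) (ℤₚ.pos-* b (suc i)) (ℤ.+<+ h)) ⟩
    q                   ≃⟨ ℚᵘₚ.≃-sym (ℚₚ.toℚᵘ-fromℚᵘ q) ⟩
    ℚ.toℚᵘ (ℚ.fromℚᵘ q) ∎)
    where
    open ℚᵘₚ.≤-Reasoning
    p q : ℚᵘ.ℚᵘ
    p = ℚᵘ.mkℚᵘ (+ a) i
    q = ℚᵘ.mkℚᵘ (+ b) j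

  /-suc : ∀ b j → (+ suc b) ℚ./ suc j ≡ (+ 1) ℚ./ suc j ℚ.+ (+ b) ℚ./ suc j
  /-suc b j = ℚₚ.toℚᵘ-injective (begin-equality
    ℚ.toℚᵘ (ℚ.fromℚᵘ p)
      ≃⟨ ℚₚ.toℚᵘ-fromℚᵘ p ⟩
    p
      ≃⟨ ℚᵘ.*≡* (common (+ b) (+ suc j)) ⟩
    q ℚᵘ.+ r
      ≃⟨ ℚᵘₚ.+-cong (ℚᵘₚ.≃-sym (ℚₚ.toℚᵘ-fromℚᵘ q)) (ℚᵘₚ.≃-sym (ℚₚ.toℚᵘ-fromℚᵘ r)) ⟩
    ℚ.toℚᵘ (ℚ.fromℚᵘ q) ℚᵘ.+ ℚ.toℚᵘ (ℚ.fromℚᵘ r)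
      ≃⟨ ℚᵘₚ.≃-sym (ℚₚ.toℚᵘ-homo-+ (ℚ.fromℚᵘ q) (ℚ.fromℚᵘ r)) ⟩
    ℚ.toℚᵘ (ℚ.fromℚᵘ q ℚ.+ ℚ.fromℚᵘ r) ∎)
    where
    open ℚᵘₚ.≤-Reasoning
    p q r : ℚᵘ.ℚᵘ
    p = ℚᵘ.mkℚᵘ (+ suc b) j
    q = ℚᵘ.mkℚᵘ (+ 1) j
    r = ℚᵘ.mkℚᵘ (+ b) j
    common : ∀ b n →
      (+ 1 ℤ.+ b) ℤ.* (n ℤ.* n) ≡ (+ 1 ℤ.* n ℤ.+ b ℤ.* n) ℤ.* n
    common = solve 2 (λ b n →
      (con (+ 1) :+ b) :* (n :* n) := (con (+ 1) :* n :+ b :* n) :* n) refl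
      where open ℤSolver.+-*-Solver

  √seq-gap : ∀ n i j → √seq n i ℚ.- √seq n j ℚ.< (+ 1) ℚ./ suc j
  √seq-gap n i j = begin-strict
    √seq n i ℚ.- √seq n j
      <⟨ ℚₚ.+-monoˡ-< (ℚ.- √seq n j) (/-mono-< a i (suc b) j (√-cross n i j)) ⟩
    (+ suc b) ℚ./ suc j ℚ.- √seq n j
      ≡⟨ cong (ℚ._- √seq n j) (/-suc b j) ⟩
    (+ 1) ℚ./ suc j ℚ.+ √seq n j ℚ.- √seq n j
      ≡⟨ //-rightDividesʳ (√seq n j) ((+ 1) ℚ./ suc j) ⟩
    (+ 1) ℚ./ suc j ∎
    where
    open ℚₚ.≤-Reasoning
    a b : ℕ
    a = isqrt (n ℕ.* (suc i ℕ.* suc i))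
    b = isqrt (n ℕ.* (suc j ℕ.* suc j))

  reciprocal-< : ∀ ε → ℚ.Positive ε → ∀ j → ↧ₙ ε ℕ.≤ j → (+ 1) ℚ./ suc j ℚ.< ε
  reciprocal-< ε@(mkℚ (+ suc p) d _) _ j ε≤j =
    subst ((+ 1) ℚ./ suc j ℚ.<_) (ℚₚ.↥p/↧p≡p ε)
      (/-mono-< 1 j (suc p) d (begin-strict
        1 ℕ.* suc d     ≡⟨ ℕₚ.*-identityˡ (suc d) ⟩
        suc d           <⟨ s≤s ε≤j ⟩
        suc j           ≤⟨ ℕₚ.m≤m+n (suc j) (p ℕ.* suc j) ⟩
        suc p ℕ.* suc j ∎))
    where open ℕₚ.≤-Reasoning

  ∣∣-< : ∀ p {ε} → p ℚ.< ε → ℚ.- p ℚ.< ε → ∣ p ∣ ℚ.< ε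
  ∣∣-< p {ε} p<ε -p<ε with ℚₚ.∣p∣≡p∨∣p∣≡-p p
  ... | inj₁ eq = subst (ℚ._< ε) (sym eq) p<ε
  ... | inj₂ eq = subst (ℚ._< ε) (sym eq) -p<ε

abstract
  √seq-cauchy : ∀ n → IsCauchy (√seq n)
  √seq-cauchy n ε 0<ε = ↧ₙ ε , λ i j i≥ j≥ →
    ∣∣-< (√seq n i ℚ.- √seq n j) (below i j j≥)
      (subst (ℚ._< ε) (sym (⁻¹-anti-homo-// (√seq n i) (√seq n j))) (below j i i≥))
    where
    below : ∀ i j → ↧ₙ ε ℕ.≤ j → √seq n i ℚ.- √seq n j ℚ.< ε
    below i j j≥ =
      ℚₚ.<-trans (√seq-gap n i j) (reciprocal-< ε (ℚ.positive 0<ε) j j≥)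

√ʳ_ : ℕ → ℝ
√ʳ n = mkℝ (√seq n) (√seq-cauchy n)

------------------------------------------------------------------------
-- Complex numbers

record ℂ : Set where
  constructor _+i_
  field
    re im : ℝ

open ℂ public

infix  4 _≈_
infixl 6 _+_
infixl 7 _*_
infix  8 -_

record _≈_ (z w : ℂ) : Set where
  constructor mk≈
  field
    re-≈ : re z ≈ʳ re w
    im-≈ : im z ≈ʳ im w

open _≈_ public

fromℝ : ℝ → ℂ
fromℝ x = x +i 0ʳ

fromℚ : ℚ → ℂ
fromℚ q = fromℝ (fromℚʳ q)

fromℤ : ℤ → ℂ
fromℤ k = fromℚ (k ℚ./ 1)

0ᶜ 1ᶜ 𝕚 : ℂ
0ᶜ = fromℚ 0ℚ
1ᶜ = fromℚ 1ℚ
𝕚  = 0ʳ +i 1ʳ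

_+_ _*_ : ℂ → ℂ → ℂ
z + w = (re z +ʳ re w) +i (im z +ʳ im w)
z * w = (re z *ʳ re w +ʳ -ʳ (im z *ʳ im w)) +i (re z *ʳ im w +ʳ im z *ʳ re w)

-_ : ℂ → ℂ
- z = (-ʳ re z) +i (-ʳ im z)

-- Principal root: positive imaginary part when the radicand is negative.
√_ : ℤ → ℂ
√ (+ n)    = fromℝ (√ʳ n)
√ -[1+ n ] = fromℝ (√ʳ suc n) * 𝕚

Real : Pred ℂ 0ℓ
Real z = im z ≈ʳ 0ʳ

ℂ∖ℝ : Pred ℂ 0ℓ
ℂ∖ℝ z = z ∉ Real

------------------------------------------------------------------------
-- Algebraic integers and degree

-- Polynomials are coefficient lists, constant term first.
eval : List ℚ → ℂ → ℂ
eval p z = foldr (λ a w → fromℚ a + z * w) 0ᶜ p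

AlgebraicInteger : Pred ℂ 0ℓ
AlgebraicInteger z =
  ∃ λ (p : List ℤ) → eval (map (ℚ._/ 1) p ∷ʳ 1ℚ) z ≈ 0ᶜ

-- z is a root of the monic rational polynomial of degree d with the given
-- lower coefficients.
MonicRoot : ∀ {d} → Vec ℚ d → Pred ℂ 0ℓ
MonicRoot p z = eval (Vec.toList p ∷ʳ 1ℚ) z ≈ 0ᶜ

-- The minimal polynomial is the monic annihilator of least degree.
HasDegree : ℕ → Pred ℂ 0ℓ
HasDegree d z =
  (∃ λ (p : Vec ℚ d) → MonicRoot p z) ×
  (∀ {m} → m ℕ.< d → (q : Vec ℚ m) → ¬ MonicRoot q z)

QuadraticInteger : Pred ℂ 0ℓ
QuadraticInteger z = AlgebraicInteger z × HasDegree 2 z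

------------------------------------------------------------------------
-- Subfields of ℂ

private variable
  ℓ : Level

-- In inv, w is the inverse of z; this avoids an inversion function, which on
-- Cauchy reals would need apartness from 0.
record IsSubfield (K : Pred ℂ ℓ) : Set ℓ where
  field
    resp : ∀ {z w} → z ≈ w → z ∈ K → w ∈ K
    one  : 1ᶜ ∈ K
    add  : ∀ {z w} → z ∈ K → w ∈ K → z + w ∈ K
    neg  : ∀ {z} → z ∈ K → - z ∈ K
    mul  : ∀ {z w} → z ∈ K → w ∈ K → z * w ∈ K
    inv  : ∀ {z w} → z ∈ K → z * w ≈ 1ᶜ → w ∈ K

combination : ∀ {n} → Vector ℚ n → Vector ℂ n → ℂ
combination q e = Vector.foldr _+_ 0ᶜ (Vector.zipWith (λ a z → fromℚ a * z) q e)

record IsBasis (K : Pred ℂ ℓ) {n} (e : Vector ℂ n) : Set ℓ where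
  field
    member      : ∀ i → e i ∈ K
    spanning    : ∀ {z} → z ∈ K → ∃ λ q → z ≈ combination q e
    independent : ∀ q → combination q e ≈ 0ᶜ → ∀ i → q i ≡ 0ℚ

HasDimension : Pred ℂ ℓ → ℕ → Set ℓ
HasDimension K n = ∃ λ (e : Vector ℂ n) → IsBasis K e

record IsImaginaryQuadraticField (K : Pred ℂ ℓ) : Set ℓ where
  field
    isSubfield : IsSubfield K
    quadratic  : HasDimension K 2
    imaginary  : ¬ (K ⊆ Real)

-- ℚ⟨ α ⟩ is the subfield generated by α.
data ℚ⟨_⟩ (α : ℂ) : Pred ℂ 0ℓ where
  gen  : α ∈ ℚ⟨ α ⟩
  rat  : ∀ q → fromℚ q ∈ ℚ⟨ α ⟩
  resp : ∀ {z w} → z ≈ w → z ∈ ℚ⟨ α ⟩ → w ∈ ℚ⟨ α ⟩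
  add  : ∀ {z w} → z ∈ ℚ⟨ α ⟩ → w ∈ ℚ⟨ α ⟩ → z + w ∈ ℚ⟨ α ⟩
  neg  : ∀ {z} → z ∈ ℚ⟨ α ⟩ → - z ∈ ℚ⟨ α ⟩
  mul  : ∀ {z w} → z ∈ ℚ⟨ α ⟩ → w ∈ ℚ⟨ α ⟩ → z * w ∈ ℚ⟨ α ⟩
  inv  : ∀ {z w} → z ∈ ℚ⟨ α ⟩ → z * w ≈ 1ᶜ → w ∈ ℚ⟨ α ⟩

PrimitiveElementOf : Pred ℂ ℓ → Pred ℂ ℓ
PrimitiveElementOf K α = K ≐ ℚ⟨ α ⟩

------------------------------------------------------------------------
-- The sets I, S and Ŝ

-- ⌊_/2⌋ is only applied to even numbers.
I : ℕ → Pred ℂ 0ℓ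
I n z = z ∈ ℂ∖ℝ × (∃ λ (c : ℤ) →
    (2 ∤ n × + (⌊ n ℕ.∸ 1 /2⌋ ℕ.^ 2 ℕ.+ 1) ℤ.≤ c × c ℤ.≤ + (⌊ n ℕ.+ 1 /2⌋ ℕ.^ 2) ×
      z ≈ fromℚ ½ * (1ᶜ + √ (+ 1 ℤ.- + 4 ℤ.* c)))
  ⊎ (2 ∣ n × + (⌊ n /2⌋ ℕ.^ 2) ℤ.< c × c ℤ.< + ((⌊ n /2⌋ ℕ.+ 1) ℕ.^ 2) ×
      z ≈ √ (ℤ.- c)))

S : Pred ℂ 0ℓ
S z = ∃ λ n → 1 ℕ.≤ n × z ∈ I n

Ŝ : Pred ℂ 0ℓ
Ŝ = S ∪ (λ z → ∃ λ (n : ℤ) → + 0 ℤ.< n × z ≈ fromℤ n * 𝕚)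

infix 8 _•_
_•_ : Sign → Pred ℂ 0ℓ → Pred ℂ 0ℓ
Sign.+ • A = A
Sign.- • A = λ z → ∃ λ α → α ∈ A × z ≈ - α

infixl 6 _⊕_
_⊕_ : Pred ℂ 0ℓ → ℤ → Pred ℂ 0ℓ
(A ⊕ n) z = ∃ λ α → α ∈ A × z ≈ α + fromℤ n

IsDisjointUnion : {J : Set} → Pred ℂ 0ℓ → (J → Pred ℂ 0ℓ) → Set
IsDisjointUnion {J} P A = P ≐ ⋃ J A × (∀ {i j} → i ≢ j → A i ⊥ A j)

{-# OPTIONS --safe #-}

-- A non-real quadratic integer z is a root of x² + bx + c with b, c ∈ ℤ.
-- Completing the square, w = z + b/2 or w = 2z + b satisfies w² = d ∈ ℤ, and
-- d < 0 because a complex number with a non-negative square is real; hence w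
-- is ± the principal root. The sign is ε, and undoing the substitution gives
-- the translate. Conversely a translate of ± an element of Ŝ is located by
-- the sign of its imaginary part and by its real part, which determine
-- (n , ε).
--
-- That b and c are integers is shown without Gauss's lemma: in ℚ[x]/(x²+bx+c)
-- the powers of z and of z − 1 have a common denominator, so the powers of
-- their norms c and 1 + b + c have bounded denominators.
--
-- Real analysis enters through two facts that hold constructively: u² + v² = 0
-- implies u = 0, and a real idempotent is 0 or 1, so that the roots of y² = r²
-- for invertible r are ±r.
module Submission where

open import Defs
open import Algebra.Bundles using (CommutativeRing; RawRing)
import Algebra.Properties.Group as Groupₚ
import Algebra.Solver.Ring
open import Algebra.Solver.Ring.AlmostCommutativeRing using (fromCommutativeRing; _-Raw-AlmostCommutative⟶_)
open import Algebra.Structures using (IsCommutativeRing)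
import Data.Empty as Empty
open import Data.Fin using (Fin; zero; suc)
open import Data.Integer as ℤ using (ℤ; +_; -[1+_])
import Data.Integer.DivMod as ℤDivMod
import Data.Integer.Properties as ℤₚ
import Data.Integer.Solver as ℤSolver
open import Data.List using (List; []; _∷_; length; map; _∷ʳ_)
open import Data.Maybe using (Maybe; just; nothing)
open import Data.Nat as ℕ using (ℕ; zero; suc; _⊔_)
open import Data.Nat.Coprimality as Coprime using (Coprime; coprime-divisor)
open import Data.Nat.Divisibility using (_∣_; _∤_; divides; *-monoʳ-∣; ∣⇒≤; 1∣_; ∣m+n∣m⇒∣n; m∣m*n)
import Data.Nat.Properties as ℕₚ
import Data.Nat.Solver as ℕSolver
open import Data.Product using (∃; _×_; _,_; proj₁; proj₂)
open import Data.Rational as ℚ using (ℚ; 0ℚ; 1ℚ; ½; mkℚ; ↧ₙ_; ∣_∣; 1/_)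
import Data.Rational.Properties as ℚₚ
import Data.Rational.Solver as ℚSolver
import Data.Rational.Unnormalised as ℚᵘ
import Data.Rational.Unnormalised.Properties as ℚᵘₚ
open import Data.Sign as Sign using (Sign)
open import Data.Sum as Sum using (_⊎_; inj₁; inj₂)
open import Data.Vec as Vec using (Vec; []; _∷_)
open import Function.Base using (_∘_)
open import Level using (Level; 0ℓ)
open import Relation.Binary.PropositionalEquality using (_≡_; _≢_; refl; sym; trans; cong; cong₂; subst; subst₂; module ≡-Reasoning)
open import Relation.Nullary using (¬_; Dec; yes; no; contradiction)
open import Relation.Unary using (Pred; _∈_; _∉_; _⊆_; _≐_; _∩_; _∖_; _⊥_; ⋃)

-- Equality of Cauchy reals is undecidable, and a vanishing product need not reveal a vanishing
-- factor. Case distinctions are therefore made on discrete data: the parity of b, the sign of d,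
-- whether -d is a perfect square, whether a rational coefficient is 0. Only the choice between the
-- two roots is read off from a real number, the idempotent (1 + y/r)/2.
--
-- The index n of `I` is bookkeeping. The ranges for odd n tile the integers c ≥ 1; those for even n
-- omit exactly the squares. So `S` consists of (1 + √(1 - 4c))/2 for all c ≥ 1 and of √(-c) for
-- nonsquare c ≥ 1. The squares c = m² would give m𝕚, and these are what `Ŝ` adds. They are also the
-- only elements of `Ŝ` in ℚ(𝕚), because 4c - 1 is 3 modulo 4 and never a square. Hence one test,
-- whether -d is a square, separates `S` from the rest both in the two unions and in the two claims
-- on primitive elements.

-- Integers among the rationals

ι : ℤ → ℚ
ι k = k ℚ./ 1

private
  toℚᵘ-ι : ∀ k → ℚ.toℚᵘ (ι k) ℚᵘ.≃ ℚᵘ.mkℚᵘ k 0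
  toℚᵘ-ι k = ℚₚ.toℚᵘ-fromℚᵘ (ℚᵘ.mkℚᵘ k 0)

ι-+ : ∀ a b → ι (a ℤ.+ b) ≡ ι a ℚ.+ ι b
ι-+ a b = ℚₚ.toℚᵘ-injective (begin-equality
  ℚ.toℚᵘ (ι (a ℤ.+ b))             ≃⟨ toℚᵘ-ι (a ℤ.+ b) ⟩
  ℚᵘ.mkℚᵘ (a ℤ.+ b) 0              ≃⟨ ℚᵘ.*≡* (eq a b) ⟩
  ℚᵘ.mkℚᵘ a 0 ℚᵘ.+ ℚᵘ.mkℚᵘ b 0     ≃⟨ ℚᵘₚ.+-cong (ℚᵘₚ.≃-sym (toℚᵘ-ι a)) (ℚᵘₚ.≃-sym (toℚᵘ-ι b)) ⟩
  ℚ.toℚᵘ (ι a) ℚᵘ.+ ℚ.toℚᵘ (ι b)   ≃⟨ ℚᵘₚ.≃-sym (ℚₚ.toℚᵘ-homo-+ (ι a) (ι b)) ⟩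
  ℚ.toℚᵘ (ι a ℚ.+ ι b)             ∎)
  where
  open ℚᵘₚ.≤-Reasoning
  open ℤSolver.+-*-Solver
  eq : ∀ a b → (a ℤ.+ b) ℤ.* + 1 ≡ (a ℤ.* + 1 ℤ.+ b ℤ.* + 1) ℤ.* + 1
  eq = solve 2 (λ a b → (a :+ b) :* con (+ 1) := (a :* con (+ 1) :+ b :* con (+ 1)) :* con (+ 1)) refl

ι-* : ∀ a b → ι (a ℤ.* b) ≡ ι a ℚ.* ι b
ι-* a b = ℚₚ.toℚᵘ-injective (begin-equality
  ℚ.toℚᵘ (ι (a ℤ.* b))             ≃⟨ toℚᵘ-ι (a ℤ.* b) ⟩
  ℚᵘ.mkℚᵘ a 0 ℚᵘ.* ℚᵘ.mkℚᵘ b 0     ≃⟨ ℚᵘₚ.*-cong (ℚᵘₚ.≃-sym (toℚᵘ-ι a)) (ℚᵘₚ.≃-sym (toℚᵘ-ι b)) ⟩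
  ℚ.toℚᵘ (ι a) ℚᵘ.* ℚ.toℚᵘ (ι b)   ≃⟨ ℚᵘₚ.≃-sym (ℚₚ.toℚᵘ-homo-* (ι a) (ι b)) ⟩
  ℚ.toℚᵘ (ι a ℚ.* ι b)             ∎)
  where open ℚᵘₚ.≤-Reasoning

ι-neg : ∀ a → ι (ℤ.- a) ≡ ℚ.- ι a
ι-neg a = ℚₚ.toℚᵘ-injective (begin-equality
  ℚ.toℚᵘ (ι (ℤ.- a))     ≃⟨ toℚᵘ-ι (ℤ.- a) ⟩
  ℚᵘ.- ℚᵘ.mkℚᵘ a 0       ≃⟨ ℚᵘₚ.-‿cong (ℚᵘₚ.≃-sym (toℚᵘ-ι a)) ⟩
  ℚᵘ.- ℚ.toℚᵘ (ι a)      ≃⟨ ℚᵘₚ.≃-sym (ℚₚ.toℚᵘ-homo‿- (ι a)) ⟩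
  ℚ.toℚᵘ (ℚ.- ι a)       ∎)
  where open ℚᵘₚ.≤-Reasoning

ι-injective : ∀ {a b} → ι a ≡ ι b → a ≡ b
ι-injective {a} {b} eq = cancel (ℚᵘₚ.≃-trans (ℚᵘₚ.≃-sym (toℚᵘ-ι a))
    (ℚᵘₚ.≃-trans (ℚₚ.toℚᵘ-cong eq) (toℚᵘ-ι b)))
  where
  cancel : ℚᵘ.mkℚᵘ a 0 ℚᵘ.≃ ℚᵘ.mkℚᵘ b 0 → a ≡ b
  cancel (ℚᵘ.*≡* h) = ℤₚ.*-cancelʳ-≡ a b (+ 1) h

ι-mono-≤ : ∀ {a b} → a ℤ.≤ b → ι a ℚ.≤ ι b
ι-mono-≤ {a} {b} h = ℚₚ.toℚᵘ-cancel-≤ (begin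
  ℚ.toℚᵘ (ι a)    ≃⟨ toℚᵘ-ι a ⟩
  ℚᵘ.mkℚᵘ a 0     ≤⟨ ℚᵘ.*≤* (ℤₚ.*-monoʳ-≤-nonNeg (+ 1) h) ⟩
  ℚᵘ.mkℚᵘ b 0     ≃⟨ ℚᵘₚ.≃-sym (toℚᵘ-ι b) ⟩
  ℚ.toℚᵘ (ι b)    ∎)
  where open ℚᵘₚ.≤-Reasoning

ι-mono-< : ∀ {a b} → a ℤ.< b → ι a ℚ.< ι b
ι-mono-< {a} {b} h = ℚₚ.toℚᵘ-cancel-< (begin-strict
  ℚ.toℚᵘ (ι a)    ≃⟨ toℚᵘ-ι a ⟩
  ℚᵘ.mkℚᵘ a 0     <⟨ ℚᵘ.*<* (ℤₚ.*-monoʳ-<-pos (+ 1) h) ⟩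
  ℚᵘ.mkℚᵘ b 0     ≃⟨ ℚᵘₚ.≃-sym (toℚᵘ-ι b) ⟩
  ℚ.toℚᵘ (ι b)    ∎)
  where open ℚᵘₚ.≤-Reasoning

/-*-cancel : ∀ a n → (a ℚ./ suc n) ℚ.* ι (+ suc n) ≡ ι a
/-*-cancel a n = ℚₚ.toℚᵘ-injective (begin-equality
  ℚ.toℚᵘ ((a ℚ./ suc n) ℚ.* ι (+ suc n))
    ≃⟨ ℚₚ.toℚᵘ-homo-* (a ℚ./ suc n) (ι (+ suc n)) ⟩
  ℚ.toℚᵘ (a ℚ./ suc n) ℚᵘ.* ℚ.toℚᵘ (ι (+ suc n))
    ≃⟨ ℚᵘₚ.*-cong (ℚₚ.toℚᵘ-fromℚᵘ (ℚᵘ.mkℚᵘ a n)) (toℚᵘ-ι (+ suc n)) ⟩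
  ℚᵘ.mkℚᵘ a n ℚᵘ.* ℚᵘ.mkℚᵘ (+ suc n) 0
    ≃⟨ ℚᵘ.*≡* (trans (eq a (+ suc n)) (cong (λ d → a ℤ.* + suc d) (sym (ℕₚ.*-identityʳ n)))) ⟩
  ℚᵘ.mkℚᵘ a 0
    ≃⟨ ℚᵘₚ.≃-sym (toℚᵘ-ι a) ⟩
  ℚ.toℚᵘ (ι a) ∎)
  where
  open ℚᵘₚ.≤-Reasoning
  open ℤSolver.+-*-Solver
  eq : ∀ a b → (a ℤ.* b) ℤ.* + 1 ≡ a ℤ.* b
  eq = solve 2 (λ a b → (a :* b) :* con (+ 1) := a :* b) refl

-- Real numbers

-- `x ≈ʳ y` says that the termwise difference is null, so the congruence laws of ℝ reduce to closure
-- properties of null sequences.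
IsNull : (ℕ → ℚ) → Set
IsNull s = ∀ ε → 0ℚ ℚ.< ε → ∃ λ N → ∀ n → N ℕ.≤ n → ∣ s n ∣ ℚ.< ε

EventuallyBounded : (ℕ → ℚ) → Set
EventuallyBounded s = ∃ λ B → 0ℚ ℚ.< B × ∃ λ N → ∀ n → N ℕ.≤ n → ∣ s n ∣ ℚ.≤ B

*-pos : ∀ {p q} → 0ℚ ℚ.< p → 0ℚ ℚ.< q → 0ℚ ℚ.< p ℚ.* q
*-pos {p} {q} 0<p 0<q = ℚₚ.positive⁻¹ (p ℚ.* q)
  where instance
    _ = ℚ.positive 0<p
    _ = ℚ.positive 0<q
    _ = ℚₚ.pos*pos⇒pos p q

recip : ∀ {q} → 0ℚ ℚ.< q → ∃ λ r → 0ℚ ℚ.< r × q ℚ.* r ≡ 1ℚ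
recip {q} 0<q = 1/ q , ℚₚ.positive⁻¹ (1/ q) , ℚₚ.*-inverseʳ q
  where instance
    _ = ℚ.positive 0<q
    _ = ℚₚ.pos⇒nonZero q
    _ = ℚₚ.1/pos⇒pos q

null-resp : ∀ {s t} → (∀ n → s n ≡ t n) → IsNull s → IsNull t
null-resp eq h ε 0<ε = let N , b = h ε 0<ε in
  N , λ n n≥ → subst (λ q → ∣ q ∣ ℚ.< ε) (eq n) (b n n≥)

null-0 : IsNull (λ _ → 0ℚ)
null-0 ε 0<ε = 0 , λ _ _ → 0<ε

null-mono : ∀ {s t} → (∃ λ M → ∀ n → M ℕ.≤ n → ∣ t n ∣ ℚ.≤ ∣ s n ∣) → IsNull s → IsNull t
null-mono (M , le) h ε 0<ε = let N , b = h ε 0<ε in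
  M ⊔ N , λ n n≥ → ℚₚ.≤-<-trans (le n (ℕₚ.m⊔n≤o⇒m≤o M N n≥)) (b n (ℕₚ.m⊔n≤o⇒n≤o M N n≥))

null-neg : ∀ {s} → IsNull s → IsNull (λ n → ℚ.- s n)
null-neg {s} = null-mono (0 , λ n _ → ℚₚ.≤-reflexive (ℚₚ.∣-p∣≡∣p∣ (s n)))

null-+ : ∀ {s t} → IsNull s → IsNull t → IsNull (λ n → s n ℚ.+ t n)
null-+ {s} {t} hs ht ε 0<ε =
  let M , bs = hs (½ ℚ.* ε) (*-pos (ℚₚ.positive⁻¹ ½) 0<ε)
      N , bt = ht (½ ℚ.* ε) (*-pos (ℚₚ.positive⁻¹ ½) 0<ε)
  in M ⊔ N , λ n n≥ → ℚₚ.≤-<-trans (ℚₚ.∣p+q∣≤∣p∣+∣q∣ (s n) (t n))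
    (subst (∣ s n ∣ ℚ.+ ∣ t n ∣ ℚ.<_) (halve ε)
      (ℚₚ.+-mono-< (bs n (ℕₚ.m⊔n≤o⇒m≤o M N n≥)) (bt n (ℕₚ.m⊔n≤o⇒n≤o M N n≥))))
  where
  open ℚSolver.+-*-Solver
  halve : ∀ e → ½ ℚ.* e ℚ.+ ½ ℚ.* e ≡ e
  halve = solve 1 (λ e → con ½ :* e :+ con ½ :* e := e) refl

null-* : ∀ {s t} → EventuallyBounded s → IsNull t → IsNull (λ n → s n ℚ.* t n)
null-* {s} {t} (B , 0<B , M , bs) ht ε 0<ε =
  let r , 0<r , Br = recip 0<B
      N , bt = ht (r ℚ.* ε) (*-pos 0<r 0<ε)
  in M ⊔ N , λ n n≥ → begin-strict
    ∣ s n ℚ.* t n ∣       ≡⟨ ℚₚ.∣p*q∣≡∣p∣*∣q∣ (s n) (t n) ⟩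
    ∣ s n ∣ ℚ.* ∣ t n ∣   ≤⟨ ℚₚ.*-monoʳ-≤-nonNeg ∣ t n ∣ {{ℚₚ.∣-∣-nonNeg (t n)}}
          (bs n (ℕₚ.m⊔n≤o⇒m≤o M N n≥)) ⟩
    B ℚ.* ∣ t n ∣         <⟨ ℚₚ.*-monoʳ-<-pos B {{ℚ.positive 0<B}} (bt n (ℕₚ.m⊔n≤o⇒n≤o M N n≥)) ⟩
    B ℚ.* (r ℚ.* ε)       ≡⟨ sym (ℚₚ.*-assoc B r ε) ⟩
    B ℚ.* r ℚ.* ε         ≡⟨ cong (ℚ._* ε) Br ⟩
    1ℚ ℚ.* ε              ≡⟨ ℚₚ.*-identityˡ ε ⟩
    ε ∎
  where open ℚₚ.≤-Reasoning

cauchy⇒bounded : ∀ x → EventuallyBounded (seq x)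
cauchy⇒bounded x =
  let N , h = cauchy x 1ℚ (ℚₚ.positive⁻¹ 1ℚ) in
  1ℚ ℚ.+ ∣ seq x N ∣ , ℚₚ.+-mono-<-≤ (ℚₚ.positive⁻¹ 1ℚ) (ℚₚ.0≤∣p∣ (seq x N)) , N , λ n n≥ → begin
    ∣ seq x n ∣                                ≡⟨ cong ∣_∣ (split (seq x n) (seq x N)) ⟩
    ∣ (seq x n ℚ.- seq x N) ℚ.+ seq x N ∣      ≤⟨ ℚₚ.∣p+q∣≤∣p∣+∣q∣ (seq x n ℚ.- seq x N) (seq x N) ⟩
    ∣ seq x n ℚ.- seq x N ∣ ℚ.+ ∣ seq x N ∣    ≤⟨ ℚₚ.+-monoˡ-≤ ∣ seq x N ∣ (ℚₚ.<⇒≤ (h n N n≥ ℕₚ.≤-refl)) ⟩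
    1ℚ ℚ.+ ∣ seq x N ∣ ∎
  where
  open ℚₚ.≤-Reasoning
  open ℚSolver.+-*-Solver
  split : ∀ a b → a ≡ (a ℚ.- b) ℚ.+ b
  split = solve 2 (λ a b → a := (a :- b) :+ b) refl

-- The operations on ℝ act termwise, so every ring law is inherited from ℚ through this; only the
-- congruences take estimates.
≈ʳ-≡ : ∀ {x y} → (∀ n → seq x n ≡ seq y n) → x ≈ʳ y
≈ʳ-≡ {x} {y} eq = mk≈ʳ (null-resp {λ _ → 0ℚ} (λ n → trans (sym (ℚₚ.+-inverseʳ (seq x n)))
      (cong (λ q → seq x n ℚ.- q) (eq n))) null-0)

≈ʳ-refl : ∀ {x} → x ≈ʳ x
≈ʳ-refl = ≈ʳ-≡ (λ _ → refl)

≈ʳ-sym : ∀ {x y} → x ≈ʳ y → y ≈ʳ x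
≈ʳ-sym {x} {y} (mk≈ʳ h) = mk≈ʳ (null-resp (λ n → flip (seq x n) (seq y n)) (null-neg h))
  where
  open ℚSolver.+-*-Solver
  flip : ∀ a b → ℚ.- (a ℚ.- b) ≡ b ℚ.- a
  flip = solve 2 (λ a b → :- (a :- b) := b :- a) refl

≈ʳ-trans : ∀ {x y z} → x ≈ʳ y → y ≈ʳ z → x ≈ʳ z
≈ʳ-trans {x} {y} {z} (mk≈ʳ h) (mk≈ʳ k) = mk≈ʳ (null-resp (λ n → eq (seq x n) (seq y n) (seq z n))
      (null-+ h k))
  where
  open ℚSolver.+-*-Solver
  eq : ∀ a b c → (a ℚ.- b) ℚ.+ (b ℚ.- c) ≡ a ℚ.- c
  eq = solve 3 (λ a b c → (a :- b) :+ (b :- c) := a :- c) refl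

+ʳ-cong : ∀ {x x′ y y′} → x ≈ʳ x′ → y ≈ʳ y′ → x +ʳ y ≈ʳ x′ +ʳ y′
+ʳ-cong {x} {x′} {y} {y′} (mk≈ʳ h) (mk≈ʳ k) =
  mk≈ʳ (null-resp (λ n → eq (seq x n) (seq x′ n) (seq y n) (seq y′ n)) (null-+ h k))
  where
  open ℚSolver.+-*-Solver
  eq : ∀ a a′ b b′ → (a ℚ.- a′) ℚ.+ (b ℚ.- b′) ≡ (a ℚ.+ b) ℚ.- (a′ ℚ.+ b′)
  eq = solve 4 (λ a a′ b b′ → (a :- a′) :+ (b :- b′) := (a :+ b) :- (a′ :+ b′)) refl

-ʳ-cong : ∀ {x x′} → x ≈ʳ x′ → -ʳ x ≈ʳ -ʳ x′
-ʳ-cong {x} {x′} (mk≈ʳ h) = mk≈ʳ (null-resp (λ n → eq (seq x n) (seq x′ n)) (null-neg h))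
  where
  open ℚSolver.+-*-Solver
  eq : ∀ a b → ℚ.- (a ℚ.- b) ≡ (ℚ.- a) ℚ.- (ℚ.- b)
  eq = solve 2 (λ a b → :- (a :- b) := (:- a) :- (:- b)) refl

*ʳ-cong : ∀ {x x′ y y′} → x ≈ʳ x′ → y ≈ʳ y′ → x *ʳ y ≈ʳ x′ *ʳ y′
*ʳ-cong {x} {x′} {y} {y′} (mk≈ʳ h) (mk≈ʳ k) =
  mk≈ʳ (null-resp (λ n → eq (seq x n) (seq x′ n) (seq y n) (seq y′ n))
    (null-+ (null-* (cauchy⇒bounded x) k) (null-* (cauchy⇒bounded y′) h)))
  where
  open ℚSolver.+-*-Solver
  eq : ∀ a a′ b b′ → a ℚ.* (b ℚ.- b′) ℚ.+ b′ ℚ.* (a ℚ.- a′) ≡ a ℚ.* b ℚ.- a′ ℚ.* b′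
  eq = solve 4 (λ a a′ b b′ → a :* (b :- b′) :+ b′ :* (a :- a′) := a :* b :- a′ :* b′) refl

ℝ-isCommutativeRing : IsCommutativeRing _≈ʳ_ _+ʳ_ _*ʳ_ -ʳ_ 0ʳ 1ʳ
ℝ-isCommutativeRing = record
  { isRing = record
    { +-isAbelianGroup = record
      { isGroup = record
        { isMonoid = record
          { isSemigroup = record
            { isMagma = record
              { isEquivalence = record { refl = ≈ʳ-refl ; sym = ≈ʳ-sym ; trans = ≈ʳ-trans }
              ; ∙-cong = +ʳ-cong }
            ; assoc = λ x y z → ≈ʳ-≡ λ n → ℚₚ.+-assoc (seq x n) (seq y n) (seq z n) }
          ; identity = (λ x → ≈ʳ-≡ λ n → ℚₚ.+-identityˡ (seq x n))
                     , (λ x → ≈ʳ-≡ λ n → ℚₚ.+-identityʳ (seq x n)) }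
        ; inverse = (λ x → ≈ʳ-≡ λ n → ℚₚ.+-inverseˡ (seq x n))
                  , (λ x → ≈ʳ-≡ λ n → ℚₚ.+-inverseʳ (seq x n))
        ; ⁻¹-cong = -ʳ-cong }
      ; comm = λ x y → ≈ʳ-≡ λ n → ℚₚ.+-comm (seq x n) (seq y n) }
    ; *-cong = *ʳ-cong
    ; *-assoc = λ x y z → ≈ʳ-≡ λ n → ℚₚ.*-assoc (seq x n) (seq y n) (seq z n)
    ; *-identity = (λ x → ≈ʳ-≡ λ n → ℚₚ.*-identityˡ (seq x n))
                 , (λ x → ≈ʳ-≡ λ n → ℚₚ.*-identityʳ (seq x n))
    ; distrib = (λ x y z → ≈ʳ-≡ λ n → ℚₚ.*-distribˡ-+ (seq x n) (seq y n) (seq z n))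
              , (λ x y z → ≈ʳ-≡ λ n → ℚₚ.*-distribʳ-+ (seq x n) (seq y n) (seq z n)) }
  ; *-comm = λ x y → ≈ʳ-≡ λ n → ℚₚ.*-comm (seq x n) (seq y n) }

p-q≡0⇒p≡q : ∀ {p q} → p ℚ.- q ≡ 0ℚ → p ≡ q
p-q≡0⇒p≡q {p} {q} eq = trans (split p q) (trans (cong (ℚ._+ q) eq) (ℚₚ.+-identityˡ q))
  where
  open ℚSolver.+-*-Solver
  split : ∀ a b → a ≡ (a ℚ.- b) ℚ.+ b
  split = solve 2 (λ a b → a := (a :- b) :+ b) refl

-- For constant sequences the distance is a fixed rational; if it were positive, it could itself be
-- taken as ε.
fromℚʳ-injective : ∀ {p q} → fromℚʳ p ≈ʳ fromℚʳ q → p ≡ q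
fromℚʳ-injective {p} {q} (mk≈ʳ h) with 0ℚ ℚₚ.<? ∣ p ℚ.- q ∣
... | yes pos = let N , b = h ∣ p ℚ.- q ∣ pos in contradiction (b N ℕₚ.≤-refl) (ℚₚ.<-irrefl refl)
... | no ¬pos = p-q≡0⇒p≡q (ℚₚ.∣p∣≡0⇒p≡0 (p ℚ.- q) (ℚₚ.≤-antisym (ℚₚ.≮⇒≥ ¬pos) (ℚₚ.0≤∣p∣ (p ℚ.- q))))

square-nonNeg : ∀ p → 0ℚ ℚ.≤ p ℚ.* p
square-nonNeg p with ℚₚ.∣p∣≡p∨∣p∣≡-p p
... | inj₁ eq = subst (0ℚ ℚ.≤_) (trans (ℚₚ.∣p*q∣≡∣p∣*∣q∣ p p) (cong₂ ℚ._*_ eq eq)) (ℚₚ.0≤∣p∣ (p ℚ.* p))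
... | inj₂ eq = subst (0ℚ ℚ.≤_) (trans (ℚₚ.∣p*q∣≡∣p∣*∣q∣ p p) (trans (cong₂ ℚ._*_ eq eq) (sq p)))
      (ℚₚ.0≤∣p∣ (p ℚ.* p))
  where
  open ℚSolver.+-*-Solver
  sq : ∀ a → (ℚ.- a) ℚ.* (ℚ.- a) ≡ a ℚ.* a
  sq = solve 1 (λ a → (:- a) :* (:- a) := a :* a) refl

-- The squares are tested against ε²: a term with ε ≤ |s n| would have a square of size at least ε².
null-sqrt : ∀ {s} → IsNull (λ n → s n ℚ.* s n) → IsNull s
null-sqrt {s} h ε 0<ε = let N , b = h (ε ℚ.* ε) (*-pos 0<ε 0<ε) in
  N , λ n n≥ → ℚₚ.≰⇒> λ ε≤ → ℚₚ.<-irrefl refl (ℚₚ.<-≤-trans (b n n≥) (begin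
    ε ℚ.* ε               ≤⟨ ℚₚ.*-monoˡ-≤-nonNeg ε {{ℚ.nonNegative (ℚₚ.<⇒≤ 0<ε)}} ε≤ ⟩
    ε ℚ.* ∣ s n ∣         ≤⟨ ℚₚ.*-monoʳ-≤-nonNeg ∣ s n ∣ {{ℚₚ.∣-∣-nonNeg (s n)}} ε≤ ⟩
    ∣ s n ∣ ℚ.* ∣ s n ∣   ≡⟨ sym (ℚₚ.∣p*q∣≡∣p∣*∣q∣ (s n) (s n)) ⟩
    ∣ s n ℚ.* s n ∣ ∎))
  where open ℚₚ.≤-Reasoning

≈ʳ0⇒null : ∀ {x} → x ≈ʳ 0ʳ → IsNull (seq x)
≈ʳ0⇒null {x} (mk≈ʳ h) = null-resp (λ n → ℚₚ.+-identityʳ (seq x n)) h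

null⇒≈ʳ0 : ∀ {x} → IsNull (seq x) → x ≈ʳ 0ʳ
null⇒≈ʳ0 {x} h = mk≈ʳ (null-resp (λ n → sym (ℚₚ.+-identityʳ (seq x n))) h)

-- The inequality a² ≤ a² + b² holds in ℚ at every index, so the null sequence of sums dominates the
-- squares of x.
x²+y²≈0⇒x≈0 : ∀ x y → x *ʳ x +ʳ y *ʳ y ≈ʳ 0ʳ → x ≈ʳ 0ʳ
x²+y²≈0⇒x≈0 x y h = null⇒≈ʳ0 {x} (null-sqrt (null-mono (0 , λ n _ → bound (seq x n) (seq y n)) (≈ʳ0⇒null h)))
  where
  bound : ∀ a b → ∣ a ℚ.* a ∣ ℚ.≤ ∣ a ℚ.* a ℚ.+ b ℚ.* b ∣
  bound a b = begin
    ∣ a ℚ.* a ∣              ≡⟨ ℚₚ.0≤p⇒∣p∣≡p (square-nonNeg a) ⟩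
    a ℚ.* a                  ≡⟨ sym (ℚₚ.+-identityʳ (a ℚ.* a)) ⟩
    a ℚ.* a ℚ.+ 0ℚ           ≤⟨ ℚₚ.+-monoʳ-≤ (a ℚ.* a) (square-nonNeg b) ⟩
    a ℚ.* a ℚ.+ b ℚ.* b      ≡⟨ sym (ℚₚ.0≤p⇒∣p∣≡p (ℚₚ.+-mono-≤ (square-nonNeg a) (square-nonNeg b))) ⟩
    ∣ a ℚ.* a ℚ.+ b ℚ.* b ∣  ∎
    where open ℚₚ.≤-Reasoning

x²≈0⇒x≈0 : ∀ x → x *ʳ x ≈ʳ 0ʳ → x ≈ʳ 0ʳ
x²≈0⇒x≈0 x h = null⇒≈ʳ0 {x} (null-sqrt (≈ʳ0⇒null h))

p≤∣p∣ : ∀ p → p ℚ.≤ ∣ p ∣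
p≤∣p∣ p with ℚₚ.≤-total 0ℚ p
... | inj₁ 0≤p = ℚₚ.≤-reflexive (sym (ℚₚ.0≤p⇒∣p∣≡p 0≤p))
... | inj₂ p≤0 = ℚₚ.≤-trans p≤0 (ℚₚ.0≤∣p∣ p)

∣∣-≤ : ∀ p {b} → p ℚ.≤ b → ℚ.- p ℚ.≤ b → ∣ p ∣ ℚ.≤ b
∣∣-≤ p {b} p≤b -p≤b with ℚₚ.∣p∣≡p∨∣p∣≡-p p
... | inj₁ eq = subst (ℚ._≤ b) (sym eq) p≤b
... | inj₂ eq = subst (ℚ._≤ b) (sym eq) -p≤b

-- Division by t without forming 1/t: with r = 1/δ, eventually |s| ≤ |r s t|, and a constant
-- multiple of a null sequence is null.
null-cancel : ∀ {s t : ℕ → ℚ} δ → 0ℚ ℚ.< δ → (∃ λ N → ∀ n → N ℕ.≤ n → δ ℚ.≤ t n) →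
  IsNull (λ n → s n ℚ.* t n) → IsNull s
null-cancel {s} {t} δ 0<δ (N , far) h =
  let r , 0<r , δr = recip 0<δ in
  null-mono (N , λ n n≥ → begin
    ∣ s n ∣                              ≡⟨ sym (ℚₚ.*-identityˡ ∣ s n ∣) ⟩
    1ℚ ℚ.* ∣ s n ∣                       ≡⟨ cong (ℚ._* ∣ s n ∣) (sym (trans (ℚₚ.*-comm r δ) δr)) ⟩
    r ℚ.* δ ℚ.* ∣ s n ∣                  ≤⟨ ℚₚ.*-monoʳ-≤-nonNeg ∣ s n ∣ {{ℚₚ.∣-∣-nonNeg (s n)}}
                                              (ℚₚ.*-monoˡ-≤-nonNeg r {{ℚ.nonNegative (ℚₚ.<⇒≤ 0<r)}}
                                                    (ℚₚ.≤-trans (far n n≥) (p≤∣p∣ (t n)))) ⟩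
    r ℚ.* ∣ t n ∣ ℚ.* ∣ s n ∣            ≡⟨ cong (λ q → q ℚ.* ∣ t n ∣ ℚ.* ∣ s n ∣)
          (sym (ℚₚ.0≤p⇒∣p∣≡p (ℚₚ.<⇒≤ 0<r))) ⟩
    ∣ r ∣ ℚ.* ∣ t n ∣ ℚ.* ∣ s n ∣        ≡⟨ eq (∣ r ∣) (∣ t n ∣) (∣ s n ∣) ⟩
    ∣ r ∣ ℚ.* (∣ s n ∣ ℚ.* ∣ t n ∣)      ≡⟨ cong (∣ r ∣ ℚ.*_) (sym (ℚₚ.∣p*q∣≡∣p∣*∣q∣ (s n) (t n))) ⟩
    ∣ r ∣ ℚ.* ∣ s n ℚ.* t n ∣            ≡⟨ sym (ℚₚ.∣p*q∣≡∣p∣*∣q∣ r (s n ℚ.* t n)) ⟩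
    ∣ r ℚ.* (s n ℚ.* t n) ∣ ∎)
    (null-* {λ _ → r} (r , 0<r , 0 , λ _ _ → ℚₚ.≤-reflexive (ℚₚ.0≤p⇒∣p∣≡p (ℚₚ.<⇒≤ 0<r))) h)
  where
  open ℚₚ.≤-Reasoning
  open ℚSolver.+-*-Solver
  eq : ∀ a b c → a ℚ.* b ℚ.* c ≡ a ℚ.* (c ℚ.* b)
  eq = solve 3 (λ a b c → a :* b :* c := a :* (c :* b)) refl

¼ : ℚ
¼ = ½ ℚ.* ½

-- One term of the sequence, taken where the tail varies by less than ¼,
-- decides which of the two factors stays away from 0.
x[1-x]≈0⇒x≈0⊎1-x≈0 : ∀ x → x *ʳ (1ʳ +ʳ -ʳ x) ≈ʳ 0ʳ → x ≈ʳ 0ʳ ⊎ 1ʳ +ʳ -ʳ x ≈ʳ 0ʳ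
x[1-x]≈0⇒x≈0⊎1-x≈0 x h with cauchy x ¼ (ℚₚ.positive⁻¹ ¼)
... | N , near with seq x N ℚₚ.≤? ½
... | yes x≤½ = inj₁ (null⇒≈ʳ0 (null-cancel {seq x} {λ n → 1ℚ ℚ.- seq x n} ¼ (ℚₚ.positive⁻¹ ¼)
      (N , far) (≈ʳ0⇒null h)))
  where
  open ℚSolver.+-*-Solver
  eq : ∀ a b → (1ℚ ℚ.- ½) ℚ.- (a ℚ.- b) ≡ (1ℚ ℚ.- a) ℚ.- (½ ℚ.- b)
  eq = solve 2 (λ a b → (con 1ℚ :- con ½) :- (a :- b) := (con 1ℚ :- a) :- (con ½ :- b)) refl
  far : ∀ n → N ℕ.≤ n → ¼ ℚ.≤ 1ℚ ℚ.- seq x n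
  far n n≥ = begin
    ¼                                                ≡⟨⟩
    (1ℚ ℚ.- ½) ℚ.- ¼                                 ≤⟨ ℚₚ.+-monoʳ-≤ (1ℚ ℚ.- ½)
          (ℚₚ.neg-antimono-≤ (ℚₚ.≤-trans (p≤∣p∣ _) (ℚₚ.<⇒≤ (near n N n≥ ℕₚ.≤-refl)))) ⟩
    (1ℚ ℚ.- ½) ℚ.- (seq x n ℚ.- seq x N)             ≡⟨ eq (seq x n) (seq x N) ⟩
    (1ℚ ℚ.- seq x n) ℚ.- (½ ℚ.- seq x N)             ≤⟨ ℚₚ.+-monoʳ-≤ (1ℚ ℚ.- seq x n)
          (ℚₚ.neg-antimono-≤ (subst (ℚ._≤ ½ ℚ.- seq x N) (ℚₚ.+-inverseʳ (seq x N))
          (ℚₚ.+-monoˡ-≤ (ℚ.- seq x N) x≤½))) ⟩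
    (1ℚ ℚ.- seq x n) ℚ.+ 0ℚ                          ≡⟨ ℚₚ.+-identityʳ _ ⟩
    1ℚ ℚ.- seq x n ∎
    where open ℚₚ.≤-Reasoning
... | no x≰½ = inj₂ (null⇒≈ʳ0 (null-cancel {λ n → 1ℚ ℚ.- seq x n} {seq x} ¼ (ℚₚ.positive⁻¹ ¼) (N , far)
    (null-resp (λ n → ℚₚ.*-comm (seq x n) _) (≈ʳ0⇒null h))))
  where
  open ℚSolver.+-*-Solver
  eq : ∀ a b → b ℚ.- (b ℚ.- a) ≡ a
  eq = solve 2 (λ a b → b :- (b :- a) := a) refl
  far : ∀ n → N ℕ.≤ n → ¼ ℚ.≤ seq x n
  far n n≥ = begin
    ½ ℚ.- ¼                              ≤⟨ ℚₚ.+-mono-≤ (ℚₚ.<⇒≤ (ℚₚ.≰⇒> x≰½))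
          (ℚₚ.neg-antimono-≤ (ℚₚ.≤-trans (p≤∣p∣ _) (ℚₚ.<⇒≤ (near N n ℕₚ.≤-refl n≥)))) ⟩
    seq x N ℚ.- (seq x N ℚ.- seq x n)    ≡⟨ eq (seq x n) (seq x N) ⟩
    seq x n ∎
    where open ℚₚ.≤-Reasoning

-- The square of the real square root of a natural number

ιℕ : ℕ → ℚ
ιℕ n = ι (+ n)

ιℕ-+ : ∀ m n → ιℕ (m ℕ.+ n) ≡ ιℕ m ℚ.+ ιℕ n
ιℕ-+ m n = ι-+ (+ m) (+ n)

ιℕ-* : ∀ m n → ιℕ (m ℕ.* n) ≡ ιℕ m ℚ.* ιℕ n
ιℕ-* m n = trans (cong ι (ℤₚ.pos-* m n)) (ι-* (+ m) (+ n))

ιℕ-mono-≤ : ∀ m n → m ℕ.≤ n → ιℕ m ℚ.≤ ιℕ n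
ιℕ-mono-≤ m n h = ι-mono-≤ {+ m} {+ n} (ℤ.+≤+ h)

ιℕ-mono-< : ∀ m n → m ℕ.< n → ιℕ m ℚ.< ιℕ n
ιℕ-mono-< m n h = ι-mono-< {+ m} {+ n} (ℤ.+<+ h)

0≤ιℕ : ∀ n → 0ℚ ℚ.≤ ιℕ n
0≤ιℕ n = ιℕ-mono-≤ 0 n ℕ.z≤n

ιℕ-nonNeg : ∀ n → ℚ.NonNegative (ιℕ n)
ιℕ-nonNeg n = ℚ.nonNegative (0≤ιℕ n)

-- The crude bound √n ≤ n, which holds because n ≤ n² for natural n. It makes the rounding error
-- below linear in K.
isqrt-scaled-≤ : ∀ n K → isqrt (n ℕ.* (K ℕ.* K)) ℕ.≤ n ℕ.* K
isqrt-scaled-≤ zero    K = ℕ.z≤n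
isqrt-scaled-≤ (suc m) K = ℕₚ.≮⇒≥ λ nK<a → ℕₚ.<-irrefl refl (begin-strict
  n ℕ.* K ℕ.* (n ℕ.* K)     <⟨ ℕₚ.*-mono-< nK<a nK<a ⟩
  a ℕ.* a                   ≤⟨ isqrt-lower (n ℕ.* (K ℕ.* K)) ⟩
  n ℕ.* (K ℕ.* K)           ≤⟨ ℕₚ.m≤n*m (n ℕ.* (K ℕ.* K)) n ⟩
  n ℕ.* (n ℕ.* (K ℕ.* K))   ≡⟨ eq n K ⟩
  n ℕ.* K ℕ.* (n ℕ.* K) ∎)
  where
  open ℕₚ.≤-Reasoning
  open ℕSolver.+-*-Solver
  n a : ℕ
  n = suc m
  a = isqrt (n ℕ.* (K ℕ.* K))
  eq : ∀ n K → n ℕ.* (n ℕ.* (K ℕ.* K)) ≡ n ℕ.* K ℕ.* (n ℕ.* K)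
  eq = solve 2 (λ n K → n :* (n :* (K :* K)) := n :* K :* (n :* K)) refl

-- With a = ⌊K√n⌋ one has a² ≤ nK² ≤ a² + 2a and a ≤ nK, so the error of the squared approximation
-- is at most 2n/K. Denominators are multiplied out, which leaves comparisons of natural numbers.
√seq-error : ∀ n k → ∣ √seq n k ℚ.* √seq n k ℚ.- ιℕ n ∣ ℚ.* ιℕ (suc k) ℚ.≤ ιℕ (2 ℕ.* n)
√seq-error n k = ℚₚ.*-cancelʳ-≤-pos κ (begin
  ∣ s ℚ.* s ℚ.- ιℕ n ∣ ℚ.* κ ℚ.* κ              ≡⟨ cong (λ q → ∣ s ℚ.* s ℚ.- ιℕ n ∣ ℚ.* q ℚ.* q)
        (sym (ℚₚ.0≤p⇒∣p∣≡p {κ} (0≤ιℕ K))) ⟩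
  ∣ s ℚ.* s ℚ.- ιℕ n ∣ ℚ.* ∣ κ ∣ ℚ.* ∣ κ ∣      ≡⟨ sym
        (trans (ℚₚ.∣p*q∣≡∣p∣*∣q∣ ((s ℚ.* s ℚ.- ιℕ n) ℚ.* κ) κ)
        (cong (ℚ._* ∣ κ ∣) (ℚₚ.∣p*q∣≡∣p∣*∣q∣ (s ℚ.* s ℚ.- ιℕ n) κ))) ⟩
  ∣ (s ℚ.* s ℚ.- ιℕ n) ℚ.* κ ℚ.* κ ∣            ≡⟨ cong ∣_∣ (expand s (ιℕ n) κ) ⟩
  ∣ (s ℚ.* κ) ℚ.* (s ℚ.* κ) ℚ.- ιℕ n ℚ.* (κ ℚ.* κ) ∣
    ≡⟨ cong₂ (λ p q → ∣ p ℚ.- q ∣) (trans (cong₂ ℚ._*_ (/-*-cancel (+ a) k) (/-*-cancel (+ a) k))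
          (sym (ιℕ-* a a))) (trans (cong (ιℕ n ℚ.*_) (sym (ιℕ-* K K))) (sym (ιℕ-* n (K ℕ.* K)))) ⟩
  ∣ ιℕ (a ℕ.* a) ℚ.- ιℕ M ∣                     ≤⟨ ∣∣-≤ (ιℕ (a ℕ.* a) ℚ.- ιℕ M) upper lower ⟩
  ιℕ (2 ℕ.* n ℕ.* K)                            ≡⟨ ιℕ-* (2 ℕ.* n) K ⟩
  ιℕ (2 ℕ.* n) ℚ.* κ ∎)
  where
  open ℚₚ.≤-Reasoning
  K M a : ℕ
  K = suc k
  M = n ℕ.* (K ℕ.* K)
  a = isqrt M
  s κ : ℚ
  s = √seq n k
  κ = ιℕ K
  instance
    _ : ℚ.Positive κ
    _ = ℚ.positive (ιℕ-mono-< 0 K (ℕ.s≤s ℕ.z≤n))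
  expand : ∀ s n κ → (s ℚ.* s ℚ.- n) ℚ.* κ ℚ.* κ ≡ (s ℚ.* κ) ℚ.* (s ℚ.* κ) ℚ.- n ℚ.* (κ ℚ.* κ)
  expand = solve 3 (λ s n κ → (s :* s :- n) :* κ :* κ := (s :* κ) :* (s :* κ) :- n :* (κ :* κ)) refl
    where open ℚSolver.+-*-Solver
  flip : ∀ a b → ℚ.- (a ℚ.- b) ≡ b ℚ.- a
  flip = solve 2 (λ a b → :- (a :- b) := b :- a) refl
    where open ℚSolver.+-*-Solver
  cancel : ∀ a b → (a ℚ.+ b) ℚ.- a ≡ b
  cancel = solve 2 (λ a b → (a :+ b) :- a := b) refl
    where open ℚSolver.+-*-Solver
  M≤ : M ℕ.≤ a ℕ.* a ℕ.+ 2 ℕ.* n ℕ.* K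
  M≤ = ℕ.s≤s⁻¹ (ℕₚ.≤-trans (isqrt-upper M) (ℕₚ.≤-trans (ℕₚ.≤-reflexive (eq a))
        (ℕ.s≤s (ℕₚ.+-monoʳ-≤ (a ℕ.* a) (ℕₚ.≤-trans (ℕₚ.*-monoʳ-≤ 2 (isqrt-scaled-≤ n K))
        (ℕₚ.≤-reflexive (sym (ℕₚ.*-assoc 2 n K))))))))
    where
    open ℕSolver.+-*-Solver
    eq : ∀ a → (1 ℕ.+ a) ℕ.* (1 ℕ.+ a) ≡ 1 ℕ.+ (a ℕ.* a ℕ.+ 2 ℕ.* a)
    eq = solve 1 (λ a → (con 1 :+ a) :* (con 1 :+ a) := con 1 :+ (a :* a :+ con 2 :* a)) refl
  upper : ιℕ (a ℕ.* a) ℚ.- ιℕ M ℚ.≤ ιℕ (2 ℕ.* n ℕ.* K)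
  upper = ℚₚ.≤-trans (subst (ιℕ (a ℕ.* a) ℚ.- ιℕ M ℚ.≤_) (ℚₚ.+-inverseʳ (ιℕ M))
        (ℚₚ.+-monoˡ-≤ (ℚ.- ιℕ M) (ιℕ-mono-≤ (a ℕ.* a) M (isqrt-lower M)))) (0≤ιℕ (2 ℕ.* n ℕ.* K))
  lower : ℚ.- (ιℕ (a ℕ.* a) ℚ.- ιℕ M) ℚ.≤ ιℕ (2 ℕ.* n ℕ.* K)
  lower = begin
    ℚ.- (ιℕ (a ℕ.* a) ℚ.- ιℕ M)                                    ≡⟨ flip (ιℕ (a ℕ.* a)) (ιℕ M) ⟩
    ιℕ M ℚ.- ιℕ (a ℕ.* a)                                          ≤⟨ ℚₚ.+-monoˡ-≤ (ℚ.- ιℕ (a ℕ.* a))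
          (ιℕ-mono-≤ M _ M≤) ⟩
    ιℕ (a ℕ.* a ℕ.+ 2 ℕ.* n ℕ.* K) ℚ.- ιℕ (a ℕ.* a)                ≡⟨ cong (ℚ._- ιℕ (a ℕ.* a))
          (ιℕ-+ (a ℕ.* a) (2 ℕ.* n ℕ.* K)) ⟩
    (ιℕ (a ℕ.* a) ℚ.+ ιℕ (2 ℕ.* n ℕ.* K)) ℚ.- ιℕ (a ℕ.* a)         ≡⟨ cancel (ιℕ (a ℕ.* a))
          (ιℕ (2 ℕ.* n ℕ.* K)) ⟩
    ιℕ (2 ℕ.* n ℕ.* K) ∎

-- A positive fraction has numerator at least 1. This is the Archimedean property with an explicit
-- bound, and it supplies the modulus of convergence in `√ʳ-square`.
pos⇒1≤↧* : ∀ {ε} → 0ℚ ℚ.< ε → 1ℚ ℚ.≤ ε ℚ.* ιℕ (↧ₙ ε)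
pos⇒1≤↧* {ε} 0<ε with ε | ℚ.positive 0<ε
... | p@(mkℚ (+ suc m) d _) | _ = begin
  1ℚ                                     ≤⟨ ιℕ-mono-≤ 1 (suc m) (ℕ.s≤s ℕ.z≤n) ⟩
  ιℕ (suc m)                             ≡⟨ sym (/-*-cancel (+ suc m) d) ⟩
  (+ suc m ℚ./ suc d) ℚ.* ιℕ (suc d)     ≡⟨ cong (ℚ._* ιℕ (suc d)) (ℚₚ.↥p/↧p≡p p) ⟩
  p ℚ.* ιℕ (suc d) ∎
  where open ℚₚ.≤-Reasoning

√ʳ-square : ∀ n → √ʳ n *ʳ √ʳ n ≈ʳ fromℚʳ (ιℕ n)
√ʳ-square n = mk≈ʳ λ ε 0<ε → 2 ℕ.* n ℕ.* ↧ₙ ε , λ k k≥ → ℚₚ.≰⇒> λ ε≤ →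
  ℚₚ.<-irrefl refl (begin-strict
    ιℕ (2 ℕ.* n ℕ.* ↧ₙ ε)                  <⟨ ιℕ-mono-< (2 ℕ.* n ℕ.* ↧ₙ ε) (suc k) (ℕ.s≤s k≥) ⟩
    ιℕ (suc k)                             ≡⟨ sym (ℚₚ.*-identityʳ (ιℕ (suc k))) ⟩
    ιℕ (suc k) ℚ.* 1ℚ                      ≤⟨ ℚₚ.*-monoˡ-≤-nonNeg (ιℕ (suc k)) {{ιℕ-nonNeg (suc k)}}
          (pos⇒1≤↧* 0<ε) ⟩
    ιℕ (suc k) ℚ.* (ε ℚ.* ιℕ (↧ₙ ε))       ≡⟨ eq (ιℕ (suc k)) ε (ιℕ (↧ₙ ε)) ⟩
    ε ℚ.* ιℕ (suc k) ℚ.* ιℕ (↧ₙ ε)         ≤⟨ ℚₚ.*-monoʳ-≤-nonNeg (ιℕ (↧ₙ ε)) {{ιℕ-nonNeg (↧ₙ ε)}}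
                                                (ℚₚ.≤-trans
                                                      (ℚₚ.*-monoʳ-≤-nonNeg
                                                      (ιℕ (suc k)) {{ιℕ-nonNeg (suc k)}} ε≤)
                                                      (√seq-error n k)) ⟩
    ιℕ (2 ℕ.* n) ℚ.* ιℕ (↧ₙ ε)             ≡⟨ sym (ιℕ-* (2 ℕ.* n) (↧ₙ ε)) ⟩
    ιℕ (2 ℕ.* n ℕ.* ↧ₙ ε) ∎)
  where
  open ℚₚ.≤-Reasoning
  open ℚSolver.+-*-Solver
  eq : ∀ k e d → k ℚ.* (e ℚ.* d) ≡ e ℚ.* k ℚ.* d
  eq = solve 3 (λ k e d → k :* (e :* d) := e :* k :* d) refl

-- Polynomial identities

-- Used for ℝ and for ℂ. The operations are parameters, hence neutral in the
-- proofs below: comparing concrete sums and products of Cauchy sequences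
-- would unfold them.
module RationalAlgebra
  (A : Set) (_≃_ : A → A → Set) (_⊞_ _⊠_ : A → A → A) (⊟_ : A → A) (η : ℚ → A)
  (isCommutativeRing : IsCommutativeRing _≃_ _⊞_ _⊠_ ⊟_ (η 0ℚ) (η 1ℚ))
  (η-+ : ∀ p q → η (p ℚ.+ q) ≃ (η p ⊞ η q))
  (η-* : ∀ p q → η (p ℚ.* q) ≃ (η p ⊠ η q))
  (η-neg : ∀ p → η (ℚ.- p) ≃ (⊟ η p)) where

  open IsCommutativeRing isCommutativeRing
    using (+-cong; +-identityˡ; *-congˡ; +-congʳ; -‿inverseʳ; zeroʳ)
    renaming (refl to ≃-refl; trans to ≃-trans)

  private
    R : CommutativeRing 0ℓ 0ℓ
    R = record { isCommutativeRing = isCommutativeRing }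

    ℚ-rawRing : RawRing 0ℓ 0ℓ
    ℚ-rawRing = CommutativeRing.rawRing ℚₚ.+-*-commutativeRing

    η-morphism : ℚ-rawRing -Raw-AlmostCommutative⟶ fromCommutativeRing R
    η-morphism = record
      { ⟦_⟧ = η ; +-homo = η-+ ; *-homo = η-* ; -‿homo = η-neg ; 0-homo = ≃-refl ; 1-homo = ≃-refl }

    η-≟ : ∀ p q → Maybe (η p ≃ η q)
    η-≟ p q with p ℚₚ.≟ q
    ... | yes refl = just ≃-refl
    ... | no _     = nothing

  open Algebra.Solver.Ring ℚ-rawRing (fromCommutativeRing R) η-morphism η-≟
  open Groupₚ (CommutativeRing.+-group R) using (x∙y⁻¹≈ε⇒x≈y)

  private
    infixl 6 _-_
    _-_ : A → A → A
    x - y = x ⊞ (⊟ y)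

    multiple : ∀ c {u v} → u ≃ v → (c ⊠ (u - v)) ≃ η 0ℚ
    multiple c {u} {v} h = ≃-trans (*-congˡ (≃-trans (+-congʳ h) (-‿inverseʳ v))) (zeroʳ c)

    sum-0 : ∀ {x y} → x ≃ η 0ℚ → y ≃ η 0ℚ → (x ⊞ y) ≃ η 0ℚ
    sum-0 h k = ≃-trans (+-cong h k) (+-identityˡ (η 0ℚ))

    -- To derive a = b from equations uᵢ = vᵢ, write a − b as a linear
    -- combination of the uᵢ − vᵢ.
    linear₁ : ∀ {a b} c {u v} → u ≃ v → (a - b) ≃ (c ⊠ (u - v)) → a ≃ b
    linear₁ {a} {b} c h eq = x∙y⁻¹≈ε⇒x≈y a b (≃-trans eq (multiple c h))

    linear₂ : ∀ {a b} c {u v} d {u′ v′} → u ≃ v → u′ ≃ v′ →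
      (a - b) ≃ ((c ⊠ (u - v)) ⊞ (d ⊠ (u′ - v′))) → a ≃ b
    linear₂ {a} {b} c d h k eq = x∙y⁻¹≈ε⇒x≈y a b (≃-trans eq (sum-0 (multiple c h) (multiple d k)))

    linear₃ : ∀ {a b} c {u v} d {u′ v′} e {u″ v″} → u ≃ v → u′ ≃ v′ → u″ ≃ v″ →
      (a - b) ≃ (((c ⊠ (u - v)) ⊞ (d ⊠ (u′ - v′))) ⊞ (e ⊠ (u″ - v″))) → a ≃ b
    linear₃ {a} {b} c d e h k l eq =
      x∙y⁻¹≈ε⇒x≈y a b (≃-trans eq (sum-0 (sum-0 (multiple c h) (multiple d k)) (multiple e l)))

    2ℚ : ℚ
    2ℚ = 1ℚ ℚ.+ 1ℚ

  -- With s = 1/r and x = (1 + y/r)/2, the product x(1 - x) is (1 - (y/r)²)/4, which vanishes when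
  -- y² = r². The values x = 0 and x = 1 correspond to y = -r and y = r.
  idempotent : ∀ y r s → (r ⊠ s) ≃ η 1ℚ → (y ⊠ y) ≃ (r ⊠ r) →
    ((η ½ ⊠ (η 1ℚ ⊞ (s ⊠ y))) ⊠ (η 1ℚ ⊞ (⊟ (η ½ ⊠ (η 1ℚ ⊞ (s ⊠ y)))))) ≃ η 0ℚ
  idempotent y r s rs≃1 y²≃r² =
    linear₂ (⊟ (η ¼ ⊠ (η 1ℚ ⊞ (r ⊠ s)))) (⊟ (η ¼ ⊠ (s ⊠ s))) rs≃1 y²≃r²
      (solve 3 (λ y r s →
        (con ½ :* (con 1ℚ :+ s :* y)) :* (con 1ℚ :+ :- (con ½ :* (con 1ℚ :+ s :* y))) :- con 0ℚ
        := (:- (con ¼ :* (con 1ℚ :+ r :* s))) :* (r :* s :- con 1ℚ) :+ (:- (con ¼ :* (s :* s))) :*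
              (y :* y :- r :* r))
        ≃-refl y r s)

  idempotent-0 : ∀ y r s → (r ⊠ s) ≃ η 1ℚ → (η ½ ⊠ (η 1ℚ ⊞ (s ⊠ y))) ≃ η 0ℚ → y ≃ (⊟ r)
  idempotent-0 y r s rs≃1 x≃0 = linear₂ (⊟ y) (η 2ℚ ⊠ r) rs≃1 x≃0
    (solve 3 (λ y r s → y :- :- r
      := (:- y) :* (r :* s :- con 1ℚ) :+ (con 2ℚ :* r) :* (con ½ :* (con 1ℚ :+ s :* y) :- con 0ℚ))
      ≃-refl y r s)

  idempotent-1 : ∀ y r s → (r ⊠ s) ≃ η 1ℚ → (η 1ℚ ⊞ (⊟ (η ½ ⊠ (η 1ℚ ⊞ (s ⊠ y))))) ≃ η 0ℚ → y ≃ r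
  idempotent-1 y r s rs≃1 1-x≃0 = linear₂ (⊟ y) (⊟ (η 2ℚ ⊠ r)) rs≃1 1-x≃0
    (solve 3 (λ y r s → y :- r
      := (:- y) :* (r :* s :- con 1ℚ) :+ (:- (con 2ℚ :* r)) :*
            ((con 1ℚ :- con ½ :* (con 1ℚ :+ s :* y)) :- con 0ℚ))
      ≃-refl y r s)

  *-assoc-re : ∀ a b c d e f →
    (((((a ⊠ c) ⊞ (⊟ (b ⊠ d))) ⊠ e) ⊞ (⊟ (((a ⊠ d) ⊞ (b ⊠ c)) ⊠ f)))) ≃
    ((a ⊠ ((c ⊠ e) ⊞ (⊟ (d ⊠ f)))) ⊞ (⊟ (b ⊠ ((c ⊠ f) ⊞ (d ⊠ e)))))
  *-assoc-re = solve 6 (λ a b c d e f →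
    (a :* c :- b :* d) :* e :- (a :* d :+ b :* c) :* f := a :* (c :* e :- d :* f) :- b :*
          (c :* f :+ d :* e)) ≃-refl

  *-assoc-im : ∀ a b c d e f →
    ((((a ⊠ c) ⊞ (⊟ (b ⊠ d))) ⊠ f) ⊞ (((a ⊠ d) ⊞ (b ⊠ c)) ⊠ e)) ≃
    ((a ⊠ ((c ⊠ f) ⊞ (d ⊠ e))) ⊞ (b ⊠ ((c ⊠ e) ⊞ (⊟ (d ⊠ f)))))
  *-assoc-im = solve 6 (λ a b c d e f →
    (a :* c :- b :* d) :* f :+ (a :* d :+ b :* c) :* e := a :* (c :* f :+ d :* e) :+ b :*
          (c :* e :- d :* f)) ≃-refl

  distribˡ-re : ∀ a b c d e f →
    ((a ⊠ (c ⊞ e)) ⊞ (⊟ (b ⊠ (d ⊞ f)))) ≃ (((a ⊠ c) ⊞ (⊟ (b ⊠ d))) ⊞ ((a ⊠ e) ⊞ (⊟ (b ⊠ f))))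
  distribˡ-re = solve 6 (λ a b c d e f →
    a :* (c :+ e) :- b :* (d :+ f) := (a :* c :- b :* d) :+ (a :* e :- b :* f)) ≃-refl

  distribˡ-im : ∀ a b c d e f →
    ((a ⊠ (d ⊞ f)) ⊞ (b ⊠ (c ⊞ e))) ≃ (((a ⊠ d) ⊞ (b ⊠ c)) ⊞ ((a ⊠ f) ⊞ (b ⊠ e)))
  distribˡ-im = solve 6 (λ a b c d e f →
    a :* (d :+ f) :+ b :* (c :+ e) := (a :* d :+ b :* c) :+ (a :* f :+ b :* e)) ≃-refl

  *-comm-re : ∀ a b c d → ((a ⊠ c) ⊞ (⊟ (b ⊠ d))) ≃ ((c ⊠ a) ⊞ (⊟ (d ⊠ b)))
  *-comm-re = solve 4 (λ a b c d → a :* c :- b :* d := c :* a :- d :* b) ≃-refl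

  *-comm-im : ∀ a b c d → ((a ⊠ d) ⊞ (b ⊠ c)) ≃ ((c ⊠ b) ⊞ (d ⊠ a))
  *-comm-im = solve 4 (λ a b c d → a :* d :+ b :* c := c :* b :+ d :* a) ≃-refl

  *-identityˡ-re : ∀ a b → ((η 1ℚ ⊠ a) ⊞ (⊟ (η 0ℚ ⊠ b))) ≃ a
  *-identityˡ-re = solve 2 (λ a b → con 1ℚ :* a :- con 0ℚ :* b := a) ≃-refl

  *-identityˡ-im : ∀ a b → ((η 1ℚ ⊠ b) ⊞ (η 0ℚ ⊠ a)) ≃ b
  *-identityˡ-im = solve 2 (λ a b → con 1ℚ :* b :+ con 0ℚ :* a := b) ≃-refl

  -- For z = x + iy with z² = n = d².
  real-root : ∀ x y d {n} → (d ⊠ d) ≃ n → ((x ⊠ x) ⊞ (⊟ (y ⊠ y))) ≃ n → ((x ⊠ y) ⊞ (y ⊠ x)) ≃ η 0ℚ →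
    (((y ⊠ y) ⊠ (y ⊠ y)) ⊞ ((d ⊠ y) ⊠ (d ⊠ y))) ≃ η 0ℚ
  real-root x y d {n} h k l = linear₃ (y ⊠ y) (⊟ (y ⊠ y)) (η ½ ⊠ (x ⊠ y)) h k l
    (solve 4 (λ x y d n → (y :* y) :* (y :* y) :+ (d :* y) :* (d :* y) :- con 0ℚ
      := (y :* y) :* (d :* d :- n) :+ (:- (y :* y)) :* ((x :* x :- y :* y) :- n) :+
            (con ½ :* (x :* y)) :* ((x :* y :+ y :* x) :- con 0ℚ))
      ≃-refl x y d n)

  -- For z = x + iy with z² = −r².
  imaginary-root : ∀ x y r → ((x ⊠ x) ⊞ (⊟ (y ⊠ y))) ≃ (⊟ (r ⊠ r)) → ((x ⊠ y) ⊞ (y ⊠ x)) ≃ η 0ℚ →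
    (((x ⊠ x) ⊠ (x ⊠ x)) ⊞ ((r ⊠ x) ⊠ (r ⊠ x))) ≃ η 0ℚ
  imaginary-root x y r h k = linear₂ (x ⊠ x) (η ½ ⊠ (x ⊠ y)) h k
    (solve 3 (λ x y r → (x :* x) :* (x :* x) :+ (r :* x) :* (r :* x) :- con 0ℚ
      := (x :* x) :* ((x :* x :- y :* y) :- :- (r :* r)) :+ (con ½ :* (x :* y)) :*
            ((x :* y :+ y :* x) :- con 0ℚ))
      ≃-refl x y r)

  imaginary-root-im : ∀ x y r → ((x ⊠ x) ⊞ (⊟ (y ⊠ y))) ≃ (⊟ (r ⊠ r)) → x ≃ η 0ℚ → (y ⊠ y) ≃ (r ⊠ r)
  imaginary-root-im x y r h k = linear₂ (⊟ (η 1ℚ)) x h k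
    (solve 3 (λ x y r → y :* y :- r :* r
      := (:- con 1ℚ) :* ((x :* x :- y :* y) :- :- (r :* r)) :+ x :* (x :- con 0ℚ))
      ≃-refl x y r)

  -- The inverse of √n is √n/n, so a root is inverted through the rational inverse q of n.
  inverse-root : ∀ {r n q} → (r ⊠ r) ≃ n → (n ⊠ q) ≃ η 1ℚ → (r ⊠ (q ⊠ r)) ≃ η 1ℚ
  inverse-root {r} {n} {q} h k = linear₂ q (η 1ℚ) h k
    (solve 3 (λ r n q → r :* (q :* r) :- con 1ℚ := q :* (r :* r :- n) :+ con 1ℚ :* (n :* q :- con 1ℚ))
      ≃-refl r n q)

  [r+0i]i-re : ∀ r → ((r ⊠ η 0ℚ) ⊞ (⊟ (η 0ℚ ⊠ η 1ℚ))) ≃ η 0ℚ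
  [r+0i]i-re = solve 1 (λ r → r :* con 0ℚ :- con 0ℚ :* con 1ℚ := con 0ℚ) ≃-refl

  [r+0i]i-im : ∀ r → ((r ⊠ η 1ℚ) ⊞ (η 0ℚ ⊠ η 0ℚ)) ≃ r
  [r+0i]i-im = solve 1 (λ r → r :* con 1ℚ :+ con 0ℚ :* con 0ℚ := r) ≃-refl

  [x+0i][y+0i]-re : ∀ x y → ((x ⊠ y) ⊞ (⊟ (η 0ℚ ⊠ η 0ℚ))) ≃ (x ⊠ y)
  [x+0i][y+0i]-re = solve 2 (λ x y → x :* y :- con 0ℚ :* con 0ℚ := x :* y) ≃-refl

  [x+0i][y+0i]-im : ∀ x y → ((x ⊠ η 0ℚ) ⊞ (η 0ℚ ⊠ y)) ≃ η 0ℚ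
  [x+0i][y+0i]-im = solve 2 (λ x y → x :* con 0ℚ :+ con 0ℚ :* y := con 0ℚ) ≃-refl

  square-product : ∀ {r i s t} → (r ⊠ r) ≃ s → (i ⊠ i) ≃ t → ((r ⊠ i) ⊠ (r ⊠ i)) ≃ (s ⊠ t)
  square-product {r} {i} {s} {t} h k = linear₂ (i ⊠ i) s h k
    (solve 4 (λ r i s t → (r :* i) :* (r :* i) :- s :* t := (i :* i) :* (r :* r :- s) :+ s :* (i :* i :- t))
      ≃-refl r i s t)

  IsRoot : A → A → A → Set
  IsRoot z b c = (c ⊞ (z ⊠ (b ⊞ z))) ≃ η 0ℚ

  z*linear : ∀ z b c u v → IsRoot z b c → (z ⊠ ((u ⊠ z) ⊞ v)) ≃ (((v ⊞ (⊟ (b ⊠ u))) ⊠ z) ⊞ (⊟ (c ⊠ u)))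
  z*linear z b c u v h = linear₁ u h
    (solve 5 (λ z b c u v → z :* (u :* z :+ v) :- ((v :- b :* u) :* z :- c :* u) := u :*
          ((c :+ z :* (b :+ z)) :- con 0ℚ))
      ≃-refl z b c u v)

  linear-⊞ : ∀ z u v u′ v′ → (((u ⊞ u′) ⊠ z) ⊞ (v ⊞ v′)) ≃ (((u ⊠ z) ⊞ v) ⊞ ((u′ ⊠ z) ⊞ v′))
  linear-⊞ = solve 5 (λ z u v u′ v′ → (u :+ u′) :* z :+ (v :+ v′) := (u :* z :+ v) :+ (u′ :* z :+ v′)) ≃-refl

  linear-⊡ : ∀ z a u v → (((a ⊠ u) ⊠ z) ⊞ (a ⊠ v)) ≃ (a ⊠ ((u ⊠ z) ⊞ v))
  linear-⊡ = solve 4 (λ z a u v → (a :* u) :* z :+ a :* v := a :* (u :* z :+ v)) ≃-refl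

  horner : ∀ a z e w → ((a ⊞ (z ⊠ e)) ⊠ w) ≃ ((a ⊠ w) ⊞ (e ⊠ (z ⊠ w)))
  horner = solve 4 (λ a z e w → (a :+ z :* e) :* w := a :* w :+ e :* (z :* w)) ≃-refl

  -- The last hypothesis is the imaginary part of uz + v, for rational u, v and z = x + iy, exactly
  -- as the operations of ℂ compute it.
  cancel-factor : ∀ x y u s → (u ⊠ s) ≃ η 1ℚ → (((u ⊠ y) ⊞ (η 0ℚ ⊠ x)) ⊞ η 0ℚ) ≃ η 0ℚ → y ≃ η 0ℚ
  cancel-factor x y u s h k = linear₂ (⊟ y) s h k
    (solve 4 (λ x y u s → y :- con 0ℚ := (:- y) :* (u :* s :- con 1ℚ) :+ s :*
          (((u :* y :+ con 0ℚ :* x) :+ con 0ℚ) :- con 0ℚ))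
      ≃-refl x y u s)

  constant-term : ∀ z v → ((η 0ℚ ⊠ z) ⊞ v) ≃ η 0ℚ → v ≃ η 0ℚ
  constant-term z v h = linear₁ (η 1ℚ) h
    (solve 2 (λ z v → v :- con 0ℚ := con 1ℚ :* ((con 0ℚ :* z :+ v) :- con 0ℚ)) ≃-refl z v)

  horner-constant : ∀ z → (η 1ℚ ⊞ (z ⊠ η 0ℚ)) ≃ η 1ℚ
  horner-constant = solve 1 (λ z → con 1ℚ :+ z :* con 0ℚ := con 1ℚ) ≃-refl

  horner-linear : ∀ z b → (b ⊞ (z ⊠ η 1ℚ)) ≃ (b ⊞ z)
  horner-linear = solve 2 (λ z b → b :+ z :* con 1ℚ := b :+ z) ≃-refl

  b+z≃0⇒z≃-b : ∀ z b → (b ⊞ z) ≃ η 0ℚ → z ≃ (⊟ b)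
  b+z≃0⇒z≃-b z b h = linear₁ (η 1ℚ) h
    (solve 2 (λ z b → z :- :- b := con 1ℚ :* ((b :+ z) :- con 0ℚ)) ≃-refl z b)

  root-neg : ∀ z b c → IsRoot z b c → IsRoot (⊟ z) (⊟ b) c
  root-neg z b c h = linear₁ (η 1ℚ) h
    (solve 3 (λ z b c → (c :+ (:- z) :* (:- b :+ :- z)) :- con 0ℚ := con 1ℚ :*
          ((c :+ z :* (b :+ z)) :- con 0ℚ))
      ≃-refl z b c)

  root-translate : ∀ z n b c → IsRoot z b c →
    IsRoot (z ⊞ n) (b ⊞ (⊟ (n ⊞ n))) (((n ⊠ n) ⊞ (⊟ (b ⊠ n))) ⊞ c)
  root-translate z n b c h = linear₁ (η 1ℚ) h
    (solve 4 (λ z n b c → (((n :* n :- b :* n) :+ c) :+ (z :+ n) :* ((b :- (n :+ n)) :+ (z :+ n))) :- con 0ℚ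
      := con 1ℚ :* ((c :+ z :* (b :+ z)) :- con 0ℚ)) ≃-refl z n b c)

  4ℚ : ℚ
  4ℚ = 2ℚ ℚ.+ 2ℚ

  half-root : ∀ s c d → (s ⊠ s) ≃ d → d ≃ (η 1ℚ ⊞ (⊟ (η 4ℚ ⊠ c))) → IsRoot (η ½ ⊠ (η 1ℚ ⊞ s)) (⊟ η 1ℚ) c
  half-root s c d h k = linear₂ (η ¼) (η ¼) h k
    (solve 3 (λ s c d → (c :+ (con ½ :* (con 1ℚ :+ s)) :* (:- con 1ℚ :+ con ½ :* (con 1ℚ :+ s))) :- con 0ℚ
      := con ¼ :* (s :* s :- d) :+ con ¼ :* (d :- (con 1ℚ :- con 4ℚ :* c))) ≃-refl s c d)

  pure-root : ∀ s c d → (s ⊠ s) ≃ d → d ≃ (⊟ c) → IsRoot s (η 0ℚ) c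
  pure-root s c d h k = linear₂ (η 1ℚ) (η 1ℚ) h k
    (solve 3 (λ s c d → (c :+ s :* (con 0ℚ :+ s)) :- con 0ℚ := con 1ℚ :* (s :* s :- d) :+ con 1ℚ :*
          (d :- :- c))
      ≃-refl s c d)

  complete-square-even : ∀ z n b c → b ≃ (n ⊞ n) → IsRoot z b c →
    ((z ⊞ n) ⊠ (z ⊞ n)) ≃ ((n ⊠ n) ⊞ (⊟ c))
  complete-square-even z n b c h k = linear₂ (⊟ z) (η 1ℚ) h k
    (solve 4 (λ z n b c → (z :+ n) :* (z :+ n) :- (n :* n :- c)
      := (:- z) :* (b :- (n :+ n)) :+ con 1ℚ :* ((c :+ z :* (b :+ z)) :- con 0ℚ)) ≃-refl z n b c)

  complete-square-odd : ∀ z n b c → b ≃ ((n ⊞ n) ⊞ η 1ℚ) → IsRoot z b c →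
    (((z ⊞ z) ⊞ ((n ⊞ n) ⊞ η 1ℚ)) ⊠ ((z ⊞ z) ⊞ ((n ⊞ n) ⊞ η 1ℚ))) ≃ (η 1ℚ ⊞ (η 4ℚ ⊠ (((n ⊠ n) ⊞ n) ⊞ (⊟ c))))
  complete-square-odd z n b c h k = linear₂ (⊟ (η 4ℚ ⊠ z)) (η 4ℚ) h k
    (solve 4 (λ z n b c → let w = (z :+ z) :+ ((n :+ n) :+ con 1ℚ) in
      w :* w :- (con 1ℚ :+ con 4ℚ :* ((n :* n :+ n) :- c))
      := (:- (con 4ℚ :* z)) :* (b :- ((n :+ n) :+ con 1ℚ)) :+ con 4ℚ :*
            ((c :+ z :* (b :+ z)) :- con 0ℚ)) ≃-refl z n b c)

  shift-back : ∀ z n w → (z ⊞ n) ≃ w → z ≃ (w ⊞ (⊟ n))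
  shift-back z n w h = linear₁ (η 1ℚ) h
    (solve 3 (λ z n w → z :- (w :- n) := con 1ℚ :* ((z :+ n) :- w)) ≃-refl z n w)

  shift-back-half : ∀ z n s → ((z ⊞ z) ⊞ ((n ⊞ n) ⊞ η 1ℚ)) ≃ s → z ≃ ((η ½ ⊠ (η 1ℚ ⊞ s)) ⊞ (⊟ (n ⊞ η 1ℚ)))
  shift-back-half z n s h = linear₁ (η ½) h
    (solve 3 (λ z n s → z :- (con ½ :* (con 1ℚ :+ s) :- (n :+ con 1ℚ)) := con ½ :*
          (((z :+ z) :+ ((n :+ n) :+ con 1ℚ)) :- s)) ≃-refl z n s)

  shift-back-half-neg : ∀ z n s → ((z ⊞ z) ⊞ ((n ⊞ n) ⊞ η 1ℚ)) ≃ (⊟ s) → z ≃ ((⊟ (η ½ ⊠ (η 1ℚ ⊞ s))) ⊞ (⊟ n))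
  shift-back-half-neg z n s h = linear₁ (η ½) h
    (solve 3 (λ z n s → z :- (:- (con ½ :* (con 1ℚ :+ s)) :- n) := con ½ :*
          (((z :+ z) :+ ((n :+ n) :+ con 1ℚ)) :- :- s)) ≃-refl z n s)

  -- An exchange step: e₁ = s(1 - p₀e₀), so 1 takes the place of e₁ in the spanning pair.
  eliminate : ∀ p₀ p₁ q₀ q₁ e₀ e₁ s → (p₁ ⊠ s) ≃ η 1ℚ → η 1ℚ ≃ ((p₀ ⊠ e₀) ⊞ ((p₁ ⊠ e₁) ⊞ η 0ℚ)) →
    ((q₀ ⊠ e₀) ⊞ ((q₁ ⊠ e₁) ⊞ η 0ℚ)) ≃ ((q₁ ⊠ s) ⊞ ((q₀ ⊞ (⊟ ((q₁ ⊠ s) ⊠ p₀))) ⊠ e₀))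
  eliminate p₀ p₁ q₀ q₁ e₀ e₁ s h k = linear₂ (⊟ (q₁ ⊠ e₁)) (⊟ (q₁ ⊠ s)) h k
    (solve 7 (λ p₀ p₁ q₀ q₁ e₀ e₁ s → (q₀ :* e₀ :+ (q₁ :* e₁ :+ con 0ℚ)) :-
          (q₁ :* s :+ (q₀ :- (q₁ :* s) :* p₀) :* e₀)
      := (:- (q₁ :* e₁)) :* (p₁ :* s :- con 1ℚ) :+ (:- (q₁ :* s)) :*
            (con 1ℚ :- (p₀ :* e₀ :+ (p₁ :* e₁ :+ con 0ℚ))))
      ≃-refl p₀ p₁ q₀ q₁ e₀ e₁ s)

  swap-sum : ∀ x y → (x ⊞ (y ⊞ η 0ℚ)) ≃ (y ⊞ (x ⊞ η 0ℚ))
  swap-sum = solve 2 (λ x y → x :+ (y :+ con 0ℚ) := y :+ (x :+ con 0ℚ)) ≃-refl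

  -- For β² - vβ - u = 0 the square of 2β - v is the discriminant v² + 4u; the factor n is there to
  -- clear denominators later.
  complete-square : ∀ β u v n → (β ⊠ β) ≃ (u ⊞ (v ⊠ β)) →
    ((n ⊠ ((β ⊞ β) ⊞ (⊟ v))) ⊠ (n ⊠ ((β ⊞ β) ⊞ (⊟ v)))) ≃ ((n ⊠ n) ⊠ ((η 4ℚ ⊠ u) ⊞ (v ⊠ v)))
  complete-square β u v n h = linear₁ (η 4ℚ ⊠ (n ⊠ n)) h
    (solve 4 (λ β u v n → (n :* ((β :+ β) :- v)) :* (n :* ((β :+ β) :- v)) :- (n :* n) :*
          (con 4ℚ :* u :+ v :* v)
      := (con 4ℚ :* (n :* n)) :* (β :* β :- (u :+ v :* β))) ≃-refl β u v n)

  -- Substitute β = v/2 + γ/(2n), where γ = n(2β - v) and s = 1/n.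
  change-generator : ∀ x y β v n s → (n ⊠ s) ≃ η 1ℚ →
    (x ⊞ (y ⊠ β)) ≃ ((x ⊞ (η ½ ⊠ (y ⊠ v))) ⊞ ((η ½ ⊠ (y ⊠ s)) ⊠ (n ⊠ ((β ⊞ β) ⊞ (⊟ v)))))
  change-generator x y β v n s h = linear₁ (⊟ (η ½ ⊠ (y ⊠ ((β ⊞ β) ⊞ (⊟ v))))) h
    (solve 6 (λ x y β v n s → (x :+ y :* β) :- ((x :+ con ½ :* (y :* v)) :+ (con ½ :* (y :* s)) :*
          (n :* ((β :+ β) :- v)))
      := (:- (con ½ :* (y :* ((β :+ β) :- v)))) :* (n :* s :- con 1ℚ)) ≃-refl x y β v n s)

  inverse-conjugate : ∀ g ḡ w n s → (g ⊠ ḡ) ≃ n → (n ⊠ s) ≃ η 1ℚ → (g ⊠ w) ≃ η 1ℚ → w ≃ (s ⊠ ḡ)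
  inverse-conjugate g ḡ w n s h k l = linear₃ (⊟ (w ⊠ s)) (⊟ w) (s ⊠ ḡ) h k l
    (solve 5 (λ g ḡ w n s → w :- s :* ḡ
      := (:- (w :* s)) :* (g :* ḡ :- n) :+ (:- w) :* (n :* s :- con 1ℚ) :+ (s :* ḡ) :* (g :* w :- con 1ℚ))
      ≃-refl g ḡ w n s)

  double-minus-one : ∀ s → (((η ½ ⊠ (η 1ℚ ⊞ s)) ⊞ (η ½ ⊠ (η 1ℚ ⊞ s))) ⊞ (⊟ η 1ℚ)) ≃ s
  double-minus-one = solve 1 (λ s → (con ½ :* (con 1ℚ :+ s) :+ con ½ :* (con 1ℚ :+ s)) :- con 1ℚ := s) ≃-refl

  zero-product : ∀ w → (η 0ℚ ⊠ w) ≃ η 0ℚ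
  zero-product = solve 1 (λ w → con 0ℚ :* w := con 0ℚ) ≃-refl

  -- The left side is the real part of ½(1 + r𝕚) as the operations of ℂ unfold it, with r𝕚 itself a
  -- product.
  half-re : ∀ r → ((η ½ ⊠ (η 1ℚ ⊞ ((r ⊠ η 0ℚ) ⊞ (⊟ (η 0ℚ ⊠ η 1ℚ))))) ⊞
        (⊟ (η 0ℚ ⊠ (η 0ℚ ⊞ ((r ⊠ η 1ℚ) ⊞ (η 0ℚ ⊠ η 0ℚ)))))) ≃ η ½
  half-re = solve 1 (λ r → con ½ :* (con 1ℚ :+ (r :* con 0ℚ :- con 0ℚ :* con 1ℚ)) :- con 0ℚ :*
        (con 0ℚ :+ (r :* con 1ℚ :+ con 0ℚ :* con 0ℚ)) := con ½) ≃-refl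

  half-im : ∀ r → ((η ½ ⊠ (η 0ℚ ⊞ ((r ⊠ η 1ℚ) ⊞ (η 0ℚ ⊠ η 0ℚ)))) ⊞
        (η 0ℚ ⊠ (η 1ℚ ⊞ ((r ⊠ η 0ℚ) ⊞ (⊟ (η 0ℚ ⊠ η 1ℚ)))))) ≃ (η ½ ⊠ r)
  half-im = solve 1 (λ r → con ½ :* (con 0ℚ :+ (r :* con 1ℚ :+ con 0ℚ :* con 0ℚ)) :+ con 0ℚ :*
        (con 1ℚ :+ (r :* con 0ℚ :- con 0ℚ :* con 1ℚ)) := con ½ :* r) ≃-refl

  x+0 : ∀ x → (x ⊞ η 0ℚ) ≃ x
  x+0 = solve 1 (λ x → x :+ con 0ℚ := x) ≃-refl

  -x≃0⇒x≃-0 : ∀ x → (⊟ x) ≃ η 0ℚ → x ≃ (⊟ η 0ℚ)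
  -x≃0⇒x≃-0 x h = linear₁ (⊟ η 1ℚ) h
    (solve 1 (λ x → x :- :- con 0ℚ := (:- con 1ℚ) :* (:- x :- con 0ℚ)) ≃-refl x)

  x≃-y⇒y≃-x : ∀ {x y} → x ≃ (⊟ y) → y ≃ (⊟ x)
  x≃-y⇒y≃-x {x} {y} h = linear₁ (η 1ℚ) h
    (solve 2 (λ x y → y :- :- x := con 1ℚ :* (x :- :- y)) ≃-refl x y)

  zero-combination : ∀ e₀ e₁ → ((η 0ℚ ⊠ e₀) ⊞ ((η 0ℚ ⊠ e₁) ⊞ η 0ℚ)) ≃ η 0ℚ
  zero-combination = solve 2 (λ e₀ e₁ → con 0ℚ :* e₀ :+ (con 0ℚ :* e₁ :+ con 0ℚ) := con 0ℚ) ≃-refl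

  divide-factor : ∀ n s x {α} → (n ⊠ s) ≃ η 1ℚ → α ≃ (n ⊠ x) → x ≃ (s ⊠ α)
  divide-factor n s x {α} h k = linear₂ (⊟ x) (⊟ s) h k
    (solve 4 (λ n s x α → x :- s :* α := (:- x) :* (n :* s :- con 1ℚ) :+ (:- s) :*
          (α :- n :* x)) ≃-refl n s x α)

-- Complex numbers

module ℝ-Algebra = RationalAlgebra ℝ _≈ʳ_ _+ʳ_ _*ʳ_ -ʳ_ fromℚʳ ℝ-isCommutativeRing
  (λ _ _ → ≈ʳ-≡ λ _ → refl) (λ _ _ → ≈ʳ-≡ λ _ → refl) (λ _ → ≈ʳ-≡ λ _ → refl)

y²≈r²⇒y≈±r : ∀ y r s → r *ʳ s ≈ʳ fromℚʳ 1ℚ → y *ʳ y ≈ʳ r *ʳ r → y ≈ʳ r ⊎ y ≈ʳ -ʳ r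
y²≈r²⇒y≈±r y r s rs≈1 y²≈r² = Sum.swap (Sum.map (ℝ-Algebra.idempotent-0 y r s rs≈1)
      (ℝ-Algebra.idempotent-1 y r s rs≈1)
  (x[1-x]≈0⇒x≈0⊎1-x≈0 (fromℚʳ ½ *ʳ (fromℚʳ 1ℚ +ʳ s *ʳ y)) (ℝ-Algebra.idempotent y r s rs≈1 y²≈r²)))

≈-refl : ∀ {z} → z ≈ z
≈-refl = mk≈ ≈ʳ-refl ≈ʳ-refl

≈-sym : ∀ {z w} → z ≈ w → w ≈ z
≈-sym (mk≈ p q) = mk≈ (≈ʳ-sym p) (≈ʳ-sym q)

≈-trans : ∀ {z w v} → z ≈ w → w ≈ v → z ≈ v
≈-trans (mk≈ p q) (mk≈ p′ q′) = mk≈ (≈ʳ-trans p p′) (≈ʳ-trans q q′)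

private module R = IsCommutativeRing ℝ-isCommutativeRing

+-cong : ∀ {z z′ w w′} → z ≈ z′ → w ≈ w′ → z + w ≈ z′ + w′
+-cong (mk≈ p q) (mk≈ p′ q′) = mk≈ (+ʳ-cong p p′) (+ʳ-cong q q′)

neg-cong : ∀ {z z′} → z ≈ z′ → - z ≈ - z′
neg-cong (mk≈ p q) = mk≈ (-ʳ-cong p) (-ʳ-cong q)

*-cong : ∀ {z z′ w w′} → z ≈ z′ → w ≈ w′ → z * w ≈ z′ * w′
*-cong (mk≈ p q) (mk≈ p′ q′) = mk≈
  (+ʳ-cong (*ʳ-cong p p′) (-ʳ-cong (*ʳ-cong q q′)))
  (+ʳ-cong (*ʳ-cong p q′) (*ʳ-cong q p′))

*-comm : ∀ z w → z * w ≈ w * z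
*-comm (a +i b) (c +i d) = mk≈ (ℝ-Algebra.*-comm-re a b c d) (ℝ-Algebra.*-comm-im a b c d)

*-identityˡ : ∀ z → 1ᶜ * z ≈ z
*-identityˡ (a +i b) = mk≈ (ℝ-Algebra.*-identityˡ-re a b) (ℝ-Algebra.*-identityˡ-im a b)

*-distribˡ-+ : ∀ z w v → z * (w + v) ≈ z * w + z * v
*-distribˡ-+ (a +i b) (c +i d) (e +i f) =
  mk≈ (ℝ-Algebra.distribˡ-re a b c d e f) (ℝ-Algebra.distribˡ-im a b c d e f)

*-assoc : ∀ z w v → (z * w) * v ≈ z * (w * v)
*-assoc (a +i b) (c +i d) (e +i f) =
  mk≈ (ℝ-Algebra.*-assoc-re a b c d e f) (ℝ-Algebra.*-assoc-im a b c d e f)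

ℂ-isCommutativeRing : IsCommutativeRing _≈_ _+_ _*_ -_ 0ᶜ 1ᶜ
ℂ-isCommutativeRing = record
  { isRing = record
    { +-isAbelianGroup = record
      { isGroup = record
        { isMonoid = record
          { isSemigroup = record
            { isMagma = record
              { isEquivalence = record { refl = ≈-refl ; sym = ≈-sym ; trans = ≈-trans }
              ; ∙-cong = +-cong }
            ; assoc = λ z w v → mk≈ (R.+-assoc (re z) (re w) (re v)) (R.+-assoc (im z) (im w) (im v)) }
          ; identity = (λ z → mk≈ (R.+-identityˡ (re z)) (R.+-identityˡ (im z)))
                     , (λ z → mk≈ (R.+-identityʳ (re z)) (R.+-identityʳ (im z))) }
        ; inverse = (λ z → mk≈ (R.-‿inverseˡ (re z)) (R.-‿inverseˡ (im z)))
                  , (λ z → mk≈ (R.-‿inverseʳ (re z)) (R.-‿inverseʳ (im z)))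
        ; ⁻¹-cong = neg-cong }
      ; comm = λ z w → mk≈ (R.+-comm (re z) (re w)) (R.+-comm (im z) (im w)) }
    ; *-cong = *-cong
    ; *-assoc = *-assoc
    ; *-identity = *-identityˡ , λ z → ≈-trans (*-comm z 1ᶜ) (*-identityˡ z)
    ; distrib = *-distribˡ-+
              , λ z w v → ≈-trans (*-comm (w + v) z) (≈-trans (*-distribˡ-+ z w v)
                    (+-cong (*-comm z w) (*-comm z v))) }
  ; *-comm = *-comm }

fromℚ-+ : ∀ p q → fromℚ (p ℚ.+ q) ≈ fromℚ p + fromℚ q
fromℚ-+ p q = mk≈ (≈ʳ-≡ λ _ → refl) (≈ʳ-≡ λ _ → refl)

fromℚ-* : ∀ p q → fromℚ (p ℚ.* q) ≈ fromℚ p * fromℚ q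
fromℚ-* p q = mk≈ (≈ʳ-≡ λ _ → sym (ℚₚ.+-identityʳ (p ℚ.* q)))
  (≈ʳ-≡ λ _ → sym (trans (cong₂ ℚ._+_ (ℚₚ.*-zeroʳ p) (ℚₚ.*-zeroˡ q)) (ℚₚ.+-identityˡ 0ℚ)))

fromℚ-neg : ∀ p → fromℚ (ℚ.- p) ≈ - fromℚ p
fromℚ-neg p = mk≈ (≈ʳ-≡ λ _ → refl) (≈ʳ-≡ λ _ → refl)

fromℚ-cong : ∀ {p q} → p ≡ q → fromℚ p ≈ fromℚ q
fromℚ-cong refl = ≈-refl

fromℚ-injective : ∀ {p q} → fromℚ p ≈ fromℚ q → p ≡ q
fromℚ-injective h = fromℚʳ-injective (re-≈ h)

module ℂ-Algebra = RationalAlgebra ℂ _≈_ _+_ _*_ -_ fromℚ ℂ-isCommutativeRing fromℚ-+ fromℚ-* fromℚ-neg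

open ℂ-Algebra using (IsRoot)

-- Integrality

Integral : ℚ → Set
Integral q = ∃ λ k → q ≡ ι k

integral-ι : ∀ k → Integral (ι k)
integral-ι k = k , refl

integral-+ : ∀ {p q} → Integral p → Integral q → Integral (p ℚ.+ q)
integral-+ (a , refl) (b , refl) = a ℤ.+ b , sym (ι-+ a b)

integral-* : ∀ {p q} → Integral p → Integral q → Integral (p ℚ.* q)
integral-* (a , refl) (b , refl) = a ℤ.* b , sym (ι-* a b)

integral-neg : ∀ {p} → Integral p → Integral (ℚ.- p)
integral-neg (a , refl) = ℤ.- a , sym (ι-neg a)

q*↧q≡↥q : ∀ q → q ℚ.* ιℕ (↧ₙ q) ≡ ι (ℚ.↥ q)
q*↧q≡↥q q@(mkℚ n d _) = trans (cong (ℚ._* ιℕ (suc d)) (sym (ℚₚ.↥p/↧p≡p q))) (/-*-cancel n d)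

integral-↧* : ∀ q → Integral (ιℕ (↧ₙ q) ℚ.* q)
integral-↧* q = ℚ.↥ q , trans (ℚₚ.*-comm (ιℕ (↧ₙ q)) q) (q*↧q≡↥q q)

infixr 8 _^_
_^_ : ℚ → ℕ → ℚ
b ^ zero  = 1ℚ
b ^ suc k = b ^ k ℚ.* b

-- If a (j + 1) / a j = x / n in lowest terms for all j then n divides every
-- a j, and the quotients a j / n satisfy the same recurrence.
geometric⇒n^k∣a₀ : ∀ {x n} → Coprime n x → ∀ (a : ℕ → ℕ) → (∀ j → n ℕ.* a (suc j) ≡ x ℕ.* a j) →
  .{{ℕ.NonZero n}} → ∀ k → n ℕ.^ k ∣ a 0
geometric⇒n^k∣a₀ {x} {n} c a rec zero    = 1∣ a 0
geometric⇒n^k∣a₀ {x} {n} c a rec (suc k) =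
  subst (n ℕ.^ suc k ∣_) (trans (ℕₚ.*-comm n (a′ 0)) (sym (a≡ 0)))
    (*-monoʳ-∣ n (geometric⇒n^k∣a₀ c a′ rec′ k))
  where
  n∣a : ∀ j → n ∣ a j
  n∣a j = coprime-divisor c (divides (a (suc j)) (trans (sym (rec j)) (ℕₚ.*-comm n (a (suc j)))))
  a′ : ℕ → ℕ
  a′ j = _∣_.quotient (n∣a j)
  a≡ : ∀ j → a j ≡ a′ j ℕ.* n
  a≡ j = _∣_.equality (n∣a j)
  rec′ : ∀ j → n ℕ.* a′ (suc j) ≡ x ℕ.* a′ j
  rec′ j = ℕₚ.*-cancelʳ-≡ _ _ n (begin
    n ℕ.* a′ (suc j) ℕ.* n     ≡⟨ ℕₚ.*-assoc n (a′ (suc j)) n ⟩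
    n ℕ.* (a′ (suc j) ℕ.* n)   ≡⟨ cong (n ℕ.*_) (sym (a≡ (suc j))) ⟩
    n ℕ.* a (suc j)            ≡⟨ rec j ⟩
    x ℕ.* a j                  ≡⟨ cong (x ℕ.*_) (a≡ j) ⟩
    x ℕ.* (a′ j ℕ.* n)         ≡⟨ sym (ℕₚ.*-assoc x (a′ j) n) ⟩
    x ℕ.* a′ j ℕ.* n ∎)
    where open ≡-Reasoning

k<[2+d]^k : ∀ d k → k ℕ.< suc (suc d) ℕ.^ k
k<[2+d]^k d zero    = ℕ.s≤s ℕ.z≤n
k<[2+d]^k d (suc k) = begin-strict
  suc k                ≤⟨ k<[2+d]^k d k ⟩
  p                    <⟨ ℕₚ.m<m+n p (ℕₚ.≤-<-trans ℕ.z≤n (k<[2+d]^k d k)) ⟩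
  p ℕ.+ p              ≤⟨ ℕₚ.+-monoʳ-≤ p (ℕₚ.m≤m+n p (d ℕ.* p)) ⟩
  p ℕ.+ (p ℕ.+ d ℕ.* p) ∎
  where
  open ℕₚ.≤-Reasoning
  p : ℕ
  p = suc (suc d) ℕ.^ k

-- If b = x/n in lowest terms with n > 1, the integers t k = C b^k satisfy n t(k+1) = x t k, so
-- every power of n divides t 0 = C. But n^C already exceeds C.
bounded-denominators⇒integral : ∀ C .{{_ : ℕ.NonZero C}} b →
  (∀ k → Integral (ιℕ C ℚ.* b ^ k)) → Integral b
bounded-denominators⇒integral C b@(mkℚ x zero    _) h = x , sym (ℚₚ.↥p/↧p≡p b)
bounded-denominators⇒integral C b@(mkℚ x (suc d) c) h =
  contradiction (∣⇒≤ (subst (n ℕ.^ C ∣_) t₀≡C (geometric⇒n^k∣a₀ (Coprime.sym (Coprime.recompute c))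
        (ℤ.∣_∣ ∘ t) rec C)))
    (ℕₚ.<⇒≱ (k<[2+d]^k d C))
  where
  n : ℕ
  n = suc (suc d)
  t : ℕ → ℤ
  t k = proj₁ (h k)
  t₀≡C : ℤ.∣ t 0 ∣ ≡ C
  t₀≡C = cong ℤ.∣_∣ (ι-injective {t 0} {+ C} (trans (sym (proj₂ (h 0))) (ℚₚ.*-identityʳ (ιℕ C))))
  rec-ℤ : ∀ j → + n ℤ.* t (suc j) ≡ x ℤ.* t j
  rec-ℤ j = ι-injective {+ n ℤ.* t (suc j)} {x ℤ.* t j} (begin
    ι (+ n ℤ.* t (suc j))                     ≡⟨ ι-* (+ n) (t (suc j)) ⟩
    ιℕ n ℚ.* ι (t (suc j))                    ≡⟨ cong (ιℕ n ℚ.*_) (sym (proj₂ (h (suc j)))) ⟩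
    ιℕ n ℚ.* (ιℕ C ℚ.* (b ^ j ℚ.* b))         ≡⟨ eq (ιℕ n) (ιℕ C) (b ^ j) b ⟩
    (b ℚ.* ιℕ n) ℚ.* (ιℕ C ℚ.* b ^ j)         ≡⟨ cong₂ ℚ._*_ (q*↧q≡↥q b) (proj₂ (h j)) ⟩
    ι x ℚ.* ι (t j)                           ≡⟨ sym (ι-* x (t j)) ⟩
    ι (x ℤ.* t j) ∎)
    where
    open ≡-Reasoning
    open ℚSolver.+-*-Solver using (solve; _:*_; _:=_)
    eq : ∀ n C p b → n ℚ.* (C ℚ.* (p ℚ.* b)) ≡ (b ℚ.* n) ℚ.* (C ℚ.* p)
    eq = solve 4 (λ n C p b → n :* (C :* (p :* b)) := (b :* n) :* (C :* p)) refl
  rec : ∀ j → n ℕ.* ℤ.∣ t (suc j) ∣ ≡ ℤ.∣ x ∣ ℕ.* ℤ.∣ t j ∣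
  rec j = trans (sym (ℤₚ.abs-* (+ n) (t (suc j)))) (trans (cong ℤ.∣_∣ (rec-ℤ j)) (ℤₚ.abs-* x (t j)))

-- Even powers of q are integers and odd powers are integers times q, so the denominator of q clears
-- them all. The induction carries two consecutive powers, since q² = d advances the exponent by
-- two.
integral-square⇒integral : ∀ q d → q ℚ.* q ≡ ι d → Integral q
integral-square⇒integral q d q²≡d = bounded-denominators⇒integral (↧ₙ q) q (proj₁ ∘ bounded)
  where
  C : ℚ
  C = ιℕ (↧ₙ q)
  open ℚSolver.+-*-Solver using (solve; _:*_; _:=_; con)
  eq₀ : ∀ c → c ≡ c ℚ.* 1ℚ
  eq₀ = solve 1 (λ c → c := c :* con 1ℚ) refl
  eq₁ : ∀ c b → c ℚ.* b ≡ c ℚ.* (1ℚ ℚ.* b)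
  eq₁ = solve 2 (λ c b → c :* b := c :* (con 1ℚ :* b)) refl
  eq₂ : ∀ c b p → (c ℚ.* p) ℚ.* (b ℚ.* b) ≡ c ℚ.* (p ℚ.* b ℚ.* b)
  eq₂ = solve 3 (λ c b p → (c :* p) :* (b :* b) := c :* (p :* b :* b)) refl
  bounded : ∀ k → Integral (C ℚ.* q ^ k) × Integral (C ℚ.* q ^ suc k)
  bounded zero    = subst Integral (eq₀ C) (integral-ι (+ ↧ₙ q)) , subst Integral (eq₁ C q) (integral-↧* q)
  bounded (suc k) = let h , h′ = bounded k in
    h′ , subst Integral (trans (cong ((C ℚ.* q ^ k) ℚ.*_) (sym q²≡d)) (eq₂ C q (q ^ k)))
          (integral-* h (integral-ι d))

-- Denominators and norms in ℚ[x]/(x² + bx + c)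

Pair : Set
Pair = ℚ × ℚ

infixl 6 _⊞_
_⊞_ : Pair → Pair → Pair
(u , v) ⊞ (u′ , v′) = u ℚ.+ u′ , v ℚ.+ v′

⊟_ : Pair → Pair
⊟ (u , v) = ℚ.- u , ℚ.- v

_⊡_ : ℚ → Pair → Pair
a ⊡ (u , v) = a ℚ.* u , a ℚ.* v

InLattice : ℕ → Pair → Set
InLattice D (u , v) = Integral (ιℕ D ℚ.* u) × Integral (ιℕ D ℚ.* v)

lattice-⊞ : ∀ D w w′ → InLattice D w → InLattice D w′ → InLattice D (w ⊞ w′)
lattice-⊞ D (u , v) (u′ , v′) (h , k) (h′ , k′) =
  subst Integral (sym (ℚₚ.*-distribˡ-+ (ιℕ D) u u′)) (integral-+ h h′) ,
  subst Integral (sym (ℚₚ.*-distribˡ-+ (ιℕ D) v v′)) (integral-+ k k′)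

lattice-⊟ : ∀ D w → InLattice D w → InLattice D (⊟ w)
lattice-⊟ D (u , v) (h , k) =
  subst Integral (ℚₚ.neg-distribʳ-* (ιℕ D) u) (integral-neg h) ,
  subst Integral (ℚₚ.neg-distribʳ-* (ιℕ D) v) (integral-neg k)

lattice-⊡ : ∀ D a w → InLattice D w → InLattice D (ι a ⊡ w)
lattice-⊡ D a (u , v) (h , k) =
  subst Integral (eq (ι a) (ιℕ D) u) (integral-* (integral-ι a) h) ,
  subst Integral (eq (ι a) (ιℕ D) v) (integral-* (integral-ι a) k)
  where
  open ℚSolver.+-*-Solver using (solve; _:*_; _:=_)
  eq : ∀ a D u → a ℚ.* (D ℚ.* u) ≡ D ℚ.* (a ℚ.* u)
  eq = solve 3 (λ a D u → a :* (D :* u) := D :* (a :* u)) refl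

lattice-scale : ∀ D E w → InLattice D w → InLattice (E ℕ.* D) w
lattice-scale D E (u , v) (h , k) =
  subst Integral (eq u) (integral-* (integral-ι (+ E)) h) ,
  subst Integral (eq v) (integral-* (integral-ι (+ E)) k)
  where
  eq : ∀ u → ιℕ E ℚ.* (ιℕ D ℚ.* u) ≡ ιℕ (E ℕ.* D) ℚ.* u
  eq u = trans (sym (ℚₚ.*-assoc (ιℕ E) (ιℕ D) u)) (cong (ℚ._* u) (sym (ιℕ-* E D)))

lattice-denominators : ∀ w → ∃ λ D → ℕ.NonZero D × InLattice D w
lattice-denominators (u , v) = ↧ₙ u ℕ.* ↧ₙ v , ℕₚ.m*n≢0 (↧ₙ u) (↧ₙ v)
  , subst (λ D → Integral (ιℕ D ℚ.* u)) (ℕₚ.*-comm (↧ₙ v) (↧ₙ u))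
        (proj₁ (lattice-scale (↧ₙ u) (↧ₙ v) (u , 0ℚ) (integral-↧* u , 0-int (↧ₙ u))))
  , proj₁ (lattice-scale (↧ₙ v) (↧ₙ u) (v , 0ℚ) (integral-↧* v , 0-int (↧ₙ v)))
  where
  0-int : ∀ D → Integral (ιℕ D ℚ.* 0ℚ)
  0-int D = + 0 , ℚₚ.*-zeroʳ (ιℕ D)

-- The pair (u , v) stands for u z + v, where z² + b z + c = 0.
module QuadraticAlgebra (b c : ℚ) where

  -- Multiplication by z, reduced with z² = -bz - c.
  step : Pair → Pair
  step (u , v) = v ℚ.- b ℚ.* u , ℚ.- (c ℚ.* u)

  step^ : ℕ → Pair → Pair
  step^ zero    w = w
  step^ (suc k) w = step^ k (step w)

  -- Multiplication by f(z) for the monic polynomial f with the given lower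
  -- coefficients.
  monic : List ℤ → Pair → Pair
  monic []       w = w
  monic (a ∷ as) w = (ι a ⊡ w) ⊞ monic as (step w)

  -- The product (uz + v)(uz' + v), where z' is the conjugate root: z + z' = -b and zz' = c.
  norm : Pair → ℚ
  norm (u , v) = c ℚ.* (u ℚ.* u) ℚ.- b ℚ.* (u ℚ.* v) ℚ.+ v ℚ.* v

  private
    open ℚSolver.+-*-Solver

    ⊞-cancel : ∀ w w′ → (⊟ w) ⊞ (w ⊞ w′) ≡ w′
    ⊞-cancel (u , v) (u′ , v′) = cong₂ _,_ (eq u u′) (eq v v′)
      where
      eq : ∀ u u′ → (ℚ.- u) ℚ.+ (u ℚ.+ u′) ≡ u′
      eq = solve 2 (λ u u′ → (:- u) :+ (u :+ u′) := u′) refl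

    step^-⊟ : ∀ k w w′ → step^ k (w ⊞ (⊟ w′)) ≡ step^ k w ⊞ (⊟ step^ k w′)
    step^-⊟ zero    w w′ = refl
    step^-⊟ (suc k) (u , v) (u′ , v′) =
      trans (cong (step^ k) (cong₂ _,_ (eq₁ u v u′ v′ b) (eq₂ u u′ c))) (step^-⊟ k _ _)
      where
      eq₁ : ∀ u v u′ v′ b → (v ℚ.- v′) ℚ.- b ℚ.* (u ℚ.- u′) ≡ (v ℚ.- b ℚ.* u) ℚ.- (v′ ℚ.- b ℚ.* u′)
      eq₁ = solve 5 (λ u v u′ v′ b → (v :- v′) :- b :* (u :- u′) := (v :- b :* u) :- (v′ :- b :* u′)) refl
      eq₂ : ∀ u u′ c → ℚ.- (c ℚ.* (u ℚ.- u′)) ≡ ℚ.- (c ℚ.* u) ℚ.- ℚ.- (c ℚ.* u′)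
      eq₂ = solve 3 (λ u u′ c → :- (c :* (u :- u′)) := :- (c :* u) :- :- (c :* u′)) refl

  common-denominator : ∀ m w → ∃ λ D → ℕ.NonZero D × (∀ i → i ℕ.≤ m → InLattice D (step^ i w))
  common-denominator zero w =
    let D , D≢0 , h = lattice-denominators w in D , D≢0 , λ { zero _ → h }
  common-denominator (suc m) w =
    let D , D≢0 , h = lattice-denominators w
        E , E≢0 , k = common-denominator m (step w)
    in E ℕ.* D , ℕₚ.m*n≢0 E D {{E≢0}} {{D≢0}} , λ where
      zero    _           → lattice-scale D E w h
      (suc i) (ℕ.s≤s i≤m) → subst (λ F → InLattice F (step^ i (step w))) (ℕₚ.*-comm D E)
                              (lattice-scale E D (step^ i (step w)) (k i i≤m))

  -- One denominator for the whole orbit w, zw, z²w, ..., so that the additive group it generates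
  -- lies in (1/D)ℤ².
  Stable : ℕ → Pair → Set
  Stable D w = ∀ k → InLattice D (step^ k w)

  stable-step : ∀ D w → Stable D w → Stable D (step w)
  stable-step D w h k = h (suc k)

  stable-⊟ : ∀ D w w′ → Stable D w → Stable D w′ → Stable D (w ⊞ (⊟ w′))
  stable-⊟ D w w′ h h′ k = subst (InLattice D) (sym (step^-⊟ k w w′))
    (lattice-⊞ D (step^ k w) (⊟ step^ k w′) (h k) (lattice-⊟ D (step^ k w′) (h′ k)))

  module _ (f : List ℤ) (f[z]≡0 : ∀ w → monic f w ≡ (0ℚ , 0ℚ)) where
    private
      -- The top coefficient is 1, so removing the lower terms from f(z)w leaves the highest power
      -- of z applied to w.
      leading : ∀ D as w → InLattice D (monic as w) → (∀ i → i ℕ.< length as → InLattice D (step^ i w)) →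
        InLattice D (step^ (length as) w)
      leading D []       w h _ = h
      leading D (a ∷ as) w h l = leading D as (step w)
        (subst (InLattice D) (⊞-cancel (ι a ⊡ w) (monic as (step w)))
          (lattice-⊞ D (⊟ (ι a ⊡ w)) (monic (a ∷ as) w)
                (lattice-⊟ D (ι a ⊡ w) (lattice-⊡ D a w (l 0 (ℕ.s≤s ℕ.z≤n)))) h))
        (λ i i< → l (suc i) (ℕ.s≤s i<))

      0-lattice : ∀ D → InLattice D (0ℚ , 0ℚ)
      0-lattice D = (+ 0 , ℚₚ.*-zeroʳ (ιℕ D)) , (+ 0 , ℚₚ.*-zeroʳ (ιℕ D))

      -- Moving the window of powers one place up adds a single vector at the top. As f(z)
      -- annihilates `step w`, that vector is an integer combination of vectors already in the
      -- lattice.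
      window : ∀ D w → (∀ i → i ℕ.≤ length f → InLattice D (step^ i w)) →
        ∀ i → i ℕ.≤ length f → InLattice D (step^ i (step w))
      window D w h i i≤ with ℕₚ.m≤n⇒m<n∨m≡n i≤
      ... | inj₁ i<   = h (suc i) i<
      ... | inj₂ refl = leading D f (step w) (subst (InLattice D) (sym (f[z]≡0 (step w))) (0-lattice D))
                          (λ i i< → h (suc i) i<)

      window⇒stable : ∀ D w → (∀ i → i ℕ.≤ length f → InLattice D (step^ i w)) → Stable D w
      window⇒stable D w h zero    = h 0 ℕ.z≤n
      window⇒stable D w h (suc k) = window⇒stable D (step w) (window D w h) k

    stable-denominator : ∀ w → ∃ λ D → ℕ.NonZero D × Stable D w
    stable-denominator w = let D , D≢0 , h = common-denominator (length f) w in
      D , D≢0 , window⇒stable D w h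

    private
      -- At this stage b and c may still have denominators, and these enter the norm beside the D²
      -- from the two coordinates.
      C : ℕ → ℕ
      C D = ↧ₙ b ℕ.* ↧ₙ c ℕ.* (D ℕ.* D)

      norm-integral : ∀ D w → InLattice D w → Integral (ιℕ (C D) ℚ.* norm w)
      norm-integral D (u , v) (hu , hv) = subst Integral eq
        (integral-+ (integral-+ (integral-* (integral-* β′ (integral-↧* c)) (integral-* hu hu))
          (integral-neg (integral-* (integral-* γ′ (integral-↧* b)) (integral-* hu hv))))
          (integral-* (integral-* β′ γ′) (integral-* hv hv)))
        where
        β′ : Integral (ιℕ (↧ₙ b))
        β′ = integral-ι (+ ↧ₙ b)
        γ′ : Integral (ιℕ (↧ₙ c))
        γ′ = integral-ι (+ ↧ₙ c)
        identity : ∀ β γ δ b c u v →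
          β ℚ.* (γ ℚ.* c) ℚ.* ((δ ℚ.* u) ℚ.* (δ ℚ.* u)) ℚ.- γ ℚ.* (β ℚ.* b) ℚ.*
                ((δ ℚ.* u) ℚ.* (δ ℚ.* v)) ℚ.+ β ℚ.* γ ℚ.* ((δ ℚ.* v) ℚ.* (δ ℚ.* v))
          ≡ β ℚ.* γ ℚ.* (δ ℚ.* δ) ℚ.* (c ℚ.* (u ℚ.* u) ℚ.- b ℚ.* (u ℚ.* v) ℚ.+ v ℚ.* v)
        identity = solve 7 (λ β γ δ b c u v →
          β :* (γ :* c) :* ((δ :* u) :* (δ :* u)) :- γ :* (β :* b) :*
                ((δ :* u) :* (δ :* v)) :+ β :* γ :* ((δ :* v) :* (δ :* v))
          := β :* γ :* (δ :* δ) :* (c :* (u :* u) :- b :* (u :* v) :+ v :* v)) refl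
        eq : _ ≡ ιℕ (C D) ℚ.* norm (u , v)
        eq = trans (identity (ιℕ (↧ₙ b)) (ιℕ (↧ₙ c)) (ιℕ D) b c u v)
          (cong (ℚ._* norm (u , v)) (sym (trans (ιℕ-* (↧ₙ b ℕ.* ↧ₙ c) (D ℕ.* D))
                (cong₂ ℚ._*_ (ιℕ-* (↧ₙ b) (↧ₙ c)) (ιℕ-* D D)))))

      -- The orbit of 1 under g has norms ν ^ k, with bounded denominators.
      multiplier-integral : ∀ (g : Pair → Pair) ν → (∀ D w → Stable D w → Stable D (g w)) →
        (∀ w → norm (g w) ≡ norm w ℚ.* ν) → Integral ν
      multiplier-integral g ν stable mult =
        let D , D≢0 , h = stable-denominator (0ℚ , 1ℚ) in
        bounded-denominators⇒integral (C D) {{ℕₚ.m*n≢0 (↧ₙ b ℕ.* ↧ₙ c)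
              (D ℕ.* D) {{ℕₚ.m*n≢0 (↧ₙ b) (↧ₙ c)}} {{ℕₚ.m*n≢0 D D {{D≢0}} {{D≢0}}}}}} ν
          λ k → let w , s , eq = orbit D h k in
            subst (λ q → Integral (ιℕ (C D) ℚ.* q)) eq (norm-integral D w (s 0))
        where
        norm-1 : ∀ b c → c ℚ.* (0ℚ ℚ.* 0ℚ) ℚ.- b ℚ.* (0ℚ ℚ.* 1ℚ) ℚ.+ 1ℚ ℚ.* 1ℚ ≡ 1ℚ
        norm-1 = solve 2 (λ b c → c :* (con 0ℚ :* con 0ℚ) :- b :*
              (con 0ℚ :* con 1ℚ) :+ con 1ℚ :* con 1ℚ := con 1ℚ) refl
        orbit : ∀ D → Stable D (0ℚ , 1ℚ) → ∀ k → ∃ λ w → Stable D w × norm w ≡ ν ^ k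
        orbit D h zero    = (0ℚ , 1ℚ) , h , norm-1 b c
        orbit D h (suc k) = let w , s , eq = orbit D h k in
          g w , stable D w s , trans (mult w) (cong (ℚ._* ν) eq)

    c-integral : Integral c
    c-integral = multiplier-integral step c stable-step (λ (u , v) → identity b c u v)
      where
      identity : ∀ b c u v →
        c ℚ.* ((v ℚ.- b ℚ.* u) ℚ.* (v ℚ.- b ℚ.* u)) ℚ.- b ℚ.*
              ((v ℚ.- b ℚ.* u) ℚ.* (ℚ.- (c ℚ.* u))) ℚ.+ ℚ.- (c ℚ.* u) ℚ.* ℚ.- (c ℚ.* u)
        ≡ (c ℚ.* (u ℚ.* u) ℚ.- b ℚ.* (u ℚ.* v) ℚ.+ v ℚ.* v) ℚ.* c
      identity = solve 4 (λ b c u v →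
        c :* ((v :- b :* u) :* (v :- b :* u)) :- b :* ((v :- b :* u) :* (:- (c :* u))) :+
              (:- (c :* u)) :* (:- (c :* u))
        := (c :* (u :* u) :- b :* (u :* v) :+ v :* v) :* c) refl

    -- Up to sign b is a trace, and traces are not multiplicative. It is reached through the norm of
    -- z - 1, which is the value of x² + bx + c at 1.
    1+b+c-integral : Integral (1ℚ ℚ.+ b ℚ.+ c)
    1+b+c-integral = multiplier-integral (λ w → step w ⊞ (⊟ w)) (1ℚ ℚ.+ b ℚ.+ c)
      (λ D w s → stable-⊟ D (step w) w (stable-step D w s) s) (λ (u , v) → identity b c u v)
      where
      identity : ∀ b c u v →
        c ℚ.* (((v ℚ.- b ℚ.* u) ℚ.- u) ℚ.* ((v ℚ.- b ℚ.* u) ℚ.- u)) ℚ.- b ℚ.*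
              (((v ℚ.- b ℚ.* u) ℚ.- u) ℚ.* (ℚ.- (c ℚ.* u) ℚ.- v)) ℚ.+ (ℚ.- (c ℚ.* u) ℚ.- v) ℚ.*
              (ℚ.- (c ℚ.* u) ℚ.- v)
        ≡ (c ℚ.* (u ℚ.* u) ℚ.- b ℚ.* (u ℚ.* v) ℚ.+ v ℚ.* v) ℚ.* (1ℚ ℚ.+ b ℚ.+ c)
      identity = solve 4 (λ b c u v →
        c :* (((v :- b :* u) :- u) :* ((v :- b :* u) :- u)) :- b :*
              (((v :- b :* u) :- u) :* (:- (c :* u) :- v)) :+ (:- (c :* u) :- v) :* (:- (c :* u) :- v)
        := (c :* (u :* u) :- b :* (u :* v) :+ v :* v) :* (con 1ℚ :+ b :+ c)) refl

    b-integral : Integral b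
    b-integral = subst Integral (eq b c)
      (integral-+ 1+b+c-integral (integral-neg (integral-+ (integral-ι (+ 1)) c-integral)))
      where
      eq : ∀ b c → (1ℚ ℚ.+ b ℚ.+ c) ℚ.- (1ℚ ℚ.+ c) ≡ b
      eq = solve 2 (λ b c → (con 1ℚ :+ b :+ c) :- (con 1ℚ :+ c) := b) refl

-- Square roots and quadratic integers

ι-reciprocal : ∀ k → ∃ λ q → ιℕ (suc k) ℚ.* q ≡ 1ℚ
ι-reciprocal k = let q , _ , eq = recip (ιℕ-mono-< 0 (suc k) (ℕ.s≤s ℕ.z≤n)) in q , eq

-- For z = x + iy, the equation xy = 0 does not tell which factor vanishes. Multiplying x² - y² = n
-- by y² gives y⁴ + ny² = 0 instead, a sum of two squares because n = (√n)².
nonneg-square⇒Real : ∀ n z → z * z ≈ fromℚ (ιℕ n) → Real z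
nonneg-square⇒Real n (x +i y) (mk≈ h k) = x²≈0⇒x≈0 y (x²+y²≈0⇒x≈0 (y *ʳ y) (√ʳ n *ʳ y)
  (ℝ-Algebra.real-root x y (√ʳ n) (√ʳ-square n) h k))

-- Likewise x² - y² = -r² times x² becomes x⁴ + r²x² = 0, so x = 0 and y² = r²; invertibility of r
-- then decides the sign.
imaginary-roots : ∀ r s → r *ʳ s ≈ʳ fromℚʳ 1ℚ → ∀ z → z * z ≈ fromℝ (-ʳ (r *ʳ r)) →
  z ≈ fromℝ r * 𝕚 ⊎ z ≈ - (fromℝ r * 𝕚)
imaginary-roots r s rs≈1 (x +i y) (mk≈ h k) = Sum.map
  (λ y≈r → mk≈ (≈ʳ-trans x≈0 (≈ʳ-sym (ℝ-Algebra.[r+0i]i-re r)))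
        (≈ʳ-trans y≈r (≈ʳ-sym (ℝ-Algebra.[r+0i]i-im r))))
  (λ y≈-r → mk≈ (≈ʳ-trans x≈0 (≈ʳ-trans (≈ʳ-≡ λ _ → refl) (-ʳ-cong (≈ʳ-sym (ℝ-Algebra.[r+0i]i-re r)))))
                (≈ʳ-trans y≈-r (-ʳ-cong (≈ʳ-sym (ℝ-Algebra.[r+0i]i-im r)))))
  (y²≈r²⇒y≈±r y r s rs≈1 (ℝ-Algebra.imaginary-root-im x y r h x≈0))
  where
  x≈0 : x ≈ʳ 0ʳ
  x≈0 = x²≈0⇒x≈0 x (x²+y²≈0⇒x≈0 (x *ʳ x) (r *ʳ x) (ℝ-Algebra.imaginary-root x y r h k))

fromℚʳ-cong : ∀ {p q} → p ≡ q → fromℚʳ p ≈ʳ fromℚʳ q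
fromℚʳ-cong refl = ≈ʳ-refl

negative-square : ∀ n {r} → r *ʳ r ≈ʳ fromℚʳ (ιℕ n) → fromℚ (ι (ℤ.- + n)) ≈ fromℝ (-ʳ (r *ʳ r))
negative-square n h = mk≈ (≈ʳ-trans (fromℚʳ-cong (ι-neg (+ n)))
      (≈ʳ-trans (≈ʳ-≡ λ _ → refl) (-ʳ-cong (≈ʳ-sym h)))) ≈ʳ-refl

√-roots : ∀ k z → z * z ≈ fromℤ -[1+ k ] → z ≈ √ -[1+ k ] ⊎ z ≈ - (√ -[1+ k ])
√-roots k z h = let q , nq≡1 = ι-reciprocal k in
  imaginary-roots (√ʳ suc k) (fromℚʳ q *ʳ √ʳ suc k)
    (ℝ-Algebra.inverse-root (√ʳ-square (suc k)) (≈ʳ-≡ λ _ → nq≡1)) z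
    (≈-trans h (negative-square (suc k) {√ʳ suc k} (√ʳ-square (suc k))))

-- Here r is the constant sequence with value the natural number itself, so the root comes out as an
-- integer times 𝕚, with no comparison to `√ʳ` of a square.
integer-roots : ∀ m z → z * z ≈ fromℤ (ℤ.- + (suc m ℕ.* suc m)) →
  z ≈ fromℤ (+ suc m) * 𝕚 ⊎ z ≈ - (fromℤ (+ suc m) * 𝕚)
integer-roots m z h = let q , mq≡1 = ι-reciprocal m in
  imaginary-roots (fromℚʳ (ιℕ (suc m))) (fromℚʳ q) (≈ʳ-≡ λ _ → mq≡1) z
    (≈-trans h (negative-square (suc m ℕ.* suc m) {fromℚʳ (ιℕ (suc m))}
          (≈ʳ-≡ λ _ → sym (ιℕ-* (suc m) (suc m)))))

fromℝ-square : ∀ x → fromℝ x * fromℝ x ≈ fromℝ (x *ʳ x)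
fromℝ-square x = mk≈ (ℝ-Algebra.[x+0i][y+0i]-re x x) (ℝ-Algebra.[x+0i][y+0i]-im x x)

fromℝ-cong : ∀ {x y} → x ≈ʳ y → fromℝ x ≈ fromℝ y
fromℝ-cong h = mk≈ h ≈ʳ-refl

𝕚-square : 𝕚 * 𝕚 ≈ fromℚ (ι (ℤ.- + 1))
𝕚-square = mk≈ (≈ʳ-≡ λ _ → refl) (≈ʳ-≡ λ _ → refl)

√-square : ∀ d → √ d * √ d ≈ fromℤ d
√-square (+ n) = ≈-trans (fromℝ-square (√ʳ n)) (fromℝ-cong (√ʳ-square n))
√-square -[1+ k ] = ≈-trans
  (ℂ-Algebra.square-product {fromℝ (√ʳ suc k)} {𝕚} (≈-trans (fromℝ-square (√ʳ suc k))
        (fromℝ-cong (√ʳ-square (suc k)))) 𝕚-square)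
  (≈-trans (≈-sym (fromℚ-* (ιℕ (suc k)) (ι (ℤ.- + 1))))
    (fromℚ-cong (trans (sym (ι-* (+ suc k) (ℤ.- + 1)))
          (cong ι (trans (ℤₚ.*-comm (+ suc k) (ℤ.- + 1)) (ℤₚ.-1*i≡-i (+ suc k)))))))

eval-∷ : ∀ a p z → eval (a ∷ p) z ≈ fromℚ a + z * eval p z
eval-∷ a p z = ≈-refl

eval-1 : ∀ z → eval (1ℚ ∷ []) z ≈ 1ᶜ
eval-1 z = ≈-trans (eval-∷ 1ℚ [] z) (ℂ-Algebra.horner-constant z)

eval-linear : ∀ b z → eval (b ∷ 1ℚ ∷ []) z ≈ fromℚ b + z
eval-linear b z = ≈-trans (eval-∷ b (1ℚ ∷ []) z)
  (≈-trans (+-cong (≈-refl {fromℚ b}) (*-cong (≈-refl {z}) (eval-1 z))) (ℂ-Algebra.horner-linear z (fromℚ b)))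

eval-quadratic : ∀ b c z → eval (c ∷ b ∷ 1ℚ ∷ []) z ≈ fromℚ c + z * (fromℚ b + z)
eval-quadratic b c z = ≈-trans (eval-∷ c (b ∷ 1ℚ ∷ []) z)
  (+-cong (≈-refl {fromℚ c}) (*-cong (≈-refl {z}) (eval-linear b z)))

linear-root-Real : ∀ q z → fromℚ q + z ≈ 0ᶜ → Real z
linear-root-Real q z h = ≈ʳ-trans (im-≈ (ℂ-Algebra.b+z≃0⇒z≃-b z (fromℚ q) h)) (≈ʳ-≡ λ _ → refl)

1ᶜ≉0ᶜ : ¬ 1ᶜ ≈ 0ᶜ
1ᶜ≉0ᶜ h = ℚₚ.1≢0 (fromℚ-injective h)

integer-root⇒quadraticInteger : ∀ b c z → z ∉ Real → IsRoot z (fromℤ b) (fromℤ c) → z ∈ QuadraticInteger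
integer-root⇒quadraticInteger b c z z∉ℝ h =
  (c ∷ b ∷ [] , root) , (ι c ∷ ι b ∷ [] , root) , minimal
  where
  root : eval (ι c ∷ ι b ∷ 1ℚ ∷ []) z ≈ 0ᶜ
  root = ≈-trans (eval-quadratic (ι b) (ι c) z) h
  minimal : ∀ {m} → m ℕ.< 2 → (q : Vec ℚ m) → ¬ MonicRoot q z
  minimal _ []       k = 1ᶜ≉0ᶜ (≈-trans (≈-sym (eval-1 z)) k)
  minimal _ (q ∷ []) k = z∉ℝ (linear-root-Real q z (≈-trans (≈-sym (eval-linear q z)) k))
  minimal (ℕ.s≤s (ℕ.s≤s ())) (_ ∷ _ ∷ _) _

module _ (z : ℂ) (z∉ℝ : z ∉ Real) (b c : ℚ) (root : IsRoot z (fromℚ b) (fromℚ c)) where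
  open QuadraticAlgebra b c

  ⟦_⟧ : Pair → ℂ
  ⟦ u , v ⟧ = fromℚ u * z + fromℚ v

  ⟦⟧-step : ∀ w → ⟦ step w ⟧ ≈ z * ⟦ w ⟧
  ⟦⟧-step (u , v) = ≈-sym (≈-trans (ℂ-Algebra.z*linear z (fromℚ b) (fromℚ c) (fromℚ u) (fromℚ v) root)
    (+-cong (*-cong (≈-trans (+-cong (≈-refl {fromℚ v})
          (≈-trans (neg-cong (≈-sym (fromℚ-* b u))) (≈-sym (fromℚ-neg (b ℚ.* u)))))
          (≈-sym (fromℚ-+ v (ℚ.- (b ℚ.* u))))) (≈-refl {z}))
      (≈-trans (neg-cong (≈-sym (fromℚ-* c u))) (≈-sym (fromℚ-neg (c ℚ.* u))))))

  ⟦⟧-⊞ : ∀ w w′ → ⟦ w ⊞ w′ ⟧ ≈ ⟦ w ⟧ + ⟦ w′ ⟧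
  ⟦⟧-⊞ (u , v) (u′ , v′) = ≈-trans
    (+-cong (*-cong (fromℚ-+ u u′) (≈-refl {z})) (fromℚ-+ v v′))
    (ℂ-Algebra.linear-⊞ z (fromℚ u) (fromℚ v) (fromℚ u′) (fromℚ v′))

  ⟦⟧-⊡ : ∀ a w → ⟦ a ⊡ w ⟧ ≈ fromℚ a * ⟦ w ⟧
  ⟦⟧-⊡ a (u , v) = ≈-trans
    (+-cong (*-cong (fromℚ-* a u) (≈-refl {z})) (fromℚ-* a v))
    (ℂ-Algebra.linear-⊡ z (fromℚ a) (fromℚ u) (fromℚ v))

  ⟦⟧-monic : ∀ f w → ⟦ monic f w ⟧ ≈ eval (map ι f ∷ʳ 1ℚ) z * ⟦ w ⟧
  ⟦⟧-monic []      w = ≈-sym (≈-trans (*-cong (eval-1 z) (≈-refl {⟦ w ⟧})) (*-identityˡ ⟦ w ⟧))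
  ⟦⟧-monic (a ∷ f) w = ≈-trans (⟦⟧-⊞ (ι a ⊡ w) (monic f (step w)))
    (≈-trans (+-cong (⟦⟧-⊡ (ι a) w) (≈-trans (⟦⟧-monic f (step w)) (*-cong (≈-refl {e}) (⟦⟧-step w))))
    (≈-trans (≈-sym (ℂ-Algebra.horner (fromℚ (ι a)) z e ⟦ w ⟧))
      (*-cong (≈-sym (eval-∷ (ι a) (map ι f ∷ʳ 1ℚ) z)) (≈-refl {⟦ w ⟧}))))
    where
    e : ℂ
    e = eval (map ι f ∷ʳ 1ℚ) z

  -- 1 and z are linearly independent over ℚ, since the imaginary part of uz + v is u times that of
  -- z. Vanishing in ℂ can thus be read off on coefficient pairs.
  ⟦⟧-injective : ∀ w → ⟦ w ⟧ ≈ 0ᶜ → w ≡ (0ℚ , 0ℚ)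
  ⟦⟧-injective (u , v) h with u ℚₚ.≟ 0ℚ
  ... | yes refl = cong (0ℚ ,_) (fromℚ-injective (ℂ-Algebra.constant-term z (fromℚ v) h))
  ... | no u≢0 = contradiction (ℝ-Algebra.cancel-factor (re z) (im z) (fromℚʳ u) (fromℚʳ (1/ u))
      (≈ʳ-≡ λ _ → ℚₚ.*-inverseʳ u) (im-≈ h)) z∉ℝ
    where instance
      _ : ℚ.NonZero u
      _ = ℚ.≢-nonZero u≢0

  algebraicInteger⇒integral : z ∈ AlgebraicInteger → Integral b × Integral c
  algebraicInteger⇒integral (f , fz≈0) = b-integral f annihilates , c-integral f annihilates
    where
    annihilates : ∀ w → monic f w ≡ (0ℚ , 0ℚ)
    annihilates w = ⟦⟧-injective (monic f w) (≈-trans (⟦⟧-monic f w)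
      (≈-trans (*-cong fz≈0 (≈-refl {⟦ w ⟧})) (ℂ-Algebra.zero-product ⟦ w ⟧)))

quadraticInteger⇒integer-root : ∀ z → z ∉ Real → z ∈ QuadraticInteger →
  ∃ λ b → ∃ λ c → IsRoot z (fromℤ b) (fromℤ c)
quadraticInteger⇒integer-root z z∉ℝ (int , (q₀ ∷ q₁ ∷ [] , h) , _) =
  substituted (algebraicInteger⇒integral z z∉ℝ q₁ q₀ root int)
  where
  root : IsRoot z (fromℚ q₁) (fromℚ q₀)
  root = ≈-trans (≈-sym (eval-quadratic q₁ q₀ z)) h
  substituted : Integral q₁ × Integral q₀ → ∃ λ b → ∃ λ c → IsRoot z (fromℤ b) (fromℤ c)
  substituted ((b , eqb) , (c , eqc)) = b , c , subst₂ (λ p q → IsRoot z (fromℚ p) (fromℚ q)) eqb eqc root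

-- The sets S and Ŝ

-- A bound on every term of the given sequence, not invariant under `≈ʳ`. It is asked of a
-- convenient representative, to which `UpperHalf` links the imaginary part by `≈ʳ`.
Positive : ℝ → Set
Positive u = ∃ λ δ → 0ℚ ℚ.< δ × (∀ n → δ ℚ.≤ seq u n)

NonNegative : ℝ → Set
NonNegative v = ∀ n → 0ℚ ℚ.≤ seq v n

positive⇒nonNegative : ∀ {u} → Positive u → NonNegative u
positive⇒nonNegative (δ , 0<δ , δ≤u) n = ℚₚ.≤-trans (ℚₚ.<⇒≤ 0<δ) (δ≤u n)

-- The difference u - (-v) = u + v is at least δ at every index.
positive≉-nonNegative : ∀ u v → Positive u → NonNegative v → ¬ u ≈ʳ -ʳ v
positive≉-nonNegative u v (δ , 0<δ , δ≤u) 0≤v (mk≈ʳ h) = let N , near = h δ 0<δ in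
  ℚₚ.<-irrefl refl (begin-strict
    δ                                      ≤⟨ δ≤u N ⟩
    seq u N                                ≡⟨ sym (ℚₚ.+-identityʳ (seq u N)) ⟩
    seq u N ℚ.+ 0ℚ                         ≤⟨ ℚₚ.+-monoʳ-≤ (seq u N) (0≤v N) ⟩
    seq u N ℚ.+ seq v N                    ≡⟨ eq (seq u N) (seq v N) ⟩
    seq u N ℚ.- (ℚ.- seq v N)              ≤⟨ p≤∣p∣ (seq u N ℚ.- (ℚ.- seq v N)) ⟩
    ∣ seq u N ℚ.- (ℚ.- seq v N) ∣          <⟨ near N ℕₚ.≤-refl ⟩
    δ ∎)
  where
  open ℚₚ.≤-Reasoning
  open ℚSolver.+-*-Solver
  eq : ∀ a b → a ℚ.+ b ≡ a ℚ.- (ℚ.- b)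
  eq = solve 2 (λ a b → a :+ b := a :- (:- b)) refl

-- ⌊K√n⌋ ≥ K for n ≥ 1, so 1 bounds every term from below.
√-positive : ∀ k → Positive (√ʳ suc k)
√-positive k = 1ℚ , ℚₚ.positive⁻¹ 1ℚ , λ j → ℚₚ.*-cancelʳ-≤-pos
      (ιℕ (suc j)) {{ℚ.positive (ιℕ-mono-< 0 (suc j) (ℕ.s≤s ℕ.z≤n))}} (begin
  1ℚ ℚ.* ιℕ (suc j)                 ≡⟨ ℚₚ.*-identityˡ (ιℕ (suc j)) ⟩
  ιℕ (suc j)                        ≤⟨ ιℕ-mono-≤ (suc j) (a j) (≤a j) ⟩
  ιℕ (a j)                          ≡⟨ sym (/-*-cancel (+ a j) j) ⟩
  √seq (suc k) j ℚ.* ιℕ (suc j) ∎)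
  where
  open ℚₚ.≤-Reasoning
  a : ℕ → ℕ
  a j = isqrt (suc k ℕ.* (suc j ℕ.* suc j))
  ≤a : ∀ j → suc j ℕ.≤ a j
  ≤a j = ℕₚ.≮⇒≥ λ a<K → ℕₚ.<-irrefl refl (ℕₚ.<-≤-trans (isqrt-upper (suc k ℕ.* (suc j ℕ.* suc j)))
    (ℕₚ.≤-trans (ℕₚ.*-mono-≤ a<K a<K) (ℕₚ.m≤n*m (suc j ℕ.* suc j) (suc k))))

fromℚʳ-positive : ∀ q → 0ℚ ℚ.< q → Positive (fromℚʳ q)
fromℚʳ-positive q 0<q = q , 0<q , λ _ → ℚₚ.≤-refl

*-positive : ∀ q u → 0ℚ ℚ.< q → Positive u → Positive (fromℚʳ q *ʳ u)
*-positive q u 0<q (δ , 0<δ , δ≤u) = q ℚ.* δ , *-pos 0<q 0<δ ,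
  λ n → ℚₚ.*-monoˡ-≤-nonNeg q {{ℚ.nonNegative (ℚₚ.<⇒≤ 0<q)}} (δ≤u n)

NonSquare : ℕ → Set
NonSquare n = ∀ m → m ℕ.* m ≢ n

-- The index starts at c = 1: for c = k + 1 the radicand 1 - 4c is -(3 + 4k).
half : ℕ → ℂ
half k = fromℚ ½ * (1ᶜ + √ -[1+ 2 ℕ.+ 4 ℕ.* k ])

1-4[1+k] : ∀ k → + 1 ℤ.- + 4 ℤ.* + suc k ≡ -[1+ 2 ℕ.+ 4 ℕ.* k ]
1-4[1+k] k = trans (cong (λ m → + 1 ℤ.- + m) (ℕₚ.*-suc 4 k)) refl

^2 : ∀ n → n ℕ.^ 2 ≡ n ℕ.* n
^2 n = cong (n ℕ.*_) (ℕₚ.*-identityʳ n)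

between-squares⇒nonSquare : ∀ j n → j ℕ.* j ℕ.< n → n ℕ.< suc j ℕ.* suc j → NonSquare n
between-squares⇒nonSquare j n lo hi m refl with m ℕₚ.≤? j
... | yes m≤j = ℕₚ.<⇒≱ lo (ℕₚ.*-mono-≤ m≤j m≤j)
... | no  m≰j = ℕₚ.<⇒≱ hi (ℕₚ.*-mono-≤ (ℕₚ.≰⇒> m≰j) (ℕₚ.≰⇒> m≰j))

half-cong : ∀ {a} k → a ≡ -[1+ 2 ℕ.+ 4 ℕ.* k ] → fromℚ ½ * (1ᶜ + √ a) ≈ half k
half-cong k refl = ≈-refl

-- The interval index is forgotten. For odd n the lower bound leaves c ≥ 1; for even n, c lies
-- strictly between consecutive squares.
S-elements : ∀ z → z ∈ S → z ∉ Real × ((∃ λ k → z ≈ half k) ⊎ (∃ λ k → NonSquare (suc k) × z ≈ √ -[1+ k ]))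
S-elements z (n , _ , z∉ℝ , + suc k , inj₁ (_ , _ , _ , eq)) =
  z∉ℝ , inj₁ (k , ≈-trans eq (half-cong k (1-4[1+k] k)))
S-elements z (n , _ , z∉ℝ , + zero , inj₁ (_ , ℤ.+≤+ le , _)) =
  contradiction le (ℕₚ.<⇒≱ (ℕₚ.m≤n+m 1 (ℕ.⌊ n ℕ.∸ 1 /2⌋ ℕ.^ 2)))
S-elements z (n , _ , z∉ℝ , + suc k , inj₂ (_ , ℤ.+<+ lo , ℤ.+<+ hi , eq)) =
  z∉ℝ , inj₂ (k , between-squares⇒nonSquare j (suc k) (subst (ℕ._< suc k) (^2 j) lo)
    (subst (suc k ℕ.<_) (trans (^2 (j ℕ.+ 1)) (cong (λ i → i ℕ.* i) (ℕₚ.+-comm j 1))) hi) , eq)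
  where
  j : ℕ
  j = ℕ.⌊ n /2⌋

⌊n+n/2⌋≡n : ∀ n → ℕ.⌊ n ℕ.+ n /2⌋ ≡ n
⌊n+n/2⌋≡n n = sym (ℕₚ.n≡⌊n+n/2⌋ n)

⌊1+n+n+1/2⌋≡1+n : ∀ n → ℕ.⌊ suc (n ℕ.+ n) ℕ.+ 1 /2⌋ ≡ suc n
⌊1+n+n+1/2⌋≡1+n n = trans (cong ℕ.⌊_/2⌋ (ℕₚ.+-comm (suc (n ℕ.+ n)) 1)) (cong suc (⌊n+n/2⌋≡n n))

2∣n+n : ∀ n → 2 ∣ n ℕ.+ n
2∣n+n n = subst (2 ∣_) (cong (n ℕ.+_) (ℕₚ.+-identityʳ n)) (m∣m*n n)

2∤1+n+n : ∀ n → 2 ∤ suc (n ℕ.+ n)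
2∤1+n+n n h with ∣⇒≤ (∣m+n∣m⇒∣n (subst (2 ∣_) (ℕₚ.+-comm 1 (n ℕ.+ n)) h) (2∣n+n n))
... | ℕ.s≤s ()

-- n = 2j + 1 with j = isqrt k: the bounds j² ≤ k < (j + 1)² are those required of c = k + 1.
half∈S : ∀ k z → z ∉ Real → z ≈ half k → z ∈ S
half∈S k z z∉ℝ eq = suc (j ℕ.+ j) , ℕ.s≤s ℕ.z≤n , z∉ℝ , + suc k , inj₁ (2∤1+n+n j , ℤ.+≤+ lo , ℤ.+≤+ hi ,
  ≈-trans eq (≈-sym (half-cong k (1-4[1+k] k))))
  where
  j : ℕ
  j = isqrt k
  lo : ℕ.⌊ j ℕ.+ j /2⌋ ℕ.^ 2 ℕ.+ 1 ℕ.≤ suc k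
  lo = subst (ℕ._≤ suc k) (trans (cong suc (trans (sym (^2 j)) (cong (ℕ._^ 2) (sym (⌊n+n/2⌋≡n j)))))
        (ℕₚ.+-comm 1 _)) (ℕ.s≤s (isqrt-lower k))
  hi : suc k ℕ.≤ ℕ.⌊ suc (j ℕ.+ j) ℕ.+ 1 /2⌋ ℕ.^ 2
  hi = subst (suc k ℕ.≤_) (trans (sym (^2 (suc j))) (cong (ℕ._^ 2) (sym (⌊1+n+n+1/2⌋≡1+n j)))) (isqrt-upper k)

-- n = 2j with j = isqrt c for c = k + 1. That c is no square makes j² ≤ c strict, and c ≥ 1 forces
-- j ≥ 1.
√∈S : ∀ k z → z ∉ Real → NonSquare (suc k) → z ≈ √ -[1+ k ] → z ∈ S
√∈S k z z∉ℝ nonSquare eq = j ℕ.+ j , 1≤ j (isqrt-upper (suc k)) , z∉ℝ , + suc k , inj₂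
      (2∣n+n j , ℤ.+<+ lo , ℤ.+<+ hi , eq)
  where
  j : ℕ
  j = isqrt (suc k)
  1≤ : ∀ j → suc k ℕ.< suc j ℕ.* suc j → 1 ℕ.≤ j ℕ.+ j
  1≤ zero    (ℕ.s≤s ())
  1≤ (suc j) _ = ℕ.s≤s ℕ.z≤n
  lo : ℕ.⌊ j ℕ.+ j /2⌋ ℕ.^ 2 ℕ.< suc k
  lo = subst (ℕ._< suc k) (trans (sym (^2 j)) (cong (ℕ._^ 2) (sym (⌊n+n/2⌋≡n j))))
    (ℕₚ.≤∧≢⇒< (isqrt-lower (suc k)) (nonSquare j))
  hi : suc k ℕ.< (ℕ.⌊ j ℕ.+ j /2⌋ ℕ.+ 1) ℕ.^ 2
  hi = subst (suc k ℕ.<_) (trans (sym (^2 (suc j))) (cong (ℕ._^ 2)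
        (trans (ℕₚ.+-comm 1 j) (cong (ℕ._+ 1) (sym (⌊n+n/2⌋≡n j)))))) (isqrt-upper (suc k))

-- These two coordinates determine sign and translate: negation leaves the upper half-plane, and 0
-- and ½ are incongruent modulo ℤ.
UpperHalf : ℂ → Set
UpperHalf z = (∃ λ u → Positive u × im z ≈ʳ u) × (re z ≈ʳ fromℚʳ 0ℚ ⊎ re z ≈ʳ fromℚʳ ½)

Ŝ-upperHalf : ∀ z → z ∈ Ŝ → UpperHalf z
Ŝ-upperHalf z (inj₁ z∈S) = from (proj₂ (S-elements z z∈S))
  where
  from : (∃ λ k → z ≈ half k) ⊎ (∃ λ k → NonSquare (suc k) × z ≈ √ -[1+ k ]) → UpperHalf z
  from (inj₁ (k , mk≈ h h′)) = let r = √ʳ suc (2 ℕ.+ 4 ℕ.* k) in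
    (fromℚʳ ½ *ʳ r , *-positive ½ r (ℚₚ.positive⁻¹ ½) (√-positive (2 ℕ.+ 4 ℕ.* k)) , ≈ʳ-trans h′
          (ℝ-Algebra.half-im r)) ,
    inj₂ (≈ʳ-trans h (ℝ-Algebra.half-re r))
  from (inj₂ (k , _ , mk≈ h h′)) =
    (√ʳ suc k , √-positive k , ≈ʳ-trans h′ (ℝ-Algebra.[r+0i]i-im (√ʳ suc k))) ,
    inj₁ (≈ʳ-trans h (ℝ-Algebra.[r+0i]i-re (√ʳ suc k)))
Ŝ-upperHalf z (inj₂ (n , 0<n , mk≈ h h′)) =
  (fromℚʳ (ι n) , fromℚʳ-positive (ι n) (ι-mono-< {+ 0} {n} 0<n) , ≈ʳ-trans h′
        (ℝ-Algebra.[r+0i]i-im (fromℚʳ (ι n)))) ,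
  inj₁ (≈ʳ-trans h (ℝ-Algebra.[r+0i]i-re (fromℚʳ (ι n))))

-- Translates of Ŝ

signedʳ : Sign → ℝ → ℝ
signedʳ Sign.+ x = x
signedʳ Sign.- x = -ʳ x

signedℚ : Sign → ℚ → ℚ
signedℚ Sign.+ q = q
signedℚ Sign.- q = ℚ.- q

-- Coordinates z = ε(offset + i height) + n.
record Location (z : ℂ) (n : ℤ) (ε : Sign) : Set where
  field
    height   : ℝ
    positive : Positive height
    im≈      : im z ≈ʳ signedʳ ε height
    offset   : ℚ
    offset≡  : offset ≡ 0ℚ ⊎ offset ≡ ½
    re≈      : re z ≈ʳ fromℚʳ (signedℚ ε offset ℚ.+ ι n)

upperHalf-re : ∀ {z} → UpperHalf z → ∃ λ h → (h ≡ 0ℚ ⊎ h ≡ ½) × re z ≈ʳ fromℚʳ h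
upperHalf-re (_ , inj₁ h) = 0ℚ , inj₁ refl , h
upperHalf-re (_ , inj₂ h) = ½ , inj₂ refl , h

location : ∀ z n ε → z ∈ ε • Ŝ ⊕ n → Location z n ε
location z n Sign.+ (α , α∈Ŝ , mk≈ h h′) =
  let up@((u , pos , eq) , _) = Ŝ-upperHalf α α∈Ŝ
      q , q≡ , req = upperHalf-re up
  in record { height = u ; positive = pos ; offset = q ; offset≡ = q≡
            ; im≈ = ≈ʳ-trans h′ (≈ʳ-trans (+ʳ-cong eq ≈ʳ-refl) (ℝ-Algebra.x+0 u))
            ; re≈ = ≈ʳ-trans h (≈ʳ-trans (+ʳ-cong req ≈ʳ-refl) (≈ʳ-≡ λ _ → refl)) }
location z n Sign.- (β , (α , α∈Ŝ , mk≈ k k′) , mk≈ h h′) =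
  let up@((u , pos , eq) , _) = Ŝ-upperHalf α α∈Ŝ
      q , q≡ , req = upperHalf-re up
  in record { height = u ; positive = pos ; offset = q ; offset≡ = q≡
            ; im≈ = ≈ʳ-trans h′ (≈ʳ-trans (+ʳ-cong (≈ʳ-trans k′ (-ʳ-cong eq)) ≈ʳ-refl) (ℝ-Algebra.x+0 (-ʳ u)))
            ; re≈ = ≈ʳ-trans h (≈ʳ-trans (+ʳ-cong (≈ʳ-trans k (-ʳ-cong req)) ≈ʳ-refl) (≈ʳ-≡ λ _ → refl)) }

n+n≢1+m+m : ∀ n m → n ℤ.+ n ≢ m ℤ.+ m ℤ.+ + 1
n+n≢1+m+m n m eq = contradiction (∣⇒≤ (divides ℤ.∣ n ℤ.- m ∣
      (trans (cong ℤ.∣_∣ even) (ℤₚ.abs-* (n ℤ.- m) (+ 2))))) (λ { (ℕ.s≤s ()) })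
  where
  open ℤSolver.+-*-Solver
  rearrange : ∀ n m → + 1 ℤ.+ ((n ℤ.+ n) ℤ.- (m ℤ.+ m ℤ.+ + 1)) ≡ (n ℤ.- m) ℤ.* + 2
  rearrange = solve 2 (λ n m → con (+ 1) :+ ((n :+ n) :- (m :+ m :+ con (+ 1))) := (n :- m) :* con (+ 2)) refl
  even : + 1 ≡ (n ℤ.- m) ℤ.* + 2
  even = trans (cong (λ d → + 1 ℤ.+ d) (sym (trans (cong (ℤ._- (m ℤ.+ m ℤ.+ + 1)) eq)
        (ℤₚ.+-inverseʳ (m ℤ.+ m ℤ.+ + 1))))) (rearrange n m)

ι≢ι+½ : ∀ n m → ι n ≢ ½ ℚ.+ ι m
ι≢ι+½ n m eq = n+n≢1+m+m n m (ι-injective {n ℤ.+ n} {m ℤ.+ m ℤ.+ + 1} (begin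
  ι (n ℤ.+ n)                      ≡⟨ ι-+ n n ⟩
  ι n ℚ.+ ι n                      ≡⟨ cong₂ ℚ._+_ eq eq ⟩
  (½ ℚ.+ ι m) ℚ.+ (½ ℚ.+ ι m)      ≡⟨ identity (ι m) ⟩
  (ι m ℚ.+ ι m) ℚ.+ 1ℚ             ≡⟨ cong (ℚ._+ 1ℚ) (sym (ι-+ m m)) ⟩
  ι (m ℤ.+ m) ℚ.+ 1ℚ               ≡⟨ sym (ι-+ (m ℤ.+ m) (+ 1)) ⟩
  ι (m ℤ.+ m ℤ.+ + 1) ∎))
  where
  open ≡-Reasoning
  open ℚSolver.+-*-Solver
  identity : ∀ x → (½ ℚ.+ x) ℚ.+ (½ ℚ.+ x) ≡ (x ℚ.+ x) ℚ.+ 1ℚ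
  identity = solve 1 (λ x → (con ½ :+ x) :+ (con ½ :+ x) := (x :+ x) :+ con 1ℚ) refl

offset-injective : ∀ ε h h′ n n′ → h ≡ 0ℚ ⊎ h ≡ ½ → h′ ≡ 0ℚ ⊎ h′ ≡ ½ →
  signedℚ ε h ℚ.+ ι n ≡ signedℚ ε h′ ℚ.+ ι n′ → n ≡ n′
offset-injective ε h h′ n n′ = cases ε
  where
  open ℚSolver.+-*-Solver
  cancel : ∀ x → (ℚ.- x) ℚ.+ (x ℚ.+ ι n) ≡ (ℚ.- x) ℚ.+ (x ℚ.+ ι n′) → n ≡ n′
  cancel x eq = ι-injective {n} {n′} (trans (sym (eq₀ x (ι n))) (trans eq (eq₀ x (ι n′))))
    where
    eq₀ : ∀ x y → (ℚ.- x) ℚ.+ (x ℚ.+ y) ≡ y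
    eq₀ = solve 2 (λ x y → (:- x) :+ (x :+ y) := y) refl
  same : ∀ x → x ℚ.+ ι n ≡ x ℚ.+ ι n′ → n ≡ n′
  same x eq = cancel x (cong ((ℚ.- x) ℚ.+_) eq)
  ½-½ : ∀ y → ½ ℚ.+ ((ℚ.- ½) ℚ.+ y) ≡ y
  ½-½ = solve 1 (λ y → con ½ :+ ((:- con ½) :+ y) := y) refl
  ½+0 : ∀ y → ½ ℚ.+ ((ℚ.- 0ℚ) ℚ.+ y) ≡ ½ ℚ.+ y
  ½+0 = solve 1 (λ y → con ½ :+ ((:- con 0ℚ) :+ y) := con ½ :+ y) refl
  cases : ∀ ε → h ≡ 0ℚ ⊎ h ≡ ½ → h′ ≡ 0ℚ ⊎ h′ ≡ ½ → signedℚ ε h ℚ.+ ι n ≡ signedℚ ε h′ ℚ.+ ι n′ → n ≡ n′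
  cases ε      (inj₁ refl) (inj₁ refl) eq = same (signedℚ ε 0ℚ) eq
  cases ε      (inj₂ refl) (inj₂ refl) eq = same (signedℚ ε ½) eq
  cases Sign.+ (inj₁ refl) (inj₂ refl) eq = contradiction (trans (sym (ℚₚ.+-identityˡ (ι n))) eq) (ι≢ι+½ n n′)
  cases Sign.+ (inj₂ refl) (inj₁ refl) eq = contradiction
        (trans (sym (ℚₚ.+-identityˡ (ι n′))) (sym eq)) (ι≢ι+½ n′ n)
  -- For the negative sign, adding ½ to both sides turns -½ into 0 and leads back to an integer
  -- against ½ plus an integer.
  cases Sign.- (inj₁ refl) (inj₂ refl) eq =
    contradiction (trans (sym (½-½ (ι n′))) (trans (cong (½ ℚ.+_) (sym eq)) (½+0 (ι n)))) (ι≢ι+½ n′ n)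
  cases Sign.- (inj₂ refl) (inj₁ refl) eq =
    contradiction (trans (sym (½-½ (ι n))) (trans (cong (½ ℚ.+_) eq) (½+0 (ι n′)))) (ι≢ι+½ n n′)

location-unique : ∀ {z n ε n′ ε′} → Location z n ε → Location z n′ ε′ → (n , ε) ≡ (n′ , ε′)
location-unique {z} {n} {ε} {n′} {ε′} L L′ = signs ε ε′ L L′
  where
  integers : ∀ ε → Location z n ε → Location z n′ ε → (n , ε) ≡ (n′ , ε)
  integers ε L L′ = cong (_, ε) (offset-injective ε L.offset L′.offset n n′ L.offset≡ L′.offset≡
    (fromℚʳ-injective (≈ʳ-trans (≈ʳ-sym L.re≈) L′.re≈)))
    where
    module L = Location L
    module L′ = Location L′
  opposite : Location z n Sign.+ → Location z n′ Sign.- → Empty.⊥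
  opposite L L′ = positive≉-nonNegative L.height L′.height L.positive
    (positive⇒nonNegative {L′.height} L′.positive) (≈ʳ-trans (≈ʳ-sym L.im≈) L′.im≈)
    where
    module L = Location L
    module L′ = Location L′
  opposite′ : Location z n Sign.- → Location z n′ Sign.+ → Empty.⊥
  opposite′ L L′ = positive≉-nonNegative L′.height L.height L′.positive
    (positive⇒nonNegative {L.height} L.positive) (≈ʳ-trans (≈ʳ-sym L′.im≈) L.im≈)
    where
    module L = Location L
    module L′ = Location L′
  signs : ∀ ε ε′ → Location z n ε → Location z n′ ε′ → (n , ε) ≡ (n′ , ε′)
  signs Sign.+ Sign.+ L L′ = integers Sign.+ L L′
  signs Sign.- Sign.- L L′ = integers Sign.- L L′
  signs Sign.+ Sign.- L L′ = Empty.⊥-elim (opposite L L′)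
  signs Sign.- Sign.+ L L′ = Empty.⊥-elim (opposite′ L L′)

location⇒∉Real : ∀ {z n ε} → Location z n ε → z ∉ Real
location⇒∉Real {z} {n} {ε} L real = signs ε L.im≈
  where
  module L = Location L
  signs : ∀ ε → im z ≈ʳ signedʳ ε L.height → Empty.⊥
  signs Sign.+ eq = positive≉-nonNegative L.height 0ʳ L.positive (λ _ → ℚₚ.≤-refl)
    (≈ʳ-trans (≈ʳ-sym eq) (≈ʳ-trans real (≈ʳ-≡ λ _ → refl)))
  signs Sign.- eq = positive≉-nonNegative L.height 0ʳ L.positive (λ _ → ℚₚ.≤-refl)
    (ℝ-Algebra.-x≃0⇒x≃-0 L.height (≈ʳ-trans (≈ʳ-sym eq) real))

-- Monic quadratic equations over ℤ under negation and translation

fromℤ-+ : ∀ a b → fromℤ (a ℤ.+ b) ≈ fromℤ a + fromℤ b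
fromℤ-+ a b = ≈-trans (fromℚ-cong (ι-+ a b)) (fromℚ-+ (ι a) (ι b))

fromℤ-* : ∀ a b → fromℤ (a ℤ.* b) ≈ fromℤ a * fromℤ b
fromℤ-* a b = ≈-trans (fromℚ-cong (ι-* a b)) (fromℚ-* (ι a) (ι b))

fromℤ-neg : ∀ a → fromℤ (ℤ.- a) ≈ - fromℤ a
fromℤ-neg a = ≈-trans (fromℚ-cong (ι-neg a)) (fromℚ-neg (ι a))

fromℤ-minus : ∀ a b → fromℤ (a ℤ.- b) ≈ fromℤ a + - fromℤ b
fromℤ-minus a b = ≈-trans (fromℤ-+ a (ℤ.- b)) (+-cong (≈-refl {fromℤ a}) (fromℤ-neg b))

root-resp : ∀ {z z′ b b′ c c′} → z ≈ z′ → b ≈ b′ → c ≈ c′ → IsRoot z b c → IsRoot z′ b′ c′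
root-resp z≈ b≈ c≈ h = ≈-trans (≈-sym (+-cong c≈ (*-cong z≈ (+-cong b≈ z≈)))) h

IntegerRoot : ℂ → Set
IntegerRoot z = ∃ λ b → ∃ λ c → IsRoot z (fromℤ b) (fromℤ c)

integerRoot-resp : ∀ {z w} → z ≈ w → IntegerRoot z → IntegerRoot w
integerRoot-resp {z} z≈w (b , c , h) = b , c , root-resp z≈w (≈-refl {fromℤ b}) (≈-refl {fromℤ c}) h

integerRoot-neg : ∀ z → IntegerRoot z → IntegerRoot (- z)
integerRoot-neg z (b , c , h) = ℤ.- b , c ,
  root-resp (≈-refl { - z}) (≈-sym (fromℤ-neg b)) (≈-refl {fromℤ c})
        (ℂ-Algebra.root-neg z (fromℤ b) (fromℤ c) h)

integerRoot-translate : ∀ z n → IntegerRoot z → IntegerRoot (z + fromℤ n)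
integerRoot-translate z n (b , c , h) = b ℤ.- (n ℤ.+ n) , ((n ℤ.* n ℤ.- b ℤ.* n) ℤ.+ c) ,
  root-resp (≈-refl {z + fromℤ n})
    (≈-sym (≈-trans (fromℤ-minus b (n ℤ.+ n)) (+-cong (≈-refl {fromℤ b}) (neg-cong (fromℤ-+ n n)))))
    (≈-sym (≈-trans (fromℤ-+ (n ℤ.* n ℤ.- b ℤ.* n) c) (+-cong
          (≈-trans (fromℤ-minus (n ℤ.* n) (b ℤ.* n)) (+-cong (fromℤ-* n n) (neg-cong (fromℤ-* b n))))
          (≈-refl {fromℤ c}))))
    (ℂ-Algebra.root-translate z (fromℤ n) (fromℤ b) (fromℤ c) h)

fromℤ-1-4* : ∀ c → fromℤ (+ 1 ℤ.- + 4 ℤ.* c) ≈ fromℚ 1ℚ + - (fromℚ ℂ-Algebra.4ℚ * fromℤ c)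
fromℤ-1-4* c = ≈-trans (fromℤ-minus (+ 1) (+ 4 ℤ.* c))
      (+-cong (≈-refl {fromℤ (+ 1)}) (neg-cong (fromℤ-* (+ 4) c)))

half-integerRoot : ∀ k → IntegerRoot (half k)
half-integerRoot k = ℤ.- + 1 , + suc k ,
  root-resp (≈-refl {half k}) (≈-sym (fromℤ-neg (+ 1))) (≈-refl {fromℤ (+ suc k)})
    (ℂ-Algebra.half-root (√ d) (fromℤ (+ suc k)) (fromℤ d) (√-square d)
      (≈-trans (fromℚ-cong (cong ι (sym (1-4[1+k] k)))) (fromℤ-1-4* (+ suc k))))
  where
  d : ℤ
  d = -[1+ 2 ℕ.+ 4 ℕ.* k ]

pure-integerRoot : ∀ s d → s * s ≈ fromℤ (ℤ.- d) → IntegerRoot s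
pure-integerRoot s d h = + 0 , d , ℂ-Algebra.pure-root s (fromℤ d) (fromℤ (ℤ.- d)) h (fromℤ-neg d)

m𝕚-square : ∀ m → (fromℤ m * 𝕚) * (fromℤ m * 𝕚) ≈ fromℤ (ℤ.- (m ℤ.* m))
m𝕚-square m = ≈-trans (ℂ-Algebra.square-product {fromℤ m} {𝕚} (≈-sym (fromℤ-* m m)) 𝕚-square)
  (≈-trans (≈-sym (fromℤ-* (m ℤ.* m) (ℤ.- + 1))) (fromℚ-cong
        (cong ι (trans (ℤₚ.*-comm (m ℤ.* m) (ℤ.- + 1)) (ℤₚ.-1*i≡-i (m ℤ.* m))))))

Ŝ-integerRoot : ∀ z → z ∈ Ŝ → IntegerRoot z
Ŝ-integerRoot z (inj₁ z∈S) = from (proj₂ (S-elements z z∈S))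
  where
  from : (∃ λ k → z ≈ half k) ⊎ (∃ λ k → NonSquare (suc k) × z ≈ √ -[1+ k ]) → IntegerRoot z
  from (inj₁ (k , eq))     = integerRoot-resp (≈-sym eq) (half-integerRoot k)
  from (inj₂ (k , _ , eq)) = integerRoot-resp (≈-sym eq)
        (pure-integerRoot (√ -[1+ k ]) (+ suc k) (√-square -[1+ k ]))
Ŝ-integerRoot z (inj₂ (m , _ , eq)) =
  integerRoot-resp (≈-sym eq) (pure-integerRoot (fromℤ m * 𝕚) (m ℤ.* m) (m𝕚-square m))

translates-integerRoot : ∀ z n ε → z ∈ ε • Ŝ ⊕ n → IntegerRoot z
translates-integerRoot z n Sign.+ (α , α∈Ŝ , eq) =
  integerRoot-resp (≈-sym eq) (integerRoot-translate α n (Ŝ-integerRoot α α∈Ŝ))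
translates-integerRoot z n Sign.- (β , (α , α∈Ŝ , eq′) , eq) =
  integerRoot-resp (≈-sym eq) (integerRoot-translate β n
    (integerRoot-resp (≈-sym eq′) (integerRoot-neg α (Ŝ-integerRoot α α∈Ŝ))))

Ŝ-translates-quadratic : ∀ z n ε → z ∈ ε • Ŝ ⊕ n → z ∈ QuadraticInteger ∩ ℂ∖ℝ
Ŝ-translates-quadratic z n ε z∈ =
  let b , c , h = translates-integerRoot z n ε z∈
      z∉ℝ = location⇒∉Real (location z n ε z∈)
  in integer-root⇒quadraticInteger b c z z∉ℝ h , z∉ℝ

Real-resp : ∀ {z w} → z ≈ w → Real z → Real w
Real-resp z≈w h = ≈ʳ-trans (≈ʳ-sym (im-≈ z≈w)) h

Real-+ : ∀ z w → Real z → Real w → Real (z + w)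
Real-+ z w h k = ≈ʳ-trans (+ʳ-cong h k) (≈ʳ-≡ λ _ → refl)

Real-neg : ∀ z → Real z → Real (- z)
Real-neg z h = ≈ʳ-trans (-ʳ-cong h) (≈ʳ-≡ λ _ → refl)

Real-fromℚ : ∀ q → Real (fromℚ q)
Real-fromℚ q = ≈ʳ-refl

Real-* : ∀ z w → Real z → Real w → Real (z * w)
Real-* z w h k = ≈ʳ-trans (+ʳ-cong (*ʳ-cong (≈ʳ-refl {re z}) k) (*ʳ-cong h (≈ʳ-refl {re w})))
      (ℝ-Algebra.[x+0i][y+0i]-im (re z) (re w))

-- Decomposition of integral roots into translates

ImaginaryIntegers : Pred ℂ 0ℓ
ImaginaryIntegers z = ∃ λ (n : ℤ) → + 0 ℤ.< n × z ≈ fromℤ n * 𝕚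

signed : ∀ {A : Pred ℂ 0ℓ} {α w} → α ∈ A → w ≈ α ⊎ w ≈ - α →
      (∀ {z z′} → z ≈ z′ → z ∈ A → z′ ∈ A) → ∃ λ ε → w ∈ ε • A
signed {α = α} α∈A (inj₁ eq) A-resp = Sign.+ , A-resp (≈-sym eq) α∈A
signed {α = α} α∈A (inj₂ eq) _ = Sign.- , α , α∈A , eq

S-resp : ∀ {z w} → z ≈ w → z ∈ S → w ∈ S
S-resp z≈w (n , 1≤n , z∉ℝ , c , inj₁ (p , q , r , eq)) =
  n , 1≤n , z∉ℝ ∘ Real-resp (≈-sym z≈w) , c , inj₁ (p , q , r , ≈-trans (≈-sym z≈w) eq)
S-resp z≈w (n , 1≤n , z∉ℝ , c , inj₂ (p , q , r , eq)) =
  n , 1≤n , z∉ℝ ∘ Real-resp (≈-sym z≈w) , c , inj₂ (p , q , r , ≈-trans (≈-sym z≈w) eq)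

imaginaryIntegers-resp : ∀ {z w} → z ≈ w → z ∈ ImaginaryIntegers → w ∈ ImaginaryIntegers
imaginaryIntegers-resp z≈w (n , 0<n , eq) = n , 0<n , ≈-trans (≈-sym z≈w) eq

∉Real-± : ∀ {w α} → w ≈ α ⊎ w ≈ - α → w ∉ Real → α ∉ Real
∉Real-± (inj₁ eq) w∉ℝ h = w∉ℝ (Real-resp (≈-sym eq) h)
∉Real-± {w} {α} (inj₂ eq) w∉ℝ h = w∉ℝ (Real-resp (≈-sym eq) (Real-neg α h))

square? : ∀ n → (∃ λ m → m ℕ.* m ≡ n) ⊎ NonSquare n
square? n with isqrt n ℕ.* isqrt n ℕₚ.≟ n
... | yes eq = inj₁ (isqrt n , eq)
... | no neq = inj₂ (between-squares⇒nonSquare (isqrt n) n (ℕₚ.≤∧≢⇒< (isqrt-lower n) neq) (isqrt-upper n))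

-- Here `S` parts from the integer multiples of 𝕚, by whether k + 1 is a perfect square.
negative-roots : ∀ k w → w ∉ Real → w * w ≈ fromℤ -[1+ k ] →
  ∃ λ ε → w ∈ ε • S ⊎ w ∈ ε • ImaginaryIntegers
negative-roots k w w∉ℝ h = from (square? (suc k))
  where
  from : (∃ λ m → m ℕ.* m ≡ suc k) ⊎ NonSquare (suc k) → ∃ λ ε → w ∈ ε • S ⊎ w ∈ ε • ImaginaryIntegers
  from (inj₁ (suc m , eq)) =
    let roots = integer-roots m w (≈-trans h (fromℚ-cong (cong (λ j → ι (ℤ.- + j)) (sym eq))))
        ε , w∈ = signed {ImaginaryIntegers} (+ suc m , ℤ.+<+
              (ℕ.s≤s ℕ.z≤n) , ≈-refl) roots imaginaryIntegers-resp
    in ε , inj₂ w∈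
  from (inj₂ nonSquare) =
    let roots = √-roots k w h
        ε , w∈ = signed {S} (√∈S k (√ -[1+ k ]) (∉Real-± roots w∉ℝ) nonSquare ≈-refl) roots S-resp
    in ε , inj₁ w∈

parity : ∀ b → ∃ λ n → b ≡ n ℤ.+ n ⊎ b ≡ n ℤ.+ n ℤ.+ + 1
parity b = b ℤDivMod./ℕ 2 , remainder (b ℤDivMod.%ℕ 2) (ℤDivMod.n%ℕd<d b 2) (ℤDivMod.a≡a%ℕn+[a/ℕn]*n b 2)
  where
  n : ℤ
  n = b ℤDivMod./ℕ 2
  2n : n ℤ.* + 2 ≡ n ℤ.+ n
  2n = trans (ℤₚ.*-comm n (+ 2)) (trans (ℤₚ.suc-* (+ 1) n) (cong (λ m → n ℤ.+ m) (ℤₚ.*-identityˡ n)))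
  remainder : ∀ r → r ℕ.< 2 → b ≡ + r ℤ.+ n ℤ.* + 2 → b ≡ n ℤ.+ n ⊎ b ≡ n ℤ.+ n ℤ.+ + 1
  remainder 0 _ eq = inj₁ (trans eq (trans (ℤₚ.+-identityˡ (n ℤ.* + 2)) 2n))
  remainder 1 _ eq = inj₂ (trans eq (trans (ℤₚ.+-comm (+ 1) (n ℤ.* + 2)) (cong (ℤ._+ + 1) 2n)))
  remainder (suc (suc _)) (ℕ.s≤s (ℕ.s≤s ())) _

InTranslate : Pred ℂ 0ℓ → ℂ → Set
InTranslate A z = ∃ λ ((n , ε) : ℤ × Sign) → z ∈ ε • A ⊕ n

even-case : ∀ z n c → z ∉ Real → IsRoot z (fromℤ (n ℤ.+ n)) (fromℤ c) →
  InTranslate S z ⊎ InTranslate ImaginaryIntegers z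
even-case z n c z∉ℝ h = from (n ℤ.* n ℤ.- c)
  (≈-trans (ℂ-Algebra.complete-square-even z (fromℤ n) (fromℤ (n ℤ.+ n)) (fromℤ c) (fromℤ-+ n n) h)
    (≈-sym (≈-trans (fromℤ-minus (n ℤ.* n) c) (+-cong (fromℤ-* n n) (≈-refl { - fromℤ c})))))
  where
  w : ℂ
  w = z + fromℤ n
  z≈ : z ≈ w + - fromℤ n
  z≈ = ℂ-Algebra.shift-back z (fromℤ n) w ≈-refl
  w∉ℝ : w ∉ Real
  w∉ℝ real = z∉ℝ (Real-resp (≈-sym z≈) (Real-+ w (- fromℤ n) real (Real-neg (fromℤ n) (Real-fromℚ (ι n)))))
  translate : ∀ {A : Pred ℂ 0ℓ} ε → w ∈ ε • A → InTranslate A z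
  translate ε w∈ = (ℤ.- n , ε) , w , w∈ , ≈-trans z≈ (+-cong (≈-refl {w}) (≈-sym (fromℤ-neg n)))
  from : ∀ d → w * w ≈ fromℤ d → InTranslate S z ⊎ InTranslate ImaginaryIntegers z
  from (+ m) sq = contradiction (nonneg-square⇒Real m w sq) w∉ℝ
  from -[1+ k ] sq = let ε , w∈ = negative-roots k w w∉ℝ sq in
    Sum.map (translate {S} ε) (translate {ImaginaryIntegers} ε) w∈

-- For w = 2z + 2n + 1, w² = 1 + 4e with e = n² + n - c. A negative e = -(k + 1) gives -(3 + 4k),
-- the radicand of `half k`, so only `S` occurs.
odd-case : ∀ z n c → z ∉ Real → IsRoot z (fromℤ (n ℤ.+ n ℤ.+ + 1)) (fromℤ c) → InTranslate S z
odd-case z n c z∉ℝ h = from (n ℤ.* n ℤ.+ n ℤ.- c)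
  (≈-trans (ℂ-Algebra.complete-square-odd z (fromℤ n) (fromℤ (n ℤ.+ n ℤ.+ + 1)) (fromℤ c)
      (≈-trans (fromℤ-+ (n ℤ.+ n) (+ 1)) (+-cong (fromℤ-+ n n) (≈-refl {1ᶜ}))) h)
    (+-cong (≈-refl {1ᶜ}) (*-cong (≈-refl {fromℤ (+ 4)}) (≈-sym (≈-trans (fromℤ-minus (n ℤ.* n ℤ.+ n) c)
      (+-cong (≈-trans (fromℤ-+ (n ℤ.* n) n) (+-cong (fromℤ-* n n) (≈-refl {fromℤ n})))
            (≈-refl { - fromℤ c})))))))
  where
  N w : ℂ
  N = fromℤ n
  w = (z + z) + ((N + N) + 1ᶜ)
  shifted-∉Real : ∀ α → z ≈ α + - (N + 1ᶜ) → α ∉ Real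
  shifted-∉Real α eq real = z∉ℝ (Real-resp (≈-sym eq)
    (Real-+ α (- (N + 1ᶜ)) real (Real-neg (N + 1ᶜ) (Real-+ N 1ᶜ (Real-fromℚ (ι n)) (Real-fromℚ 1ℚ)))))
  shifted-∉Real-neg : ∀ α → z ≈ - α + - N → α ∉ Real
  shifted-∉Real-neg α eq real = z∉ℝ (Real-resp (≈-sym eq)
    (Real-+ (- α) (- N) (Real-neg α real) (Real-neg N (Real-fromℚ (ι n)))))
  w∉ℝ : w ∉ Real
  w∉ℝ real = shifted-∉Real (fromℚ ½ * (1ᶜ + w)) (ℂ-Algebra.shift-back-half z N w ≈-refl)
    (Real-* (fromℚ ½) (1ᶜ + w) (Real-fromℚ ½) (Real-+ 1ᶜ w (Real-fromℚ 1ℚ) real))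
  from : ∀ e → w * w ≈ 1ᶜ + fromℤ (+ 4) * fromℤ e → InTranslate S z
  from (+ m) sq = contradiction (nonneg-square⇒Real (1 ℕ.+ 4 ℕ.* m) w
    (≈-trans sq (≈-sym (≈-trans (fromℤ-+ (+ 1) (+ (4 ℕ.* m)))
      (+-cong (≈-refl {1ᶜ}) (≈-trans (fromℚ-cong (ιℕ-* 4 m)) (fromℚ-* (ιℕ 4) (ιℕ m)))))))) w∉ℝ
  from -[1+ k ] sq = select (√-roots (2 ℕ.+ 4 ℕ.* k) w
    (≈-trans sq (≈-trans (≈-sym (≈-trans (fromℤ-+ (+ 1) (+ 4 ℤ.* -[1+ k ]))
          (+-cong (≈-refl {1ᶜ}) (fromℤ-* (+ 4) -[1+ k ]))))
      (fromℚ-cong (cong ι (trans (cong (λ m → + 1 ℤ.+ m) (sym (ℤₚ.neg-distribʳ-* (+ 4) (+ suc k))))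
            (1-4[1+k] k)))))))
    where
    s : ℂ
    s = √ -[1+ 2 ℕ.+ 4 ℕ.* k ]
    select : w ≈ s ⊎ w ≈ - s → InTranslate S z
    -- z = (w - (2n + 1))/2 is (1 + s)/2 - (n + 1) for w = s and -(1 + s)/2 - n for w = -s. Negating
    -- `half k` also negates its real part ½, so the two translates differ by 1.
    select (inj₁ w≈s) = let z≈ = ℂ-Algebra.shift-back-half z N s w≈s in
      (ℤ.- (n ℤ.+ + 1) , Sign.+) , half k , half∈S k (half k) (shifted-∉Real (half k) z≈) ≈-refl
      , ≈-trans z≈ (+-cong (≈-refl {half k}) (≈-sym (≈-trans (fromℤ-neg (n ℤ.+ + 1))
            (neg-cong (fromℤ-+ n (+ 1))))))
    select (inj₂ w≈-s) = let z≈ = ℂ-Algebra.shift-back-half-neg z N s w≈-s in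
      (ℤ.- n , Sign.-) , - half k , (half k , half∈S k (half k)
            (shifted-∉Real-neg (half k) z≈) ≈-refl , ≈-refl)
      , ≈-trans z≈ (+-cong (≈-refl { - half k}) (≈-sym (fromℤ-neg n)))

decomposition : ∀ z → z ∉ Real → IntegerRoot z → InTranslate S z ⊎ InTranslate ImaginaryIntegers z
decomposition z z∉ℝ (b , c , h) = from (parity b)
  where
  from : (∃ λ n → b ≡ n ℤ.+ n ⊎ b ≡ n ℤ.+ n ℤ.+ + 1) → InTranslate S z ⊎ InTranslate ImaginaryIntegers z
  from (n , inj₁ eq) = even-case z n c z∉ℝ (subst (λ b → IsRoot z (fromℤ b) (fromℤ c)) eq h)
  from (n , inj₂ eq) = inj₁ (odd-case z n c z∉ℝ (subst (λ b → IsRoot z (fromℤ b) (fromℤ c)) eq h))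

translate-mono : ∀ {A B : Pred ℂ 0ℓ} → A ⊆ B → ∀ ε n → ε • A ⊕ n ⊆ ε • B ⊕ n
translate-mono A⊆B Sign.+ n (α , α∈A , eq) = α , A⊆B α∈A , eq
translate-mono A⊆B Sign.- n (β , (α , α∈A , eq′) , eq) = β , (α , A⊆B α∈A , eq′) , eq

-- Subfields

ℚ⟨⟩-isSubfield : ∀ α → IsSubfield ℚ⟨ α ⟩
ℚ⟨⟩-isSubfield α = record
  { resp = ℚ⟨_⟩.resp ; one = rat 1ℚ ; add = ℚ⟨_⟩.add ; neg = ℚ⟨_⟩.neg ; mul = ℚ⟨_⟩.mul ; inv = ℚ⟨_⟩.inv }

module _ {ℓ : Level} {K : Pred ℂ ℓ} (isSubfield : IsSubfield K) where
  private module K = IsSubfield isSubfield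

  ℕ∈subfield : ∀ n → fromℚ (ιℕ n) ∈ K
  -- `IsSubfield` provides 1, and 0 arises as 1 - 1.
  ℕ∈subfield zero    = K.resp (≈-trans (≈-sym (fromℤ-neg-+ 1ℚ)) (fromℚ-cong (ℚₚ.+-inverseʳ 1ℚ)))
        (K.add K.one (K.neg K.one))
    where
    fromℤ-neg-+ : ∀ q → fromℚ (q ℚ.- q) ≈ fromℚ q + - fromℚ q
    fromℤ-neg-+ q = ≈-trans (fromℚ-+ q (ℚ.- q)) (+-cong (≈-refl {fromℚ q}) (fromℚ-neg q))
  ℕ∈subfield (suc n) = K.resp (≈-sym (≈-trans (fromℚ-cong (ιℕ-+ 1 n)) (fromℚ-+ 1ℚ (ιℕ n))))
        (K.add K.one (ℕ∈subfield n))

  ℤ∈subfield : ∀ k → fromℤ k ∈ K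
  ℤ∈subfield (+ n)    = ℕ∈subfield n
  ℤ∈subfield -[1+ n ] = K.resp (≈-sym (fromℤ-neg (+ suc n))) (K.neg (ℕ∈subfield (suc n)))

  ℚ∈subfield : ∀ q → fromℚ q ∈ K
  ℚ∈subfield q = let s , ds≡1 = ι-reciprocal (ℚ.denominator-1 q) in
    K.resp (≈-trans (≈-sym (fromℚ-* (ι (ℚ.↥ q)) s)) (fromℚ-cong (trans (cong (ℚ._* s) (sym (q*↧q≡↥q q)))
        (trans (ℚₚ.*-assoc q (ιℕ (↧ₙ q)) s) (trans (cong (q ℚ.*_) ds≡1) (ℚₚ.*-identityʳ q))))))
      (K.mul (ℤ∈subfield (ℚ.↥ q))
        (K.inv (ℕ∈subfield (↧ₙ q)) (≈-trans (≈-sym (fromℚ-* (ιℕ (↧ₙ q)) s)) (fromℚ-cong ds≡1))))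

  ℚ⟨⟩⊆subfield : ∀ {α} → α ∈ K → ℚ⟨ α ⟩ ⊆ K
  ℚ⟨⟩⊆subfield α∈K gen        = α∈K
  ℚ⟨⟩⊆subfield α∈K (rat q)    = ℚ∈subfield q
  ℚ⟨⟩⊆subfield α∈K (resp e x) = K.resp e (ℚ⟨⟩⊆subfield α∈K x)
  ℚ⟨⟩⊆subfield α∈K (add x y)  = K.add (ℚ⟨⟩⊆subfield α∈K x) (ℚ⟨⟩⊆subfield α∈K y)
  ℚ⟨⟩⊆subfield α∈K (neg x)    = K.neg (ℚ⟨⟩⊆subfield α∈K x)
  ℚ⟨⟩⊆subfield α∈K (mul x y)  = K.mul (ℚ⟨⟩⊆subfield α∈K x) (ℚ⟨⟩⊆subfield α∈K y)
  ℚ⟨⟩⊆subfield α∈K (inv x e)  = K.inv (ℚ⟨⟩⊆subfield α∈K x) e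

-- The field ℚ(𝕚)

gaussian : ℚ → ℚ → ℂ
gaussian q r = fromℚʳ q +i fromℚʳ r

gaussian-* : ∀ q r q′ r′ → gaussian q r * gaussian q′ r′ ≈ gaussian (q ℚ.* q′ ℚ.- r ℚ.* r′)
      (q ℚ.* r′ ℚ.+ r ℚ.* q′)
gaussian-* q r q′ r′ = mk≈ (≈ʳ-≡ λ _ → refl) (≈ʳ-≡ λ _ → refl)

gaussian-cong : ∀ {q q′ r r′} → q ≡ q′ → r ≡ r′ → gaussian q r ≈ gaussian q′ r′
gaussian-cong refl refl = ≈-refl

q²+r²≡0⇒q≡0 : ∀ q r → q ℚ.* q ℚ.+ r ℚ.* r ≡ 0ℚ → q ≡ 0ℚ
q²+r²≡0⇒q≡0 q r eq = fromℚʳ-injective (x²+y²≈0⇒x≈0 (fromℚʳ q) (fromℚʳ r) (≈ʳ-≡ λ _ → eq))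

IsGaussian : Pred ℂ 0ℓ
IsGaussian z = ∃ λ q → ∃ λ r → z ≈ gaussian q r

-- The norm q² + r² is rational, so its vanishing is decidable; otherwise the inverse is the
-- conjugate divided by the norm.
gaussian-inverse : ∀ q r w → gaussian q r * w ≈ 1ᶜ → IsGaussian w
gaussian-inverse q r w h = from (q ℚ.* q ℚ.+ r ℚ.* r ℚₚ.≟ 0ℚ)
  where
  n : ℚ
  n = q ℚ.* q ℚ.+ r ℚ.* r
  from : Dec (n ≡ 0ℚ) → IsGaussian w
  from (yes n≡0) = contradiction (≈-trans (≈-sym h) (≈-trans (*-cong g≈0 (≈-refl {w}))
        (ℂ-Algebra.zero-product w))) 1ᶜ≉0ᶜ
    where
    g≈0 : gaussian q r ≈ 0ᶜ
    g≈0 = gaussian-cong (q²+r²≡0⇒q≡0 q r n≡0) (q²+r²≡0⇒q≡0 r q (trans (ℚₚ.+-comm (r ℚ.* r) (q ℚ.* q)) n≡0))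
  -- The summands with 0ℚ come from the product (s + 0𝕚)(q - r𝕚).
  from (no n≢0) = s ℚ.* q ℚ.- 0ℚ ℚ.* (ℚ.- r) , s ℚ.* (ℚ.- r) ℚ.+ 0ℚ ℚ.* q ,
    ≈-trans (ℂ-Algebra.inverse-conjugate (gaussian q r) (gaussian q (ℚ.- r)) w (fromℚ n) (fromℚ s) conjugate
      (≈-trans (≈-sym (fromℚ-* n s)) (fromℚ-cong (ℚₚ.*-inverseʳ n))) h)
      (gaussian-* s 0ℚ q (ℚ.- r))
    where
    instance
      _ : ℚ.NonZero n
      _ = ℚ.≢-nonZero n≢0
    s : ℚ
    s = 1/ n
    open ℚSolver.+-*-Solver
    eq-re : ∀ q r → q ℚ.* q ℚ.- r ℚ.* (ℚ.- r) ≡ q ℚ.* q ℚ.+ r ℚ.* r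
    eq-re = solve 2 (λ q r → q :* q :- r :* (:- r) := q :* q :+ r :* r) refl
    eq-im : ∀ q r → q ℚ.* (ℚ.- r) ℚ.+ r ℚ.* q ≡ 0ℚ
    eq-im = solve 2 (λ q r → q :* (:- r) :+ r :* q := con 0ℚ) refl
    conjugate : gaussian q r * gaussian q (ℚ.- r) ≈ fromℚ n
    conjugate = ≈-trans (gaussian-* q r q (ℚ.- r)) (gaussian-cong (eq-re q r) (eq-im q r))

-- ℚ + ℚ𝕚 is closed under every rule generating `ℚ⟨ 𝕚 ⟩`. The resulting coordinates are what make
-- non-membership provable.
ℚ⟨𝕚⟩⇒gaussian : ∀ {z} → z ∈ ℚ⟨ 𝕚 ⟩ → IsGaussian z
ℚ⟨𝕚⟩⇒gaussian gen     = 0ℚ , 1ℚ , ≈-refl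
ℚ⟨𝕚⟩⇒gaussian (rat q) = q , 0ℚ , ≈-refl
ℚ⟨𝕚⟩⇒gaussian (resp e x) = let q , r , h = ℚ⟨𝕚⟩⇒gaussian x in q , r , ≈-trans (≈-sym e) h
ℚ⟨𝕚⟩⇒gaussian (add x y) = let q , r , h = ℚ⟨𝕚⟩⇒gaussian x ; q′ , r′ , h′ = ℚ⟨𝕚⟩⇒gaussian y in
  q ℚ.+ q′ , r ℚ.+ r′ , ≈-trans (+-cong h h′) (mk≈ (≈ʳ-≡ λ _ → refl) (≈ʳ-≡ λ _ → refl))
ℚ⟨𝕚⟩⇒gaussian (neg x) = let q , r , h = ℚ⟨𝕚⟩⇒gaussian x in
  ℚ.- q , ℚ.- r , ≈-trans (neg-cong h) (mk≈ (≈ʳ-≡ λ _ → refl) (≈ʳ-≡ λ _ → refl))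
ℚ⟨𝕚⟩⇒gaussian (mul x y) = let q , r , h = ℚ⟨𝕚⟩⇒gaussian x ; q′ , r′ , h′ = ℚ⟨𝕚⟩⇒gaussian y in
  _ , _ , ≈-trans (*-cong h h′) (gaussian-* q r q′ r′)
ℚ⟨𝕚⟩⇒gaussian (inv {z} {w} x e) = let q , r , h = ℚ⟨𝕚⟩⇒gaussian x in
  gaussian-inverse q r w (≈-trans (*-cong (≈-sym h) (≈-refl {w})) e)

q*r≡0⇒q≡0⊎r≡0 : ∀ q r → q ℚ.* r ℚ.+ r ℚ.* q ≡ 0ℚ → q ≡ 0ℚ ⊎ r ≡ 0ℚ
q*r≡0⇒q≡0⊎r≡0 q r eq with q ℚₚ.≟ 0ℚ
... | yes q≡0 = inj₁ q≡0
... | no q≢0 = inj₂ (begin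
  r                                                 ≡⟨ sym (ℚₚ.*-identityˡ r) ⟩
  1ℚ ℚ.* r                                          ≡⟨ cong (ℚ._* r) (sym (ℚₚ.*-inverseˡ q)) ⟩
  (1/ q) ℚ.* q ℚ.* r                                ≡⟨ identity (1/ q) q r ⟩
  ½ ℚ.* (1/ q) ℚ.* (q ℚ.* r ℚ.+ r ℚ.* q)            ≡⟨ cong ((½ ℚ.* (1/ q)) ℚ.*_) eq ⟩
  ½ ℚ.* (1/ q) ℚ.* 0ℚ                               ≡⟨ ℚₚ.*-zeroʳ (½ ℚ.* (1/ q)) ⟩
  0ℚ ∎)
  where
  open ≡-Reasoning
  open ℚSolver.+-*-Solver
  instance
    _ : ℚ.NonZero q
    _ = ℚ.≢-nonZero q≢0
  identity : ∀ s q r → s ℚ.* q ℚ.* r ≡ ½ ℚ.* s ℚ.* (q ℚ.* r ℚ.+ r ℚ.* q)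
  identity = solve 3 (λ s q r → s :* q :* r := con ½ :* s :* (q :* r :+ r :* q)) refl

-- If r = 0, the rational square q² would be negative. If q = 0, then r² = k + 1, so the rational r
-- is an integer and k + 1 a square.
gaussian-square : ∀ q r k → q ℚ.* q ℚ.- r ℚ.* r ≡ ι -[1+ k ] → q ≡ 0ℚ ⊎ r ≡ 0ℚ → ¬ NonSquare (suc k)
gaussian-square q .0ℚ k eq (inj₂ refl) _ =
  ℚₚ.<-irrefl refl (ℚₚ.≤-<-trans (square-nonNeg q) (subst (ℚ._< 0ℚ) (trans (sym eq) (identity q))
        (ι-mono-< { -[1+ k ]} {+ 0} ℤ.-<+)))
  where
  open ℚSolver.+-*-Solver
  identity : ∀ q → q ℚ.* q ℚ.- 0ℚ ℚ.* 0ℚ ≡ q ℚ.* q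
  identity = solve 1 (λ q → q :* q :- con 0ℚ :* con 0ℚ := q :* q) refl
gaussian-square .0ℚ r k eq (inj₁ refl) nonSquare = square (integral-square⇒integral r (+ suc k) r²≡)
  where
  open ℚSolver.+-*-Solver
  identity : ∀ r → ℚ.- (0ℚ ℚ.* 0ℚ ℚ.- r ℚ.* r) ≡ r ℚ.* r
  identity = solve 1 (λ r → :- (con 0ℚ :* con 0ℚ :- r :* r) := r :* r) refl
  r²≡ : r ℚ.* r ≡ ι (+ suc k)
  r²≡ = trans (sym (identity r)) (trans (cong ℚ.-_ eq) (sym (ι-neg -[1+ k ])))
  square : Integral r → Empty.⊥
  square (m , refl) = nonSquare ℤ.∣ m ∣ (trans (sym (ℤₚ.abs-* m m))
    (cong ℤ.∣_∣ (ι-injective {m ℤ.* m} {+ suc k} (trans (ι-* m m) r²≡))))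

√∉ℚ⟨𝕚⟩ : ∀ k → NonSquare (suc k) → √ -[1+ k ] ∉ ℚ⟨ 𝕚 ⟩
√∉ℚ⟨𝕚⟩ k nonSquare √∈ = from (ℚ⟨𝕚⟩⇒gaussian √∈)
  where
  from : IsGaussian (√ -[1+ k ]) → Empty.⊥
  from (q , r , h) = gaussian-square q r k (fromℚʳ-injective (re-≈ sq))
        (q*r≡0⇒q≡0⊎r≡0 q r (fromℚʳ-injective (im-≈ sq))) nonSquare
    where
    sq : gaussian (q ℚ.* q ℚ.- r ℚ.* r) (q ℚ.* r ℚ.+ r ℚ.* q) ≈ fromℤ -[1+ k ]
    sq = ≈-trans (≈-sym (gaussian-* q r q r)) (≈-trans (≈-sym (*-cong h h)) (√-square -[1+ k ]))

-- Squares are 0 or 1 modulo 4: otherwise 3 + 4k or 2 + 4k would be a multiple of 4.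
m²≢3+4k : ∀ k → NonSquare (suc (2 ℕ.+ 4 ℕ.* k))
m²≢3+4k k m eq = from (parityℕ m)
  where
  open ℕSolver.+-*-Solver
  parityℕ : ∀ m → ∃ λ t → m ≡ t ℕ.+ t ⊎ m ≡ suc (t ℕ.+ t)
  parityℕ zero = 0 , inj₁ refl
  parityℕ (suc m) = next (parityℕ m)
    where
    next : (∃ λ t → m ≡ t ℕ.+ t ⊎ m ≡ suc (t ℕ.+ t)) → ∃ λ t → suc m ≡ t ℕ.+ t ⊎ suc m ≡ suc (t ℕ.+ t)
    next (t , inj₁ e) = t , inj₂ (cong suc e)
    next (t , inj₂ e) = suc t , inj₁ (trans (cong suc e) (cong suc (sym (ℕₚ.+-suc t t))))
  even : ∀ t → (t ℕ.+ t) ℕ.* (t ℕ.+ t) ≡ 4 ℕ.* (t ℕ.* t)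
  even = solve 1 (λ t → (t :+ t) :* (t :+ t) := con 4 :* (t :* t)) refl
  odd : ∀ t → suc (t ℕ.+ t) ℕ.* suc (t ℕ.+ t) ≡ 1 ℕ.+ 4 ℕ.* (t ℕ.* t ℕ.+ t)
  odd = solve 1 (λ t → (con 1 :+ (t :+ t)) :* (con 1 :+ (t :+ t)) := con 1 :+ con 4 :* (t :* t :+ t)) refl
  4∤ : ∀ r x → suc r ℕ.< 4 → suc r ℕ.+ 4 ℕ.* k ≢ 4 ℕ.* x
  4∤ r x r<4 e = ℕₚ.<⇒≱ r<4 (∣⇒≤ (∣m+n∣m⇒∣n (subst (4 ∣_)
        (trans (sym e) (ℕₚ.+-comm (suc r) (4 ℕ.* k))) (m∣m*n x)) (m∣m*n k)))
  from : (∃ λ t → m ≡ t ℕ.+ t ⊎ m ≡ suc (t ℕ.+ t)) → Empty.⊥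
  from (t , inj₁ refl) = 4∤ 2 (t ℕ.* t) (ℕₚ.≤-refl) (trans (sym eq) (even t))
  from (t , inj₂ refl) = 4∤ 1 (t ℕ.* t ℕ.+ t) (ℕ.s≤s (ℕ.s≤s (ℕ.s≤s ℕ.z≤n)))
        (cong ℕ.pred (trans (sym eq) (odd t)))

S∩ℚ⟨𝕚⟩≡∅ : ∀ {z} → z ∈ S → z ∉ ℚ⟨ 𝕚 ⟩
S∩ℚ⟨𝕚⟩≡∅ {z} z∈S z∈ℚ⟨𝕚⟩ = from (proj₂ (S-elements z z∈S))
  where
  from : (∃ λ k → z ≈ half k) ⊎ (∃ λ k → NonSquare (suc k) × z ≈ √ -[1+ k ]) → Empty.⊥
  -- The map α ↦ 2α - 1 recovers the square root from `half k`.
  from (inj₁ (k , eq)) = √∉ℚ⟨𝕚⟩ (2 ℕ.+ 4 ℕ.* k) (m²≢3+4k k)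
    (resp (ℂ-Algebra.double-minus-one (√ -[1+ 2 ℕ.+ 4 ℕ.* k ]))
      (add (add (resp eq z∈ℚ⟨𝕚⟩) (resp eq z∈ℚ⟨𝕚⟩)) (neg (rat 1ℚ))))
  from (inj₂ (k , nonSquare , eq)) = √∉ℚ⟨𝕚⟩ k nonSquare (resp eq z∈ℚ⟨𝕚⟩)

S-translates∩ℚ⟨𝕚⟩≡∅ : ∀ z n ε → z ∈ ε • S ⊕ n → z ∉ ℚ⟨ 𝕚 ⟩
S-translates∩ℚ⟨𝕚⟩≡∅ z n Sign.+ (α , α∈S , eq) z∈ = S∩ℚ⟨𝕚⟩≡∅ α∈S
  (resp (≈-sym (ℂ-Algebra.shift-back α (fromℤ n) z (≈-sym eq))) (add z∈ (neg (rat (ι n)))))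
S-translates∩ℚ⟨𝕚⟩≡∅ z n Sign.- (β , (α , α∈S , eq′) , eq) z∈ = S∩ℚ⟨𝕚⟩≡∅ α∈S
  (resp (≈-sym (ℂ-Algebra.x≃-y⇒y≃-x eq′))
    (neg (resp (≈-sym (ℂ-Algebra.shift-back β (fromℤ n) z (≈-sym eq))) (add z∈ (neg (rat (ι n)))))))

imaginaryIntegers⊆ℚ⟨𝕚⟩ : ImaginaryIntegers ⊆ ℚ⟨ 𝕚 ⟩
imaginaryIntegers⊆ℚ⟨𝕚⟩ (n , _ , eq) = resp (≈-sym eq) (mul (rat (ι n)) gen)

imaginaryIntegers-translates⊆ℚ⟨𝕚⟩ : ∀ z n ε → z ∈ ε • ImaginaryIntegers ⊕ n → z ∈ ℚ⟨ 𝕚 ⟩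
imaginaryIntegers-translates⊆ℚ⟨𝕚⟩ z n Sign.+ (α , α∈ , eq) =
  resp (≈-sym eq) (add (imaginaryIntegers⊆ℚ⟨𝕚⟩ α∈) (rat (ι n)))
imaginaryIntegers-translates⊆ℚ⟨𝕚⟩ z n Sign.- (β , (α , α∈ , eq′) , eq) =
  resp (≈-sym eq) (add (resp (≈-sym eq′) (neg (imaginaryIntegers⊆ℚ⟨𝕚⟩ α∈))) (rat (ι n)))

-- The two disjoint unions

Ŝ-translates-disjoint : ∀ {i j : ℤ × Sign} → i ≢ j →
  (proj₂ i • Ŝ ⊕ proj₁ i) ⊥ (proj₂ j • Ŝ ⊕ proj₁ j)
Ŝ-translates-disjoint {n , ε} {n′ , ε′} i≢j {z} (z∈ , z∈′) =
  i≢j (location-unique (location z n ε z∈) (location z n′ ε′ z∈′))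

quadraticIntegers-decomposition : IsDisjointUnion (QuadraticInteger ∩ ℂ∖ℝ)
      (λ ((n , ε) : ℤ × Sign) → ε • Ŝ ⊕ n)
quadraticIntegers-decomposition =
  ( (λ {z} (quadratic , z∉ℝ) → join (decomposition z z∉ℝ (quadraticInteger⇒integer-root z z∉ℝ quadratic)))
  , λ {z} ((n , ε) , z∈) → Ŝ-translates-quadratic z n ε z∈ )
  , Ŝ-translates-disjoint
  where
  join : ∀ {z} → InTranslate S z ⊎ InTranslate ImaginaryIntegers z → z ∈ ⋃ (ℤ × Sign) (λ (n , ε) → ε • Ŝ ⊕ n)
  join (inj₁ ((n , ε) , z∈)) = (n , ε) , translate-mono inj₁ ε n z∈
  join (inj₂ ((n , ε) , z∈)) = (n , ε) , translate-mono inj₂ ε n z∈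

nongaussian-decomposition : IsDisjointUnion ((QuadraticInteger ∩ ℂ∖ℝ) ∖ ℚ⟨ 𝕚 ⟩)
      (λ ((n , ε) : ℤ × Sign) → ε • S ⊕ n)
nongaussian-decomposition =
  ( (λ {z} ((quadratic , z∉ℝ) , z∉ℚ⟨𝕚⟩) → exclude z∉ℚ⟨𝕚⟩
        (decomposition z z∉ℝ (quadraticInteger⇒integer-root z z∉ℝ quadratic)))
  , λ {z} ((n , ε) , z∈) → Ŝ-translates-quadratic z n ε
        (translate-mono inj₁ ε n z∈) , S-translates∩ℚ⟨𝕚⟩≡∅ z n ε z∈ )
  , λ {(n , ε)} {(n′ , ε′)} i≢j (z∈ , z∈′) →
      Ŝ-translates-disjoint i≢j (translate-mono inj₁ ε n z∈ , translate-mono inj₁ ε′ n′ z∈′)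
  where
  exclude : ∀ {z} → z ∉ ℚ⟨ 𝕚 ⟩ → InTranslate S z ⊎ InTranslate ImaginaryIntegers z → z ∈ ⋃ (ℤ × Sign)
        (λ (n , ε) → ε • S ⊕ n)
  exclude z∉ (inj₁ i) = i
  exclude {z} z∉ (inj₂ ((n , ε) , z∈)) = contradiction (imaginaryIntegers-translates⊆ℚ⟨𝕚⟩ z n ε z∈) z∉

-- Primitive elements of imaginary quadratic fields

module ImaginaryQuadraticField {ℓ : Level} (K : Pred ℂ ℓ) (isIQF : IsImaginaryQuadraticField K) where
  open IsImaginaryQuadraticField isIQF
  private
    module K = IsSubfield isSubfield
    e : Fin 2 → ℂ
    e = proj₁ quadratic
    module E = IsBasis (proj₂ quadratic)
    e₀ e₁ : ℂ
    e₀ = e zero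
    e₁ = e (suc zero)

  SpannedBy : ℂ → Set ℓ
  SpannedBy β = ∀ {z} → z ∈ K → ∃ λ u → ∃ λ v → z ≈ fromℚ u + fromℚ v * β

  private
    spanning : ∀ {z} → z ∈ K → ∃ λ q₀ → ∃ λ q₁ → z ≈ fromℚ q₀ * e₀ + (fromℚ q₁ * e₁ + 0ᶜ)
    spanning z∈K = let q , h = E.spanning z∈K in q zero , q (suc zero) , h

    eliminated : ∀ p₀ p₁ q₀ q₁ x y s → p₁ ℚ.* s ≡ 1ℚ → 1ᶜ ≈ fromℚ p₀ * x + (fromℚ p₁ * y + 0ᶜ) →
      fromℚ q₀ * x + (fromℚ q₁ * y + 0ᶜ) ≈ fromℚ (q₁ ℚ.* s) + fromℚ (q₀ ℚ.- q₁ ℚ.* s ℚ.* p₀) * x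
    eliminated p₀ p₁ q₀ q₁ x y s p₁s≡1 h = ≈-trans
      (ℂ-Algebra.eliminate (fromℚ p₀) (fromℚ p₁) (fromℚ q₀) (fromℚ q₁) x y (fromℚ s)
        (≈-trans (≈-sym (fromℚ-* p₁ s)) (fromℚ-cong p₁s≡1)) h)
      (≈-sym (+-cong (fromℚ-* q₁ s) (*-cong (≈-trans (fromℚ-+ q₀ (ℚ.- (q₁ ℚ.* s ℚ.* p₀)))
            (+-cong (≈-refl {fromℚ q₀})
        (≈-trans (fromℚ-neg (q₁ ℚ.* s ℚ.* p₀)) (neg-cong
              (≈-trans (fromℚ-* (q₁ ℚ.* s) p₀) (*-cong (fromℚ-* q₁ s) (≈-refl {fromℚ p₀})))))))
              (≈-refl {x}))))

    -- Since 1 ≠ 0, one of its coordinates in the basis e₀, e₁ is nonzero. The corresponding vector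
    -- is exchanged for 1, and the other one is β.
    choose : (∃ λ p₀ → ∃ λ p₁ → 1ᶜ ≈ fromℚ p₀ * e₀ + (fromℚ p₁ * e₁ + 0ᶜ)) → ∃ λ β → β ∈ K × SpannedBy β
    choose (p₀ , p₁ , h) with p₁ ℚₚ.≟ 0ℚ
    ... | no p₁≢0 = e₀ , E.member zero , λ z∈K → let q₀ , q₁ , k = spanning z∈K in
      _ , _ , ≈-trans k (eliminated p₀ p₁ q₀ q₁ e₀ e₁ (1/ p₁) (ℚₚ.*-inverseʳ p₁) h)
      where instance
        _ : ℚ.NonZero p₁
        _ = ℚ.≢-nonZero p₁≢0
    ... | yes refl with p₀ ℚₚ.≟ 0ℚ
    ... | no p₀≢0 = e₁ , E.member (suc zero) , λ z∈K → let q₀ , q₁ , k = spanning z∈K in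
      _ , _ , ≈-trans k (≈-trans (ℂ-Algebra.swap-sum (fromℚ q₀ * e₀) (fromℚ q₁ * e₁))
        (eliminated 0ℚ p₀ q₁ q₀ e₁ e₀ (1/ p₀) (ℚₚ.*-inverseʳ p₀)
          (≈-trans h (ℂ-Algebra.swap-sum (fromℚ p₀ * e₀) (fromℚ 0ℚ * e₁)))))
      where instance
        _ : ℚ.NonZero p₀
        _ = ℚ.≢-nonZero p₀≢0
    ... | yes refl = contradiction (≈-trans h (ℂ-Algebra.zero-combination e₀ e₁)) 1ᶜ≉0ᶜ

    -- With β² = u + vβ and 4u + v² = m / n, the generator γ = n (2β − v)
    -- satisfies γ² = n m ∈ ℤ.
    integral-generator : (∃ λ β → β ∈ K × SpannedBy β) → ∃ λ γ → γ ∈ K × SpannedBy γ × ∃ λ d → γ * γ ≈ fromℤ d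
    integral-generator (β , β∈K , span) =
      let u , v , β² = span (K.mul β∈K β∈K)
          R = ℂ-Algebra.4ℚ ℚ.* u ℚ.+ v ℚ.* v
          n = ιℕ (↧ₙ R)
          s , ns≡1 = ι-reciprocal (ℚ.denominator-1 R)
      in fromℚ n * ((β + β) + - fromℚ v)
       , K.mul (ℚ∈subfield isSubfield n) (K.add (K.add β∈K β∈K) (K.neg (ℚ∈subfield isSubfield v)))
       , (λ z∈K → let x , y , h = span z∈K in
           x ℚ.+ ½ ℚ.* (y ℚ.* v) , ½ ℚ.* (y ℚ.* s) ,
           ≈-trans h (≈-trans (ℂ-Algebra.change-generator (fromℚ x) (fromℚ y) β (fromℚ v) (fromℚ n)
                 (fromℚ s) (≈-trans (≈-sym (fromℚ-* n s)) (fromℚ-cong ns≡1)))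
             (+-cong (≈-sym (≈-trans (fromℚ-+ x (½ ℚ.* (y ℚ.* v)))
                   (+-cong (≈-refl {fromℚ x}) (≈-trans (fromℚ-* ½ (y ℚ.* v))
                   (*-cong (≈-refl {fromℚ ½}) (fromℚ-* y v))))))
               (*-cong (≈-sym (≈-trans (fromℚ-* ½ (y ℚ.* s))
                     (*-cong (≈-refl {fromℚ ½}) (fromℚ-* y s))))
                     (≈-refl {fromℚ n * ((β + β) + - fromℚ v)})))))
       , + ↧ₙ R ℤ.* ℚ.↥ R
       , ≈-trans (ℂ-Algebra.complete-square β (fromℚ u) (fromℚ v) (fromℚ n) β²)
           (≈-trans (*-cong (≈-sym (fromℚ-* n n)) (≈-sym
                 (≈-trans (fromℚ-+ (ℂ-Algebra.4ℚ ℚ.* u) (v ℚ.* v))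
                 (+-cong (fromℚ-* ℂ-Algebra.4ℚ u) (fromℚ-* v v)))))
             (≈-trans (≈-sym (fromℚ-* (n ℚ.* n) R)) (fromℚ-cong (scaled R))))
      where
      scaled : ∀ R → ιℕ (↧ₙ R) ℚ.* ιℕ (↧ₙ R) ℚ.* R ≡ ι (+ ↧ₙ R ℤ.* ℚ.↥ R)
      scaled R = trans (ℚₚ.*-assoc (ιℕ (↧ₙ R)) (ιℕ (↧ₙ R)) R)
        (trans (cong (ιℕ (↧ₙ R) ℚ.*_) (trans (ℚₚ.*-comm (ιℕ (↧ₙ R)) R) (q*↧q≡↥q R)))
              (sym (ι-* (+ ↧ₙ R) (ℚ.↥ R))))

    signed-generator : ∀ {A : Pred ℂ 0ℓ} γ ε → γ ∈ ε • A → γ ∈ K → SpannedBy γ → ∃ λ α → α ∈ A × α ∈ PrimitiveElementOf K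
    signed-generator γ Sign.+ γ∈A γ∈K span = γ , γ∈A ,
      (λ z∈K → let u , v , h = span z∈K in resp (≈-sym h) (add (rat u) (mul (rat v) gen))) , ℚ⟨⟩⊆subfield isSubfield γ∈K
    signed-generator γ Sign.- (α , α∈A , γ≈-α) γ∈K span = α , α∈A ,
      (λ z∈K → let u , v , h = span z∈K in resp (≈-sym h) (add (rat u) (mul (rat v) (resp (≈-sym γ≈-α) (neg gen))))) ,
      ℚ⟨⟩⊆subfield isSubfield (K.resp (≈-sym (ℂ-Algebra.x≃-y⇒y≃-x γ≈-α)) (K.neg γ∈K))

  -- A generator with integral square is, up to sign, an element of `Ŝ`. The alternatives stay
  -- separate because the second one occurs only for ℚ(𝕚).
  primitive-element : (∃ λ α → α ∈ S × α ∈ PrimitiveElementOf K) ⊎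
        (∃ λ α → α ∈ ImaginaryIntegers × α ∈ PrimitiveElementOf K)
  primitive-element = from (integral-generator (choose (spanning K.one)))
    where
    from : (∃ λ γ → γ ∈ K × SpannedBy γ × ∃ λ d → γ * γ ≈ fromℤ d) →
      (∃ λ α → α ∈ S × α ∈ PrimitiveElementOf K) ⊎ (∃ λ α → α ∈ ImaginaryIntegers × α ∈ PrimitiveElementOf K)
    from (γ , γ∈K , span , d , γ²≈d) = by-sign d γ²≈d
      where
      γ∉ℝ : γ ∉ Real
      -- 1 and γ span K over ℚ, so a real γ would make all of K real.
      γ∉ℝ real = imaginary λ z∈K → let u , v , h = span z∈K in
        Real-resp (≈-sym h) (Real-+ (fromℚ u) (fromℚ v * γ) (Real-fromℚ u)
              (Real-* (fromℚ v) γ (Real-fromℚ v) real))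
      by-sign : ∀ d → γ * γ ≈ fromℤ d →
        (∃ λ α → α ∈ S × α ∈ PrimitiveElementOf K) ⊎ (∃ λ α → α ∈ ImaginaryIntegers × α ∈ PrimitiveElementOf K)
      by-sign (+ m)    sq = contradiction (nonneg-square⇒Real m γ sq) γ∉ℝ
      by-sign -[1+ k ] sq = let ε , γ∈ = negative-roots k γ γ∉ℝ sq in
        Sum.map (λ γ∈ → signed-generator {S} γ ε γ∈ γ∈K span)
              (λ γ∈ → signed-generator {ImaginaryIntegers} γ ε γ∈ γ∈K span) γ∈

-- For α = n𝕚 with n > 0, 𝕚 is the rational multiple α/n.
imaginaryInteger⇒ℚ⟨𝕚⟩ : ∀ {α} → α ∈ ImaginaryIntegers → ℚ⟨ α ⟩ ≐ ℚ⟨ 𝕚 ⟩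
imaginaryInteger⇒ℚ⟨𝕚⟩ {α} α∈@(+ suc n , _ , eq) =
  ℚ⟨⟩⊆subfield (ℚ⟨⟩-isSubfield 𝕚) (imaginaryIntegers⊆ℚ⟨𝕚⟩ α∈) ,
  let s , ns≡1 = ι-reciprocal n in
  ℚ⟨⟩⊆subfield (ℚ⟨⟩-isSubfield α) (resp
    (≈-sym (ℂ-Algebra.divide-factor (fromℤ (+ suc n)) (fromℚ s) 𝕚
          (≈-trans (≈-sym (fromℚ-* (ιℕ (suc n)) s)) (fromℚ-cong ns≡1)) eq))
    (mul (rat s) gen))
imaginaryInteger⇒ℚ⟨𝕚⟩ (+ zero , ℤ.+<+ () , _)

theorem8 : {ℓ : Level} →
    ( IsDisjointUnion (QuadraticInteger ∩ ℂ∖ℝ)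
    (λ ((n , ε) : ℤ × Sign) → ε • Ŝ ⊕ n)
    × IsDisjointUnion ((QuadraticInteger ∩ ℂ∖ℝ) ∖ ℚ⟨ 𝕚 ⟩)
    (λ ((n , ε) : ℤ × Sign) → ε • S ⊕ n) )
    ×
    ( (∀ (K : Pred ℂ ℓ) → IsImaginaryQuadraticField K →
    ∃ λ α → α ∈ Ŝ × α ∈ PrimitiveElementOf K)
    × (∀ (K : Pred ℂ ℓ) → IsImaginaryQuadraticField K → ¬ (K ≐ ℚ⟨ 𝕚 ⟩) →
    ∃ λ α → α ∈ S × α ∈ PrimitiveElementOf K) )
theorem8 =
  (quadraticIntegers-decomposition , nongaussian-decomposition) ,
  (λ K isIQF → Sum.[ (λ (α , α∈S , K≐) → α , inj₁ α∈S , K≐)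
                   , (λ (α , α∈T , K≐) → α , inj₂ α∈T , K≐) ]′ (primitive-element K isIQF)) ,
  (λ K isIQF K≢ℚ⟨𝕚⟩ → Sum.[ (λ found → found)
                          -- A generator m𝕚 would give K = ℚ(𝕚), the excluded field.
                          , (λ (α , α∈T , K⊆ , ⊆K) → let ⊆𝕚 , 𝕚⊆ = imaginaryInteger⇒ℚ⟨𝕚⟩ α∈T in
                              Empty.⊥-elim (K≢ℚ⟨𝕚⟩ ((λ z∈K → ⊆𝕚 (K⊆ z∈K)) , λ z∈ → ⊆K (𝕚⊆ z∈)))) ]′ (primitive-element K isIQF))
  where open ImaginaryQuadraticField using (primitive-element)
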